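{- Work in $\mathsf{ZF}$ (Zermelo–Fraenkel set theory without the Axiom of Choice). Assume the Nielsen–Schreier principle $\mathsf{NS}$: if $F$ is a free group and $K\leq F$ is a subgroup, then $K$ is a free group. Then $\mathsf{AC}_{fin}$ holds: every set of non-empty finite sets has a choice function.
   Context: A group $G$ is free if it is isomorphic to the free group $F(X)$ on some set $X$, where $F(X)$ consists of all reduced words in the letters $X\cup X^{ - }$ (with $X^-=\{x^{ -1}:x\in X\}$ a set of formal inverses disjoint from $X$), with group operation concatenation followed by reduction. A choice function for a family $Y$ of non-empty sets is a function $c$ on $Y$ with $c(y)\in y$ for all $y\in Y$. The statement is that $\mathsf{ZF}\vdash \mathsf{NS}\Rightarrow\mathsf{AC}_{fin}$. -}

module Defs where

open import Data.Fin.Base using (Fin; zero; suc; _↑ʳ_; lift)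
open import Data.List.Base using (List; []; _∷_; map)
open import Data.List.Membership.Propositional using (_∈_)
open import Data.Nat.Base using (ℕ; zero; suc; _+_)
open import Function.Base using (id)

private
  variable
    n m : ℕ

------------------------------------------------------------------------
-- First-order classical logic with equality over the language {∈}
------------------------------------------------------------------------

infix  8 _≐_ _ϵ_
infix  7 ~_
infixr 6 _∧_
infixr 5 _∨_
infixr 4 _⇒_
infix  3 _⇔_

-- Formula n: formulas with free variables among n de Bruijn indices.  The
-- language has no function symbols, so variables are the only terms.  The
-- remaining connectives are classically defined from ⊥ᶠ, ⇒ and ∀ᶠ.
data Formula (n : ℕ) : Set where
  _≐_ _ϵ_ : Fin n → Fin n → Formula n
  ⊥ᶠ      : Formula n
  _⇒_     : Formula n → Formula n → Formula n
  ∀ᶠ      : Formula (suc n) → Formula n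

Sentence : Set
Sentence = Formula 0

~_ : Formula n → Formula n
~ φ = φ ⇒ ⊥ᶠ

_∧_ _∨_ _⇔_ : Formula n → Formula n → Formula n
φ ∧ ψ = ~ (φ ⇒ ~ ψ)
φ ∨ ψ = ~ φ ⇒ ψ
φ ⇔ ψ = (φ ⇒ ψ) ∧ (ψ ⇒ φ)

∃ᶠ : Formula (suc n) → Formula n
∃ᶠ φ = ~ ∀ᶠ (~ φ)

-- Substitution of variables for variables.
ren : (Fin n → Fin m) → Formula n → Formula m
ren ρ (x ≐ y) = ρ x ≐ ρ y
ren ρ (x ϵ y) = ρ x ϵ ρ y
ren ρ ⊥ᶠ      = ⊥ᶠ
ren ρ (φ ⇒ ψ) = ren ρ φ ⇒ ren ρ ψ
ren ρ (∀ᶠ φ)  = ∀ᶠ (ren (lift 1 ρ) φ)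

infixr 5 _▸_
_▸_ : Fin m → (Fin n → Fin m) → Fin (suc n) → Fin m
(x ▸ ρ) zero    = x
(x ▸ ρ) (suc i) = ρ i

infix 9 _[_]
_[_] : Formula (suc n) → Fin n → Formula n
φ [ x ] = ren (x ▸ id) φ

∀-closure : ∀ {n} → Formula n → Sentence
∀-closure {zero}  φ = φ
∀-closure {suc n} φ = ∀-closure (∀ᶠ φ)

-- Classical natural deduction from the sentences of T and the hypotheses Γ.
-- A formula in Formula 0 has no variable at which to instantiate, so the
-- calculus does not presuppose a non-empty universe; for ZF this makes no
-- difference, because Infinity asserts that some set exists.
infix 2 _∣_⊢_
data _∣_⊢_ (T : Sentence → Set) {n : ℕ} (Γ : List (Formula n)) : Formula n → Set where
  axiom   : ∀ {σ} → T σ → T ∣ Γ ⊢ ren (λ ()) σ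
  hyp     : ∀ {φ} → φ ∈ Γ → T ∣ Γ ⊢ φ
  ⇒-intro : ∀ {φ ψ} → T ∣ φ ∷ Γ ⊢ ψ → T ∣ Γ ⊢ φ ⇒ ψ
  ⇒-elim  : ∀ {φ ψ} → T ∣ Γ ⊢ φ ⇒ ψ → T ∣ Γ ⊢ φ → T ∣ Γ ⊢ ψ
  raa     : ∀ {φ} → T ∣ ~ φ ∷ Γ ⊢ ⊥ᶠ → T ∣ Γ ⊢ φ
  ∀-intro : ∀ {φ} → T ∣ map (ren suc) Γ ⊢ φ → T ∣ Γ ⊢ ∀ᶠ φ
  ∀-elim  : ∀ {φ} → T ∣ Γ ⊢ ∀ᶠ φ → (x : Fin n) → T ∣ Γ ⊢ φ [ x ]
  ≐-refl  : ∀ {x} → T ∣ Γ ⊢ x ≐ x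
  ≐-subst : ∀ φ {x y} → T ∣ Γ ⊢ x ≐ y → T ∣ Γ ⊢ φ [ x ] → T ∣ Γ ⊢ φ [ y ]

infix 2 _⊢_
_⊢_ : (Sentence → Set) → Sentence → Set
T ⊢ σ = T ∣ [] ⊢ σ

------------------------------------------------------------------------
-- Notation: blocks of quantifiers with named variables.  A variable x from
-- outside a block of k quantifiers is written x ↑ k inside it.
------------------------------------------------------------------------

infix 9 _↑_
_↑_ : Fin n → (k : ℕ) → Fin (k + n)
x ↑ k = k ↑ʳ x

∀₁ ∃₁ : (Fin (1 + n) → Formula (1 + n)) → Formula n
∀₁ φ = ∀ᶠ (φ zero)
∃₁ φ = ∃ᶠ (φ zero)

∀₂ ∃₂ : (Fin (2 + n) → Fin (2 + n) → Formula (2 + n)) → Formula n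
∀₂ φ = ∀₁ λ x → ∀₁ λ y → φ (x ↑ 1) y
∃₂ φ = ∃₁ λ x → ∃₁ λ y → φ (x ↑ 1) y

∀₃ ∃₃ : (Fin (3 + n) → Fin (3 + n) → Fin (3 + n) → Formula (3 + n)) → Formula n
∀₃ φ = ∀₂ λ x y → ∀₁ λ z → φ (x ↑ 1) (y ↑ 1) z
∃₃ φ = ∃₂ λ x y → ∃₁ λ z → φ (x ↑ 1) (y ↑ 1) z

∀₄ ∃₄ : (Fin (4 + n) → Fin (4 + n) → Fin (4 + n) → Fin (4 + n) → Formula (4 + n)) →
        Formula n
∀₄ φ = ∀₂ λ x y → ∀₂ λ z w → φ (x ↑ 2) (y ↑ 2) z w
∃₄ φ = ∃₂ λ x y → ∃₂ λ z w → φ (x ↑ 2) (y ↑ 2) z w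

-- "for all x in a" and "for some x in a"
∀∈ ∃∈ : Fin n → (Fin (1 + n) → Formula (1 + n)) → Formula n
∀∈ a φ = ∀₁ λ x → x ϵ a ↑ 1 ⇒ φ x
∃∈ a φ = ∃₁ λ x → x ϵ a ↑ 1 ∧ φ x

-- "there is exactly one x"
∃! : (∀ {m} → (Fin n → Fin m) → Fin m → Formula m) → Formula n
∃! φ = ∃₁ λ x → φ (_↑ 1) x ∧ ∀₁ λ y → φ (_↑ 2) y ⇒ y ≐ x ↑ 1

------------------------------------------------------------------------
-- Basic set-theoretic notions
------------------------------------------------------------------------

infix 8 _⊆_
_⊆_ : Fin n → Fin n → Formula n
x ⊆ y = ∀∈ x λ z → z ϵ y ↑ 1

IsEmpty : Fin n → Formula n
IsEmpty x = ∀₁ λ z → ~ z ϵ x ↑ 1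

-- s = x ∪ {x}
IsSuccessor : (s x : Fin n) → Formula n
IsSuccessor s x = ∀₁ λ z → z ϵ s ↑ 1 ⇔ (z ϵ x ↑ 1 ∨ z ≐ x ↑ 1)

IsInductive : Fin n → Formula n
IsInductive a = (∃∈ a λ e → IsEmpty e) ∧ (∀∈ a λ x → ∃∈ (a ↑ 1) λ s → IsSuccessor s (x ↑ 1))

-- p = {x , y}
IsPair : (p x y : Fin n) → Formula n
IsPair p x y = ∀₁ λ z → z ϵ p ↑ 1 ⇔ (z ≐ x ↑ 1 ∨ z ≐ y ↑ 1)

-- p = ⟨x , y⟩ = {{x} , {x , y}}
IsOPair : (p x y : Fin n) → Formula n
IsOPair p x y =
  ∃₂ λ a b → IsPair a (x ↑ 2) (x ↑ 2) ∧ IsPair b (x ↑ 2) (y ↑ 2) ∧ IsPair (p ↑ 2) a b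

-- ⟨x , y⟩ ∈ r
Related : (r x y : Fin n) → Formula n
Related r x y = ∃∈ r λ p → IsOPair p (x ↑ 1) (y ↑ 1)

-- c = a × b
IsProduct : (c a b : Fin n) → Formula n
IsProduct c a b =
  ∀₁ λ p → p ϵ c ↑ 1 ⇔ (∃₂ λ x y → x ϵ a ↑ 3 ∧ y ϵ b ↑ 3 ∧ IsOPair (p ↑ 2) x y)

-- f : a → b
IsFunction : (f a b : Fin n) → Formula n
IsFunction f a b =
  (∀∈ f λ p → ∃₂ λ x y → x ϵ a ↑ 3 ∧ y ϵ b ↑ 3 ∧ IsOPair (p ↑ 2) x y) ∧
  (∀∈ a λ x → ∃! λ wk y → Related (wk (f ↑ 1)) (wk x) y)

IsBijection : (f a b : Fin n) → Formula n
IsBijection f a b =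
  IsFunction f a b ∧ (∀∈ b λ y → ∃! λ wk x → Related (wk (f ↑ 1)) x (wk y))

-- k is a natural number, i.e. an element of ω, the least inductive set.
IsNatural : Fin n → Formula n
IsNatural k = ∀₁ λ i → IsInductive i ⇒ k ↑ 1 ϵ i

IsFinite : Fin n → Formula n
IsFinite a = ∃₂ λ k f → IsNatural k ∧ IsBijection f (a ↑ 2) k

------------------------------------------------------------------------
-- The axioms of ZF
------------------------------------------------------------------------

extensionality foundation pairing union powerset infinity : Sentence
extensionality = ∀₂ λ x y → (∀₁ λ z → z ϵ x ↑ 1 ⇔ z ϵ y ↑ 1) ⇒ x ≐ y
foundation     = ∀₁ λ x → (∃₁ λ y → y ϵ x ↑ 1) ⇒
                   (∃∈ x λ y → ~ (∃₁ λ z → z ϵ x ↑ 2 ∧ z ϵ y ↑ 1))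
pairing        = ∀₂ λ x y → ∃₁ λ p → IsPair p (x ↑ 1) (y ↑ 1)
union          = ∀₁ λ x → ∃₁ λ u → ∀₁ λ z → z ϵ u ↑ 1 ⇔ (∃∈ (x ↑ 2) λ y → z ↑ 1 ϵ y)
powerset       = ∀₁ λ x → ∃₁ λ p → ∀₁ λ z → z ϵ p ↑ 1 ⇔ z ⊆ x ↑ 2
infinity       = ∃₁ λ a → IsInductive a

-- φ(z , parameters), with z the variable of index 0.
separation : Formula (1 + n) → Sentence
separation φ = ∀-closure (∀₁ λ x → ∃₁ λ y → ∀₁ λ z →
  z ϵ y ↑ 1 ⇔ (z ϵ x ↑ 2 ∧ ren (z ▸ (_↑ 3)) φ))

-- φ(x , y , parameters), with x, y the variables of index 0, 1.
replacement : Formula (2 + n) → Sentence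
replacement φ = ∀-closure (∀₁ λ a →
  (∀₃ λ x y y′ → x ϵ a ↑ 3 ∧ ren (x ▸ y ▸ (_↑ 4)) φ ∧ ren (x ▸ y′ ▸ (_↑ 4)) φ ⇒ y ≐ y′) ⇒
  (∃₁ λ b → ∀₁ λ y → y ϵ b ↑ 1 ⇔ (∃∈ (a ↑ 2) λ x → ren (x ▸ y ↑ 1 ▸ (_↑ 4)) φ)))

data ZF : Sentence → Set where
  zf-extensionality : ZF extensionality
  zf-foundation     : ZF foundation
  zf-pairing        : ZF pairing
  zf-union          : ZF union
  zf-powerset       : ZF powerset
  zf-infinity       : ZF infinity
  zf-separation     : ∀ {n} (φ : Formula (1 + n)) → ZF (separation φ)
  zf-replacement    : ∀ {n} (φ : Formula (2 + n)) → ZF (replacement φ)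

------------------------------------------------------------------------
-- Groups.  A group is given by its carrier g and its operation, a
-- function m : g × g → g.
------------------------------------------------------------------------

-- m(a , b) = c
Mult : (m a b c : Fin n) → Formula n
Mult m a b c = ∃₁ λ p → IsOPair p (a ↑ 1) (b ↑ 1) ∧ Related (m ↑ 1) p (c ↑ 1)

IsGroup : (g m : Fin n) → Formula n
IsGroup g m =
  (∃₁ λ s → IsProduct s (g ↑ 1) (g ↑ 1) ∧ IsFunction (m ↑ 1) s (g ↑ 1)) ∧
  (∀₃ λ a b c → a ϵ g ↑ 3 ∧ b ϵ g ↑ 3 ∧ c ϵ g ↑ 3 ⇒
    (∀₃ λ ab bc d →
      Mult (m ↑ 6) (a ↑ 3) (b ↑ 3) ab ∧ Mult (m ↑ 6) (b ↑ 3) (c ↑ 3) bc ∧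
      Mult (m ↑ 6) ab (c ↑ 3) d ⇒ Mult (m ↑ 6) (a ↑ 3) bc d)) ∧
  (∃∈ g λ e →
    (∀∈ (g ↑ 1) λ a → Mult (m ↑ 2) (e ↑ 1) a a ∧ Mult (m ↑ 2) a (e ↑ 1) a) ∧
    (∀∈ (g ↑ 1) λ a → ∃∈ (g ↑ 2) λ b →
      Mult (m ↑ 3) (a ↑ 1) b (e ↑ 2) ∧ Mult (m ↑ 3) b (a ↑ 1) (e ↑ 2)))

-- (k , l) ≤ (g , m): k ⊆ g is a group under the operation inherited from g.
-- As l is a function on k × k, l ⊆ m says that l is the restriction of m.
IsSubgroup : (k l g m : Fin n) → Formula n
IsSubgroup k l g m = IsGroup k l ∧ k ⊆ g ∧ l ⊆ m

-- f : (g , m) ≅ (h , l)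
IsIsomorphism : (f g m h l : Fin n) → Formula n
IsIsomorphism f g m h l =
  IsBijection f g h ∧
  (∀₃ λ a b c → Mult (m ↑ 3) a b c ⇒
    (∀₃ λ a′ b′ c′ →
      Related (f ↑ 6) (a ↑ 3) a′ ∧ Related (f ↑ 6) (b ↑ 3) b′ ∧ Related (f ↑ 6) (c ↑ 3) c′ ⇒
      Mult (l ↑ 6) a′ b′ c′))

------------------------------------------------------------------------
-- Words over X ∪ X⁻.  The letter x is coded as ⟨x , 0⟩ and x⁻¹ as ⟨x , 1⟩.
-- The empty word is ∅, and the word consisting of the letter a followed by
-- the word w is ⟨a , w⟩.
------------------------------------------------------------------------

-- a is the letter x
IsPositive : (a x : Fin n) → Formula n
IsPositive a x = ∃₁ λ e → IsEmpty e ∧ IsOPair (a ↑ 1) (x ↑ 1) e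

-- a is the letter x⁻¹
IsNegative : (a x : Fin n) → Formula n
IsNegative a x = ∃₂ λ e i → IsEmpty e ∧ IsSuccessor i e ∧ IsOPair (a ↑ 2) (x ↑ 2) i

-- a ∈ X ∪ X⁻
IsLetter : (X a : Fin n) → Formula n
IsLetter X a = ∃∈ X λ x → IsPositive (a ↑ 1) x ∨ IsNegative (a ↑ 1) x

AreInverseLetters : (X a b : Fin n) → Formula n
AreInverseLetters X a b = ∃∈ X λ x →
  (IsPositive (a ↑ 1) x ∧ IsNegative (b ↑ 1) x) ∨ (IsNegative (a ↑ 1) x ∧ IsPositive (b ↑ 1) x)

-- w belongs to the least set containing the empty word and closed under
-- prefixing a letter.
IsWord : (X w : Fin n) → Formula n
IsWord X w = ∀₁ λ S →
  (∃∈ S λ e → IsEmpty e) ∧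
  (∀₃ λ a v av → IsLetter (X ↑ 4) a ∧ v ϵ S ↑ 3 ∧ IsOPair av a v ⇒ av ϵ S ↑ 3) ⇒
  w ↑ 1 ϵ S

-- w = u v, for words u, v over X ∪ X⁻: for fixed v, the graph of u ↦ u v is
-- the least R with ⟨∅ , v⟩ ∈ R that contains ⟨a u , a w⟩ whenever it contains
-- ⟨u , w⟩.
IsConcat : (X u v w : Fin n) → Formula n
IsConcat X u v w = IsWord X u ∧ IsWord X v ∧ (∀₁ λ R →
  (∃₁ λ e → IsEmpty e ∧ Related (R ↑ 1) e (v ↑ 2)) ∧
  (∀₃ λ a p q → IsLetter (X ↑ 4) a ∧ Related (R ↑ 3) p q ⇒
    (∀₂ λ ap aq → IsOPair ap (a ↑ 2) (p ↑ 2) ∧ IsOPair aq (a ↑ 2) (q ↑ 2) ⇒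
      Related (R ↑ 5) ap aq)) ⇒
  Related R (u ↑ 1) (w ↑ 1))

-- w = p a b q and v = p q for words p, q and mutually inverse letters a, b.
Cancels : (X w v : Fin n) → Formula n
Cancels X w v = ∃₂ λ p q → IsConcat (X ↑ 2) p q (v ↑ 2) ∧
  (∃₄ λ a b bq abq →
    AreInverseLetters (X ↑ 6) a b ∧ IsOPair bq b (q ↑ 4) ∧ IsOPair abq a bq ∧
    IsConcat (X ↑ 6) (p ↑ 4) abq (w ↑ 6))

IsReducedWord : (X w : Fin n) → Formula n
IsReducedWord X w = IsWord X w ∧ ~ (∃₁ λ v → Cancels (X ↑ 1) (w ↑ 1) v)

-- v arises from w by finitely many cancellations and is reduced.
IsReductionOf : (X v w : Fin n) → Formula n
IsReductionOf X v w =
  IsReducedWord X v ∧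
  (∀₁ λ S → w ↑ 1 ϵ S ∧ (∀₂ λ s t → s ϵ S ↑ 2 ∧ Cancels (X ↑ 3) s t ⇒ t ϵ S ↑ 2) ⇒ v ↑ 1 ϵ S)

-- (W , M) is the free group F(X): W is the set of reduced words, and M is
-- concatenation followed by reduction.
IsFreeGroupOn : (X W M : Fin n) → Formula n
IsFreeGroupOn X W M =
  (∀₁ λ w → w ϵ W ↑ 1 ⇔ IsReducedWord (X ↑ 1) w) ∧
  (∀₁ λ t → t ϵ M ↑ 1 ⇔
    (∃₃ λ u v w → u ϵ W ↑ 4 ∧ v ϵ W ↑ 4 ∧
      (∃₁ λ uv → IsConcat (X ↑ 5) (u ↑ 1) (v ↑ 1) uv ∧ IsReductionOf (X ↑ 5) (w ↑ 1) uv) ∧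
      (∃₁ λ p → IsOPair p (u ↑ 1) (v ↑ 1) ∧ IsOPair (t ↑ 4) p (w ↑ 1))))

IsFree : (g m : Fin n) → Formula n
IsFree g m = IsGroup g m ∧
  (∃₄ λ X W M f → IsFreeGroupOn X W M ∧ IsIsomorphism f (g ↑ 4) (m ↑ 4) W M)

------------------------------------------------------------------------
-- The two principles
------------------------------------------------------------------------

-- Nielsen–Schreier
NS : Sentence
NS = ∀₄ λ F m K l → IsFree F m ∧ IsSubgroup K l F m ⇒ IsFree K l

IsChoiceFunction : (c Y : Fin n) → Formula n
IsChoiceFunction c Y =
  (∃₁ λ b → IsFunction (c ↑ 1) (Y ↑ 1) b) ∧
  (∀∈ Y λ y → ∃∈ y λ z → Related (c ↑ 2) (y ↑ 1) z)

ACfin : Sentence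
ACfin = ∀₁ λ Y →
  (∀∈ Y λ y → (∃₁ λ z → z ϵ y ↑ 1) ∧ IsFinite y) ⇒ (∃₁ λ c → IsChoiceFunction c (Y ↑ 1))

{-# OPTIONS --safe #-}

-- By completeness it is enough to argue in the models of ZF, where falsity may be inhabited;
-- this generality, due to Krivine, is what makes the completeness theorem constructive.
--
-- Let X be the disjoint union of the members of Y, and let K ≤ F(X) be the kernel of the action
-- of F(X) on Y × 2 in which a letter over y flips the bit attached to y.  For y ∈ Y all the
-- one-letter words z with z ∈ y lie in the same coset K z.  If K is free on B, then this coset is
-- the vertex set of a tree, the Cayley graph of K with respect to B.  Consider the vertices whose
-- greatest distance to the finite set y is least.  Two of them are at distance at most 1, since
-- otherwise the vertex next to one of them on the path to the other would be nearer to all of y.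
-- Edges are oriented, so there is a unique such vertex at which no edge from another one ends.
-- It is a word in which the number of letters over y is odd, and the first of these letters is
-- the chosen element of y.  Bounds on distances are expressed as membership in balls, which
-- avoids arithmetic.
module Submission where

open import Defs
open import Data.Fin.Base using (Fin; zero; suc; lift; _↑ˡ_; _↑ʳ_; splitAt; join)
open import Data.Fin.Properties using (join-splitAt)
open import Data.List.Base as List using (List; []; _∷_; map)
open import Data.List.Membership.Propositional.Properties using (∈-map⁺)
open import Data.List.Properties using (map-∘; map-cong)
open import Data.List.Relation.Binary.Subset.Propositional as Sub using ()
open import Data.List.Relation.Binary.Subset.Propositional.Properties using (map⁺; ∷⁺ʳ; xs⊆xs++ys; xs⊆ys++xs)
open import Data.List.Relation.Unary.All as All using (All; []; _∷_)
import Data.List.Relation.Unary.All.Properties as All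
open import Data.List.Relation.Unary.Any using (here; there)
open import Data.Nat.Base using (ℕ; zero; suc; _+_; _≤_; _<_; z≤n; s≤s; _⊔_; _≤′_; ≤′-refl; ≤′-step)
open import Data.Nat.Properties using (+-comm; +-suc; +-identityʳ; ≤-trans; ≤-refl; <-irrefl; n<1+n; m<n⇒m<1+n;
  m≤m+n; _≤?_; m⊔n≤o⇒m≤o; m⊔n≤o⇒n≤o; m≤n⇒m≤1+n; ≤⇒≤′; ≤′⇒≤)
open import Data.Product.Base using (Σ; _×_; _,_; proj₁; proj₂)
open import Data.Sum.Base using (_⊎_; inj₁; inj₂; [_,_]′)
open import Data.Vec.Base using (Vec; []; _∷_; lookup; _++_; tabulate; head; tail)
open import Data.Vec.Properties using (lookup-++ˡ; lookup-++ʳ; tabulate∘lookup; tabulate-cong; lookup∘tabulate)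
open import Function.Base using (_∘_; id; case_of_)
open import Relation.Binary.PropositionalEquality using (_≡_; refl; sym; trans; cong; cong₂; subst)
open import Relation.Nullary using (Dec; yes; no; contradiction)

-- The tree replaces choice: one basis of `K` puts a tree structure on all the relevant cosets at
-- once, and everything after that is defined uniformly in `y`. Finiteness of `y` is used at a
-- single point, to find some ball that covers it.
--
-- Two demands on `K` pull in opposite directions. It must be large enough to put all of `y` into
-- one coset, and small enough that no word of that coset can lose all its letters over `y`, because
-- the central vertex need not be one of the one-letter words from which the tree was measured.
-- Recording nothing but a parity for each `y` meets both.
--
-- The formal obstacle is that the schemas of ZF speak about first-order formulas only. In a Henkin
-- model existential statements become Σ-types with actual witnesses, so that the mathematics can be
-- written in ordinary Agda. Each predicate used in Separation, Replacement or an induction then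
-- carries a certificate of definability.

private
  variable
    n m k j : ℕ

-- Renaming of variables and structural rules for derivations

ren-∘ : ∀ {n m k} {ρ : Fin m → Fin k} {σ : Fin n → Fin m} {τ : Fin n → Fin k} →
        (∀ i → ρ (σ i) ≡ τ i) → ∀ φ → ren ρ (ren σ φ) ≡ ren τ φ
ren-∘ h (x ≐ y) = cong₂ _≐_ (h x) (h y)
ren-∘ h (x ϵ y) = cong₂ _ϵ_ (h x) (h y)
ren-∘ h ⊥ᶠ      = refl
ren-∘ h (φ ⇒ ψ) = cong₂ _⇒_ (ren-∘ h φ) (ren-∘ h ψ)
ren-∘ h (∀ᶠ φ)  = cong ∀ᶠ (ren-∘ (λ { zero → refl ; (suc i) → cong suc (h i) }) φ)

ren-id : {ρ : Fin n → Fin n} → (∀ i → ρ i ≡ i) → ∀ φ → ren ρ φ ≡ φ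
ren-id h (x ≐ y) = cong₂ _≐_ (h x) (h y)
ren-id h (x ϵ y) = cong₂ _ϵ_ (h x) (h y)
ren-id h ⊥ᶠ      = refl
ren-id h (φ ⇒ ψ) = cong₂ _⇒_ (ren-id h φ) (ren-id h ψ)
ren-id h (∀ᶠ φ)  = cong ∀ᶠ (ren-id (λ { zero → refl ; (suc i) → cong suc (h i) }) φ)

ren-cong : {ρ σ : Fin n → Fin m} → (∀ i → ρ i ≡ σ i) → ∀ φ → ren ρ φ ≡ ren σ φ
ren-cong h φ = trans (sym (ren-id (λ _ → refl) (ren _ φ))) (ren-∘ h φ)

ren-[] : (σ : Fin n → Fin m) (φ : Formula (suc n)) (x : Fin n) →
         ren σ (φ [ x ]) ≡ ren (lift 1 σ) φ [ σ x ]
ren-[] σ φ x = trans (ren-∘ (λ _ → refl) φ)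
  (sym (ren-∘ (λ { zero → refl ; (suc i) → refl }) φ))

module _ {T : Sentence → Set} where

  ⊢-weaken : {Γ Δ : List (Formula n)} {φ : Formula n} → Γ Sub.⊆ Δ → T ∣ Γ ⊢ φ → T ∣ Δ ⊢ φ
  ⊢-weaken s (axiom t)       = axiom t
  ⊢-weaken s (hyp h)         = hyp (s h)
  ⊢-weaken s (⇒-intro d)     = ⇒-intro (⊢-weaken (∷⁺ʳ _ s) d)
  ⊢-weaken s (⇒-elim d e)    = ⇒-elim (⊢-weaken s d) (⊢-weaken s e)
  ⊢-weaken s (raa d)         = raa (⊢-weaken (∷⁺ʳ _ s) d)
  ⊢-weaken s (∀-intro d)     = ∀-intro (⊢-weaken (map⁺ _ s) d)
  ⊢-weaken s (∀-elim d x)    = ∀-elim (⊢-weaken s d) x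
  ⊢-weaken s ≐-refl          = ≐-refl
  ⊢-weaken s (≐-subst φ d e) = ≐-subst φ (⊢-weaken s d) (⊢-weaken s e)

  ⊢-ren : {Γ : List (Formula n)} {φ : Formula n} (σ : Fin n → Fin m) →
          T ∣ Γ ⊢ φ → T ∣ map (ren σ) Γ ⊢ ren σ φ
  ⊢-ren σ (axiom {s} t)   = subst (T ∣ _ ⊢_) (sym (ren-∘ (λ ()) s)) (axiom t)
  ⊢-ren σ (hyp h)         = hyp (∈-map⁺ _ h)
  ⊢-ren σ (⇒-intro d)     = ⇒-intro (⊢-ren σ d)
  ⊢-ren σ (⇒-elim d e)    = ⇒-elim (⊢-ren σ d) (⊢-ren σ e)
  ⊢-ren σ (raa d)         = raa (⊢-ren σ d)
  ⊢-ren {Γ = Γ} σ (∀-intro {φ} d) = ∀-intro (subst (T ∣_⊢ _) eq (⊢-ren (lift 1 σ) d))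
    where
    eq : map (ren (lift 1 σ)) (map (ren suc) Γ) ≡ map (ren suc) (map (ren σ) Γ)
    eq = trans (sym (map-∘ Γ)) (trans
      (map-cong (λ ψ → trans (ren-∘ (λ _ → refl) ψ) (sym (ren-∘ (λ _ → refl) ψ))) Γ) (map-∘ Γ))
  ⊢-ren σ (∀-elim {φ} d x) = subst (T ∣ _ ⊢_) (sym (ren-[] σ φ x)) (∀-elim (⊢-ren σ d) (σ x))
  ⊢-ren σ ≐-refl          = ≐-refl
  ⊢-ren σ (≐-subst φ {x} {y} d e) = subst (T ∣ _ ⊢_) (sym (ren-[] σ φ y))
    (≐-subst (ren (lift 1 σ) φ) (⊢-ren σ d) (subst (T ∣ _ ⊢_) (ren-[] σ φ x) (⊢-ren σ e)))

-- Enumeration of formulas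

-- Moves along the antidiagonals of ℕ × ℕ.
step : ℕ × ℕ → ℕ × ℕ
step (zero  , b) = suc b , 0
step (suc a , b) = a , suc b

walk : ℕ → ℕ × ℕ
walk zero    = 0 , 0
walk (suc n) = step (walk n)

-- The bound `a + b ≤ n` matters as much as surjectivity: it ensures that a formula over `k`
-- variables is scheduled no earlier than stage `k`.
Reached : ℕ × ℕ → Set
Reached (a , b) = Σ ℕ λ n → a + b ≤ n × walk n ≡ (a , b)

reached-down : ∀ b a → Reached (b + a , 0) → Reached (a , b)
reached-down zero    a r = r
reached-down (suc b) a r
  with reached-down b (suc a) (subst (λ x → Reached (x , 0)) (sym (+-suc b a)) r)
... | n , le , eq = suc n , subst (_≤ suc n) (sym (+-suc a b)) (m≤n⇒m≤1+n le) , cong step eq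

reached-axis : ∀ s → Reached (s , 0)
reached-axis zero    = 0 , z≤n , refl
reached-axis (suc s)
  with reached-down s 0 (subst (λ x → Reached (x , 0)) (sym (+-identityʳ s)) (reached-axis s))
... | n , le , eq = suc n , s≤s (subst (_≤ n) (sym (+-identityʳ s)) le) , cong step eq

reached : ∀ p → Reached p
reached (a , b) = reached-down b a (reached-axis (b + a))

finOf : ∀ k → ℕ → Fin (suc k)
finOf zero    _       = zero
finOf (suc k) zero    = zero
finOf (suc k) (suc n) = suc (finOf k n)

finOf-onto : (x : Fin (suc k)) → Σ ℕ λ n → finOf k n ≡ x
finOf-onto {zero}  zero    = 0 , refl
finOf-onto {suc k} zero    = 0 , refl
finOf-onto {suc k} (suc x) with finOf-onto x
... | n , refl = suc n , refl

atom : (∀ {k} → Fin k → Fin k → Formula k) → ∀ k → ℕ × ℕ → Formula k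
atom _∼_ zero    _       = ⊥ᶠ
atom _∼_ (suc k) (a , b) = finOf k a ∼ finOf k b

-- The depth `d` makes the recursion structural. Codes need not be unique; it suffices that every
-- formula of depth at most `d` has one.
decode     : (d k : ℕ) → ℕ → Formula k
decodeNode : (d k : ℕ) → ℕ × ℕ → Formula k
decode zero    k n = ⊥ᶠ
decode (suc d) k n = decodeNode d k (walk n)
decodeNode d k (0 , i) = ⊥ᶠ
decodeNode d k (1 , i) = atom _≐_ k (walk i)
decodeNode d k (2 , i) = atom _ϵ_ k (walk i)
decodeNode d k (3 , i) = decode d k (proj₁ (walk i)) ⇒ decode d k (proj₂ (walk i))
decodeNode d k (suc (suc (suc (suc _))) , i) = ∀ᶠ (decode d (suc k) i)

depth : Formula n → ℕ
depth (x ≐ y) = 1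
depth (x ϵ y) = 1
depth ⊥ᶠ      = 0
depth (φ ⇒ ψ) = suc (depth φ ⊔ depth ψ)
depth (∀ᶠ φ)  = suc (depth φ)

node-onto : ∀ {d t i} {φ : Formula k} → decodeNode d k (t , i) ≡ φ → Σ ℕ λ c → decode (suc d) k c ≡ φ
node-onto {k} {d} {t} {i} eq with reached (t , i)
... | c , _ , eq′ = c , trans (cong (decodeNode d k) eq′) eq

atom-onto : (_∼_ : ∀ {k} → Fin k → Fin k → Formula k) (x y : Fin k) →
            Σ ℕ λ i → atom _∼_ k (walk i) ≡ x ∼ y
atom-onto {suc k} _∼_ x y with finOf-onto x | finOf-onto y
... | a , refl | b , refl with reached (a , b)
... | i , _ , eq = i , cong (atom _∼_ (suc k)) eq

decode-onto : ∀ d (φ : Formula k) → depth φ ≤ d → Σ ℕ λ c → decode d k c ≡ φ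
decode-onto zero    ⊥ᶠ le = 0 , refl
decode-onto (suc d) ⊥ᶠ le = node-onto {t = 0} {i = 0} refl
decode-onto (suc d) (x ≐ y) le with atom-onto _≐_ x y
... | i , eq = node-onto {d = d} {t = 1} {i = i} eq
decode-onto (suc d) (x ϵ y) le with atom-onto _ϵ_ x y
... | i , eq = node-onto {d = d} {t = 2} {i = i} eq
decode-onto {k} (suc d) (φ ⇒ ψ) (s≤s le)
  with decode-onto d φ (m⊔n≤o⇒m≤o (depth φ) _ le) | decode-onto d ψ (m⊔n≤o⇒n≤o (depth φ) _ le)
... | a , eq | b , eq′ with reached (a , b)
... | i , _ , eqi = node-onto {t = 3} {i = i}
  (trans (cong (λ p → decode d k (proj₁ p) ⇒ decode d k (proj₂ p)) eqi) (cong₂ _⇒_ eq eq′))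
decode-onto (suc d) (∀ᶠ φ) (s≤s le) with decode-onto d φ le
... | i , eq = node-onto {d = d} {t = 4} {i = i} (cong ∀ᶠ eq)

-- Variables of the stages

emb : k ≤′ j → Fin k → Fin j
emb ≤′-refl     x = x
emb (≤′-step p) x = suc (emb p x)

-- The de Bruijn level, which unlike the index is the same at all later stages.
level : Fin k → ℕ
level {suc k} zero    = k
level {suc k} (suc x) = level x

level-< : (x : Fin k) → level x < k
level-< {suc k} zero    = n<1+n k
level-< {suc k} (suc x) = m<n⇒m<1+n (level-< x)

level-injective : {x y : Fin k} → level x ≡ level y → x ≡ y
level-injective {suc k} {zero}  {zero}  eq = refl
level-injective {suc k} {zero}  {suc y} eq = contradiction (level-< y) (<-irrefl (sym eq))
level-injective {suc k} {suc x} {zero}  eq = contradiction (level-< x) (<-irrefl eq)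
level-injective {suc k} {suc x} {suc y} eq = cong suc (level-injective eq)

level-emb : (p : k ≤′ j) (x : Fin k) → level (emb p x) ≡ level x
level-emb ≤′-refl     x = refl
level-emb (≤′-step p) x = level-emb p x

emb-unique : {i : ℕ} {p : k ≤′ i} {q : j ≤′ i} {x : Fin k} {y : Fin j} →
             level x ≡ level y → emb p x ≡ emb q y
emb-unique {p = p} {q} {x} {y} eq =
  level-injective (trans (level-emb p x) (trans eq (sym (level-emb q y))))

≤′-sup : ∀ k j → Σ ℕ λ m → k ≤′ m × j ≤′ m
≤′-sup k j = k + j , ≤⇒≤′ (m≤m+n k j) , ≤⇒≤′ (subst (j ≤_) (+-comm j k) (m≤m+n j k))

-- A schedule that treats every formula of every stage

module _ (shift : ℕ → ℕ) (up : ∀ {k j} → k ≤′ j → Formula (shift k) → Formula (shift j)) where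

  -- The index `j` is unpacked into a stage `k`, a depth `d` and a code `i`; an entry whose stage is
  -- still to come is replaced by `⊥ᶠ`. The parameter `shift` lets one schedule serve both the
  -- candidates, with `k` variables, and the Henkin formulas, with `suc k`.
  treatCode : ∀ j k → ℕ × ℕ → Dec (k ≤ j) → Formula (shift j)
  treatCode j k (d , i) (yes p) = up (≤⇒≤′ p) (decode d (shift k) i)
  treatCode j k (d , i) (no _)  = ⊥ᶠ

  treatPair : ∀ j → ℕ × ℕ → Formula (shift j)
  treatPair j (k , c) = treatCode j k (walk c) (k ≤? j)

  treat : ∀ j → Formula (shift j)
  treat j = treatPair j (walk j)

  treat-onto : (φ : Formula (shift k)) → Σ ℕ λ j → Σ (k ≤′ j) λ p → treat j ≡ up p φ
  treat-onto {k} φ with decode-onto _ φ ≤-refl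
  ... | i , eqi with reached (depth φ , i)
  ... | c , _ , eqc with reached (k , c)
  ... | j , le , eqj = j , proj₁ (found (k ≤? j)) ,
    trans (cong (treatPair j) eqj)
      (trans (cong (λ q → treatCode j k q (k ≤? j)) eqc) (proj₂ (found (k ≤? j))))
    where
    found : (q : Dec (k ≤ j)) → Σ (k ≤′ j) λ p → treatCode j k (depth φ , i) q ≡ up p φ
    found (yes p) = ≤⇒≤′ p , cong (up _) eqi
    found (no ¬p) = contradiction (≤-trans (m≤m+n k c) le) ¬p

-- Models with a possibly inhabited falsity

module Satisfaction (D : Set) (_∈_ _≈_ : D → D → Set) (R : Set) where

  -- R interprets falsity; it need not be empty.
  Sat : Formula n → Vec D n → Set
  Sat (x ≐ y) ρ = lookup ρ x ≈ lookup ρ y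
  Sat (x ϵ y) ρ = lookup ρ x ∈ lookup ρ y
  Sat ⊥ᶠ      ρ = R
  Sat (φ ⇒ ψ) ρ = Sat φ ρ → Sat ψ ρ
  Sat (∀ᶠ φ)  ρ = ∀ d → Sat φ (d ∷ ρ)

-- `sat-stable` makes the logic classical relative to `R`, which the arbitrary relations `_∈_` and
-- `_≈_` would not do by themselves. `sat-henkin` names a potential counterexample to each universal
-- formula; applied to negations it yields witnesses of existential ones.
record Model : Set₁ where
  infix 4 _∈_ _≈_
  field
    D       : Set
    _∈_ _≈_ : D → D → Set
    R       : Set
  open Satisfaction D _∈_ _≈_ R public
  field
    sat-stable  : (φ : Formula n) (ρ : Vec D n) → ((Sat φ ρ → R) → R) → Sat φ ρ
    ≈-refl      : ∀ {x} → x ≈ x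
    sat-leibniz : (φ : Formula (suc n)) (ρ : Vec D n) {x y : D} → x ≈ y → Sat φ (x ∷ ρ) → Sat φ (y ∷ ρ)
    sat-axiom   : {σ : Sentence} → ZF σ → Sat σ []
    sat-henkin  : (φ : Formula (suc n)) (ρ : Vec D n) → Σ D λ d → Sat φ (d ∷ ρ) → ∀ x → Sat φ (x ∷ ρ)

-- Derivability from a theory

Derives : (Formula k → Set) → Formula k → Set
Derives S φ = Σ (List (Formula _)) λ Γ → All S Γ × (ZF ∣ Γ ⊢ φ)

module _ {S : Formula k → Set} where

  derives-∈ : ∀ {φ} → S φ → Derives S φ
  derives-∈ s = _ , s ∷ [] , hyp (here refl)

  derives-map : ∀ {φ ψ} → (∀ {Γ} → ZF ∣ Γ ⊢ φ → ZF ∣ Γ ⊢ ψ) → Derives S φ → Derives S ψ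
  derives-map f (Γ , a , d) = Γ , a , f d

  derives-map₂ : ∀ {φ ψ χ} → (∀ {Γ} → ZF ∣ Γ ⊢ φ → ZF ∣ Γ ⊢ ψ → ZF ∣ Γ ⊢ χ) →
                 Derives S φ → Derives S ψ → Derives S χ
  derives-map₂ f (Γ , a , d) (Δ , b , e) = Γ List.++ Δ , All.++⁺ a b ,
    f (⊢-weaken (xs⊆xs++ys Γ Δ) d) (⊢-weaken (xs⊆ys++xs Δ Γ) e)

-- The theory of stage k + 1 extends that of stage k by a Henkin axiom for a new variable and
-- by one formula, added only if its refutation would already yield R.  The latter is not
-- decidable, and need not be: the theory is just a predicate.
module Completeness (χ : Sentence) where

  R : Set
  R = ZF ∣ χ ∷ [] ⊢ ⊥ᶠ

  witness : ∀ k → Formula (suc k)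
  witness = treat suc (λ p → ren (lift 1 (emb p)))

  candidate : ∀ k → Formula k
  candidate = treat id (λ p → ren (emb p))

  henkinAxiom : ∀ k → Formula (suc k)
  henkinAxiom k = witness k ⇒ ren suc (∀ᶠ (witness k))

  Stage Extended : ∀ k → Formula k → Set
  Stage zero    φ = φ ≡ χ
  Stage (suc k) φ = (Σ (Formula k) λ ψ → Extended k ψ × φ ≡ ren suc ψ) ⊎ φ ≡ henkinAxiom k
  Extended k φ = Stage k φ ⊎ (φ ≡ candidate k × (Derives (Stage k) (~ candidate k) → R))

  -- Refuting the Henkin axiom gives `φ` for a fresh variable together with the negation of `∀ᶠ φ`,
  -- but `φ` for a fresh variable generalizes.
  henkin-conservative : {Γ : List (Formula k)} (φ : Formula (suc k)) →
    ZF ∣ (φ ⇒ ren suc (∀ᶠ φ)) ∷ map (ren suc) Γ ⊢ ⊥ᶠ → ZF ∣ Γ ⊢ ⊥ᶠ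
  henkin-conservative {Γ = Γ} φ d =
    -- The contradiction is still derived in the presence of the fresh variable. The calculus admits
    -- an empty universe, so the object asserted by Infinity is needed to discharge that variable.
    ⇒-elim (axiom zf-infinity) (∀-intro (⇒-intro (⊢-weaken there
      (⇒-elim ¬∀ (⊢-ren suc (∀-intro φ-holds))))))
    where
    ψ : Formula _
    ψ = ren suc (∀ᶠ φ)
    φ-holds : ZF ∣ map (ren suc) Γ ⊢ φ
    φ-holds = raa (⇒-elim (⊢-weaken there (⇒-intro d))
      (⇒-intro (raa (⇒-elim (hyp (there (there (here refl)))) (hyp (there (here refl)))))))
    ¬∀ : ZF ∣ map (ren suc) Γ ⊢ ~ ψ
    ¬∀ = ⇒-intro (⇒-elim (⊢-weaken there (⇒-intro d)) (⇒-intro (hyp (there (here refl)))))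

  split-stage : {Γ : List (Formula (suc k))} → All (Stage (suc k)) Γ →
    Σ (List (Formula k)) λ Δ → All (Extended k) Δ × Γ Sub.⊆ henkinAxiom k ∷ map (ren suc) Δ
  split-stage [] = [] , [] , λ ()
  split-stage (inj₁ (ψ , e , refl) ∷ a) with split-stage a
  ... | Δ , b , s = ψ ∷ Δ , e ∷ b , λ
    { (here refl) → there (here refl)
    ; (there h)   → case s h of λ { (here eq) → here eq ; (there h′) → there (there h′) } }
  split-stage (inj₂ refl ∷ a) with split-stage a
  ... | Δ , b , s = Δ , b , λ { (here eq) → here eq ; (there h) → s h }

  split-extended : {Γ : List (Formula k)} → All (Extended k) Γ →
    Σ (List (Formula k)) λ Δ → All (Stage k) Δ × (Γ Sub.⊆ Δ ⊎
      ((Derives (Stage k) (~ candidate k) → R) × Γ Sub.⊆ candidate k ∷ Δ))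
  split-extended [] = [] , [] , inj₁ λ ()
  split-extended (inj₁ t ∷ a) with split-extended a
  ... | Δ , b , inj₁ s       = _ ∷ Δ , t ∷ b , inj₁ (∷⁺ʳ _ s)
  ... | Δ , b , inj₂ (c , s) = _ ∷ Δ , t ∷ b , inj₂ (c , λ
    { (here eq) → there (here eq)
    ; (there h) → case s h of λ { (here eq) → here eq ; (there h′) → there (there h′) } })
  split-extended (inj₂ (refl , c) ∷ a) with split-extended a
  ... | Δ , b , inj₁ s       = Δ , b , inj₂ (c , ∷⁺ʳ _ s)
  ... | Δ , b , inj₂ (_ , s) = Δ , b , inj₂ (c , λ { (here eq) → here eq ; (there h) → s h })

  -- One stage is peeled off at a time: the Henkin axiom by conservativity, then the candidate,
  -- whose admission condition turns a derivation of its negation into `R`.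
  consistent : ∀ k → Derives (Stage k) ⊥ᶠ → R
  consistent zero (Γ , a , d) = ⊢-weaken (λ h → here (All.lookup a h)) d
  consistent (suc k) (Γ , a , d) with split-stage a
  ... | Δ , b , s with split-extended b | henkin-conservative (witness k) (⊢-weaken s d)
  ... | Δ′ , b′ , inj₁ s′       | d′ = consistent k (Δ′ , b′ , ⊢-weaken s′ d′)
  ... | Δ′ , b′ , inj₂ (c , s′) | d′ = c (Δ′ , b′ , ⇒-intro (⊢-weaken s′ d′))

  -- The limit of the stages

  derives-suc : {φ : Formula k} → Derives (Stage k) φ → Derives (Stage (suc k)) (ren suc φ)
  derives-suc (Γ , a , d) =
    map (ren suc) Γ , All.map⁺ (All.map (λ t → inj₁ (_ , inj₁ t , refl)) a) , ⊢-ren suc d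

  derives-emb : (p : k ≤′ j) {φ : Formula k} →
                Derives (Stage k) φ → Derives (Stage j) (ren (emb p) φ)
  derives-emb ≤′-refl     {φ} d = subst (Derives _) (sym (ren-id (λ _ → refl) φ)) d
  derives-emb (≤′-step p) {φ} d = subst (Derives _) (ren-∘ (λ _ → refl) φ) (derives-suc (derives-emb p d))

  -- Derivability from the union of all stages, expressed without forming a theory in infinitely
  -- many variables.
  Holds : Formula k → Set
  Holds {k} φ = Σ ℕ λ j → Σ (k ≤′ j) λ p → Derives (Stage j) (ren (emb p) φ)

  holds : {φ : Formula k} → Derives (Stage k) φ → Holds φ
  holds d = _ , ≤′-refl , derives-emb ≤′-refl d

  -- Levels are absolute, so two renamings with the same levels coincide after embedding into a
  -- common later stage.
  holds-transport : (φ : Formula n) {σ : Fin n → Fin k} {τ : Fin n → Fin j} →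
    (∀ i → level (σ i) ≡ level (τ i)) → Holds (ren σ φ) → Holds (ren τ φ)
  holds-transport {j = j} φ {σ} {τ} eq (s , p , d) with ≤′-sup s j
  ... | m , q , r = m , r , subst (Derives (Stage m)) eq′ (derives-emb q d)
    where
    eq′ : ren (emb q) (ren (emb p) (ren σ φ)) ≡ ren (emb r) (ren τ φ)
    eq′ = trans (cong (ren (emb q)) (ren-∘ (λ _ → refl) φ)) (trans
      (ren-∘ (λ i → emb-unique {p = q} {q = r} (trans (level-emb p (σ i)) (eq i))) φ)
      (sym (ren-∘ (λ _ → refl) φ)))

  holds-map₂ : {φ ψ θ : Formula k} →
    (∀ {j} (p : k ≤′ j) {Γ} → ZF ∣ Γ ⊢ ren (emb p) φ → ZF ∣ Γ ⊢ ren (emb p) ψ → ZF ∣ Γ ⊢ ren (emb p) θ) →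
    Holds φ → Holds ψ → Holds θ
  holds-map₂ {φ = φ} {ψ} f (i , p , d) (j , q , e) with ≤′-sup i j
  ... | m , p′ , q′ = m , r , derives-map₂ (f r) (move p p′ d) (move q q′ e)
    where
    r : _ ≤′ m
    r = ≤⇒≤′ (≤-trans (≤′⇒≤ p) (≤′⇒≤ p′))
    move : ∀ {i} (p : _ ≤′ i) (p′ : i ≤′ m) {φ} →
           Derives (Stage i) (ren (emb p) φ) → Derives (Stage m) (ren (emb r) φ)
    move p p′ {φ} d = subst (Derives _)
      (ren-∘ (λ x → emb-unique {p = p′} {q = r} (level-emb p x)) φ) (derives-emb p′ d)

  holds-map : {φ ψ : Formula k} →
    (∀ {j} (p : k ≤′ j) {Γ} → ZF ∣ Γ ⊢ ren (emb p) φ → ZF ∣ Γ ⊢ ren (emb p) ψ) → Holds φ → Holds ψ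
  holds-map f (j , p , d) = j , p , derives-map (f p) d

  holds-mp : {φ ψ : Formula k} → Holds (φ ⇒ ψ) → Holds φ → Holds ψ
  holds-mp {φ = φ} {ψ} = holds-map₂ {φ = φ ⇒ ψ} {ψ = φ} {θ = ψ} λ p → ⇒-elim

  ⊢-antecedent : ∀ {Γ} {φ ψ : Formula k} → ZF ∣ Γ ⊢ ~ (φ ⇒ ψ) → ZF ∣ Γ ⊢ φ
  ⊢-antecedent d = raa (⇒-elim (⊢-weaken there d)
    (⇒-intro (raa (⇒-elim (hyp (there (there (here refl)))) (hyp (there (here refl)))))))

  holds-antecedent : {φ ψ : Formula k} → Holds (~ (φ ⇒ ψ)) → Holds φ
  holds-antecedent {φ = φ} {ψ} = holds-map {φ = ~ (φ ⇒ ψ)} {ψ = φ} λ p → ⊢-antecedent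

  holds-refute : {φ ψ : Formula k} → Holds (~ (φ ⇒ ψ)) → Holds ψ → Holds {k} ⊥ᶠ
  holds-refute {φ = φ} {ψ} = holds-map₂ {φ = ~ (φ ⇒ ψ)} {ψ = ψ} {θ = ⊥ᶠ}
    λ p d e → ⇒-elim d (⇒-intro (⊢-weaken there e))

  holds-stable : {φ : Formula k} → Holds (~ ~ φ) → Holds φ
  holds-stable {φ = φ} = holds-map {φ = ~ ~ φ} {ψ = φ}
    λ p d → raa (⇒-elim (⊢-weaken there d) (hyp (here refl)))

  holds-leibniz : (φ : Formula (suc k)) {x y : Fin k} → Holds (x ≐ y) → Holds (φ [ x ]) → Holds (φ [ y ])
  holds-leibniz φ {x} {y} = holds-map₂ {φ = x ≐ y} {ψ = φ [ x ]} {θ = φ [ y ]}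
    λ p d e → subst (ZF ∣ _ ⊢_) (sym (ren-[] (emb p) φ y))
      (≐-subst (ren (lift 1 (emb p)) φ) d (subst (ZF ∣ _ ⊢_) (ren-[] (emb p) φ x) e))

  holds-⊥ : Holds {k} ⊥ᶠ → R
  holds-⊥ (j , _ , d) = consistent j d

  -- At the stage where `φ` is the candidate, a derivation of its negation is an instance of
  -- `Holds (~ φ)`; the assumption is therefore exactly the admission condition.
  holds-maximal : (φ : Formula k) → (Holds (~ φ) → R) → Holds φ
  holds-maximal φ c with treat-onto id (λ p → ren (emb p)) φ
  ... | j , p , eq = suc j , ≤′-step p , derives-∈ (inj₁
    (ren (emb p) φ , inj₂ (sym eq , λ d → c (j , p , subst (Derives (Stage j) ∘ ~_) eq d)) ,
     sym (ren-∘ (λ _ → refl) φ)))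

  -- The term model and the truth lemma

  D : Set
  D = ℕ

  infix 4 _∈_ _≈_
  -- The elements are variable levels, and level `k` belongs to the variable introduced at stage
  -- `suc k`. Any stage may witness a relation, and no quotient is taken, since `_≈_` interprets
  -- equality.
  _∈_ _≈_ : D → D → Set
  x ∈ y = Σ ℕ λ k → Σ (Fin k) λ a → Σ (Fin k) λ b → level a ≡ x × level b ≡ y × Holds (a ϵ b)
  x ≈ y = Σ ℕ λ k → Σ (Fin k) λ a → Σ (Fin k) λ b → level a ≡ x × level b ≡ y × Holds (a ≐ b)

  open Satisfaction D _∈_ _≈_ R

  pair-at : Fin k → Fin k → Fin 2 → Fin k
  pair-at a b zero       = a
  pair-at a b (suc zero) = b

  holds-atom : (φ : Formula 2) {a b : Fin k} {a′ b′ : Fin j} → level a ≡ level a′ → level b ≡ level b′ →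
               Holds (ren (pair-at a b) φ) → Holds (ren (pair-at a′ b′) φ)
  holds-atom φ eq eq′ = holds-transport φ λ { zero → eq ; (suc zero) → eq′ }

  Names : (Fin n → Fin k) → Vec D n → Set
  Names σ ρ = ∀ i → level (σ i) ≡ lookup ρ i

  -- The truth lemma. Its two halves are mutually recursive because an implication reverses the
  -- direction in its antecedent. Maximality settles implications, the Henkin axioms settle
  -- universal formulas.
  sat⇒holds : (φ : Formula n) {σ : Fin n → Fin k} {ρ : Vec D n} → Names σ ρ → Sat φ ρ → Holds (ren σ φ)
  holds⇒sat : (φ : Formula n) {σ : Fin n → Fin k} {ρ : Vec D n} → Names σ ρ → Holds (ren σ φ) → Sat φ ρ

  -- The element is the level of the variable added at the stage that treats `φ` as its Henkin
  -- formula.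
  henkin-instance : (φ : Formula (suc n)) {σ : Fin n → Fin k} {ρ : Vec D n} → Names σ ρ →
    Σ D λ d → Sat φ (d ∷ ρ) → Holds (ren σ (∀ᶠ φ))

  sat⇒holds (x ≐ y) s (k , a , b , e , e′ , h) =
    holds-atom (zero ≐ suc zero) (trans e (sym (s x))) (trans e′ (sym (s y))) h
  sat⇒holds (x ϵ y) s (k , a , b , e , e′ , h) =
    holds-atom (zero ϵ suc zero) (trans e (sym (s x))) (trans e′ (sym (s y))) h
  sat⇒holds ⊥ᶠ      s r = holds-maximal ⊥ᶠ λ _ → r
  sat⇒holds (φ ⇒ ψ) {σ} s f = holds-maximal (ren σ (φ ⇒ ψ)) λ h →
    holds-⊥ (holds-refute {φ = ren σ φ} {ψ = ren σ ψ} h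
      (sat⇒holds ψ s (f (holds⇒sat φ s (holds-antecedent {φ = ren σ φ} {ψ = ren σ ψ} h)))))
  sat⇒holds (∀ᶠ φ)  s f = proj₂ (henkin-instance φ s) (f (proj₁ (henkin-instance φ s)))

  holds⇒sat (x ≐ y) {σ} s h = _ , σ x , σ y , s x , s y , h
  holds⇒sat (x ϵ y) {σ} s h = _ , σ x , σ y , s x , s y , h
  holds⇒sat ⊥ᶠ      s h = holds-⊥ h
  holds⇒sat (φ ⇒ ψ) {σ} s h t = holds⇒sat ψ s (holds-mp {φ = ren σ φ} {ψ = ren σ ψ} h (sat⇒holds φ s t))
  holds⇒sat (∀ᶠ φ) {σ} {ρ} s (j , p , h) d with ≤′-sup j (suc d)
  ... | m , q , r = holds⇒sat φ {emb r zero ▸ emb q ∘ emb p ∘ σ} names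
    (holds (derives-map instantiate (derives-emb q h)))
    where
    names : Names (emb r zero ▸ emb q ∘ emb p ∘ σ) (d ∷ ρ)
    names zero    = level-emb r zero
    names (suc i) = trans (level-emb q _) (trans (level-emb p _) (s i))
    eq : ren (lift 1 (emb q)) (ren (lift 1 (emb p)) (ren (lift 1 σ) φ)) [ emb r zero ] ≡
         ren (emb r zero ▸ emb q ∘ emb p ∘ σ) φ
    eq = trans (ren-∘ (λ _ → refl) (ren (lift 1 (emb p)) (ren (lift 1 σ) φ)))
      (trans (ren-∘ (λ _ → refl) (ren (lift 1 σ) φ)) (ren-∘ (λ { zero → refl ; (suc i) → refl }) φ))
    instantiate : ∀ {Γ} → ZF ∣ Γ ⊢ ren (emb q) (ren (emb p) (ren σ (∀ᶠ φ))) →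
                  ZF ∣ Γ ⊢ ren (emb r zero ▸ emb q ∘ emb p ∘ σ) φ
    instantiate e = subst (ZF ∣ _ ⊢_) eq (∀-elim e (emb r zero))

  henkin-instance φ {σ} {ρ} s
    with treat-onto suc (λ p → ren (lift 1 (emb p))) (ren (lift 1 σ) φ)
  ... | j , p , eq = j , λ t → back (holds-mp {φ = witness j} {ψ = ren suc (∀ᶠ (witness j))}
        (holds {φ = henkinAxiom j} (derives-∈ (inj₂ refl))) (subst Holds eq₁ (sat⇒holds φ names t)))
    where
    τ : Fin _ → Fin (suc j)
    τ = zero ▸ suc ∘ emb p ∘ σ
    names : Names τ (j ∷ ρ)
    names zero    = refl
    names (suc i) = trans (level-emb p _) (s i)
    eq₁ : ren τ φ ≡ witness j
    eq₁ = sym (trans eq (ren-∘ (λ { zero → refl ; (suc i) → refl }) φ))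
    eq₂ : ren suc (∀ᶠ (witness j)) ≡ ren (suc ∘ emb p ∘ σ) (∀ᶠ φ)
    eq₂ = trans (cong (ren suc ∘ ∀ᶠ) eq)
      (trans (ren-∘ (λ _ → refl) (ren σ (∀ᶠ φ))) (ren-∘ (λ _ → refl) (∀ᶠ φ)))
    back : Holds (ren suc (∀ᶠ (witness j))) → Holds (ren σ (∀ᶠ φ))
    back h = holds-transport (∀ᶠ φ) (λ i → level-emb p (σ i)) (subst Holds eq₂ h)

  naming : (ρ : Vec D n) → Σ ℕ λ k → Σ (Fin n → Fin k) λ σ → Names σ ρ
  naming []      = 0 , (λ ()) , λ ()
  naming (d ∷ ρ) with naming ρ
  ... | k , σ , s with ≤′-sup k (suc d)
  ... | m , p , q = m , (emb q zero ▸ emb p ∘ σ) ,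
    λ { zero → level-emb q zero ; (suc i) → trans (level-emb p _) (s i) }

  stable : (φ : Formula n) (ρ : Vec D n) → ((Sat φ ρ → R) → R) → Sat φ ρ
  stable φ ρ f with naming ρ
  ... | k , σ , s = holds⇒sat φ s (holds-stable {φ = ren σ φ} (sat⇒holds (~ ~ φ) s f))

  leibniz : (φ : Formula (suc n)) (ρ : Vec D n) {x y : D} → x ≈ y → Sat φ (x ∷ ρ) → Sat φ (y ∷ ρ)
  leibniz φ ρ {x} {y} e t with naming (x ∷ y ∷ ρ)
  ... | k , σ , s = holds⇒sat φ names (subst Holds (eq (suc zero)) (holds-leibniz φ′
      (sat⇒holds (zero ≐ suc zero) {ρ = x ∷ y ∷ ρ} s e) (subst Holds (sym (eq zero)) (sat⇒holds φ names′ t))))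
    where
    τ : Fin _ → Fin k
    τ i = σ (suc (suc i))
    φ′ : Formula (suc k)
    φ′ = ren (lift 1 τ) φ
    eq : ∀ i → φ′ [ σ i ] ≡ ren (σ i ▸ τ) φ
    eq i = ren-∘ (λ { zero → refl ; (suc i) → refl }) φ
    names : Names (σ (suc zero) ▸ τ) (y ∷ _)
    names zero    = s (suc zero)
    names (suc i) = s (suc (suc i))
    names′ : Names (σ zero ▸ τ) (x ∷ _)
    names′ zero    = s zero
    names′ (suc i) = s (suc (suc i))

  henkin : (φ : Formula (suc n)) (ρ : Vec D n) → Σ D λ d → Sat φ (d ∷ ρ) → ∀ x → Sat φ (x ∷ ρ)
  henkin φ ρ with naming ρ
  ... | k , σ , s = proj₁ (henkin-instance φ {σ} {ρ} s) ,
    λ t → holds⇒sat (∀ᶠ φ) {σ} {ρ} s (proj₂ (henkin-instance φ {σ} {ρ} s) t)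

  reflexive : ∀ {x} → x ≈ x
  reflexive {x} = suc x , zero , zero , refl , refl , holds {φ = zero ≐ zero} ([] , [] , ≐-refl)

  sat-theorem : {σ : Sentence} → ZF σ → Sat σ []
  sat-theorem {σ} t = holds⇒sat σ {id} (λ ())
    (holds {φ = ren id σ} ([] , [] , subst (ZF ∣ [] ⊢_) (ren-cong (λ ()) σ) (axiom t)))

  model : Model
  model = record
    { D = D ; _∈_ = _∈_ ; _≈_ = _≈_ ; R = R
    ; sat-stable = stable ; ≈-refl = reflexive ; sat-leibniz = leibniz
    ; sat-axiom = sat-theorem ; sat-henkin = henkin }

  sat-χ : Sat χ []
  sat-χ = holds⇒sat χ {id} (λ ()) (holds {φ = ren id χ} (derives-∈ (ren-id (λ ()) χ)))

-- In the model built from `~ σ`, falsity is derivability of `⊥ᶠ` from `~ σ`, and `~ σ` is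
-- satisfied. Truth of `σ` there is thus turned directly into a derivation.
provable : (σ : Sentence) → ((M : Model) → Model.Sat M σ []) → ZF ⊢ σ
provable σ f = raa (sat-χ (f model))
  where open Completeness (~ σ)

-- Set theory inside a model

module InModel (M : Model) where

  open Model M

  -- Classical reasoning relative to R

  infix 3 ¬_
  ¬_ : Set → Set
  ¬ A = A → R

  infix 1 _↔_
  _↔_ : Set → Set → Set
  A ↔ B = (A → B) × (B → A)

  infixr 2 _or_
  -- Definitionally the interpretation of `_∨_`; the price is that it can be eliminated only into
  -- stable types.
  _or_ : Set → Set → Set
  A or B = ¬ A → B

  -- Dependent Σ-types get no instance: their stability rests on a Henkin witness and is obtained
  -- from a defining formula, by `fm-stable`.
  record Stable (A : Set) : Set where
    constructor mkStable
    field
      stable : ¬ ¬ A → A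

  open Stable {{...}} public

  instance
    stable-R : Stable R
    stable-R = mkStable λ f → f id

    stable-∈ : ∀ {x y} → Stable (x ∈ y)
    stable-∈ {x} {y} = mkStable (sat-stable (zero ϵ suc zero) (x ∷ y ∷ []))

    stable-≈ : ∀ {x y} → Stable (x ≈ y)
    stable-≈ {x} {y} = mkStable (sat-stable (zero ≐ suc zero) (x ∷ y ∷ []))

    stable-Π : {A : Set} {B : A → Set} {{_ : ∀ {x} → Stable (B x)}} → Stable ((x : A) → B x)
    stable-Π = mkStable λ f x → stable λ g → f λ h → g (h x)

    stable-× : {A B : Set} {{_ : Stable A}} {{_ : Stable B}} → Stable (A × B)
    stable-× = mkStable λ f → stable (λ g → f (g ∘ proj₁)) , stable (λ g → f (g ∘ proj₂))

  exfalso : {A : Set} {{_ : Stable A}} → R → A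
  exfalso r = stable λ _ → r

  by-cases : (A : Set) {B : Set} {{_ : Stable B}} → (A → B) → (¬ A → B) → B
  by-cases A f g = stable λ k → k (g λ a → k (f a))

  or-elim : {A B C : Set} {{_ : Stable C}} → A or B → (A → C) → (B → C) → C
  or-elim o f g = stable λ k → k (g (o λ a → k (f a)))

  inl : {A B : Set} {{_ : Stable B}} → A → A or B
  inl a ¬a = exfalso (¬a a)

  inr : {A B : Set} → B → A or B
  inr b _ = b

  infixr 9 _↔∘_
  _↔∘_ : {A B C : Set} → B ↔ C → A ↔ B → A ↔ C
  (f , g) ↔∘ (h , k) = f ∘ h , k ∘ g

  ↔-sym : {A B : Set} → A ↔ B → B ↔ A
  ↔-sym (f , g) = g , f

  →-cong : {A B C E : Set} → A ↔ B → C ↔ E → (A → C) ↔ (B → E)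
  →-cong (f , g) (h , k) = (λ p → h ∘ p ∘ g) , (λ p → k ∘ p ∘ f)

  ↔-≡ : {A B : Set} → A ≡ B → A ↔ B
  ↔-≡ refl = id , id

  -- Definable predicates, with parameters

  sat-ren : (φ : Formula n) (σ : Fin n → Fin m) {θ : Vec D n} {ρ : Vec D m} →
            (∀ i → lookup ρ (σ i) ≡ lookup θ i) → Sat (ren σ φ) ρ ↔ Sat φ θ
  sat-ren (x ≐ y) σ h = ↔-≡ (cong₂ _≈_ (h x) (h y))
  sat-ren (x ϵ y) σ h = ↔-≡ (cong₂ _∈_ (h x) (h y))
  sat-ren ⊥ᶠ      σ h = id , id
  sat-ren (φ ⇒ ψ) σ h = →-cong (sat-ren φ σ h) (sat-ren ψ σ h)
  sat-ren (∀ᶠ φ) σ {θ} {ρ} h = (λ k d → proj₁ (ih d) (k d)) , (λ k d → proj₂ (ih d) (k d))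
    where
    ih : ∀ d → Sat (ren (lift 1 σ) φ) (d ∷ ρ) ↔ Sat φ (d ∷ θ)
    ih d = sat-ren φ (lift 1 σ) λ { zero → refl ; (suc i) → h i }

  -- The certificate that an Agda predicate is first-order. It gives access to Separation and
  -- Replacement and yields stability and invariance under `_≈_`.
  record Def {n} (P : Vec D n → Set) : Set where
    constructor mkDef
    field
      {arity} : ℕ
      params  : Vec D arity
      code    : Formula (n + arity)
      correct : ∀ ρ → P ρ ↔ Sat code (ρ ++ params)

  opaque
    def-iff : {P Q : Vec D n → Set} → (∀ ρ → P ρ ↔ Q ρ) → Def P → Def Q
    def-iff e (mkDef p c r) = mkDef p c λ ρ → r ρ ↔∘ ↔-sym (e ρ)

    def-formula : (φ : Formula n) → Def (Sat φ)
    def-formula φ = mkDef [] (ren (_↑ˡ 0) φ) λ ρ →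
      ↔-sym (sat-ren φ (_↑ˡ 0) (lookup-++ˡ ρ []))

    lookup-join : (xs : Vec D n) (ys : Vec D m) (i : Fin n ⊎ Fin m) →
                  lookup (xs ++ ys) (join n m i) ≡ [ lookup xs , lookup ys ]′ i
    lookup-join xs ys (inj₁ i) = lookup-++ˡ xs ys i
    lookup-join xs ys (inj₂ j) = lookup-++ʳ xs ys j

    ren₂ : {a b : ℕ} → (Fin n ⊎ Fin a → Fin m ⊎ Fin b) → Formula (n + a) → Formula (m + b)
    ren₂ {n} {m} {a} {b} σ = ren (join m b ∘ σ ∘ splitAt n)

    sat-ren₂ : {a b : ℕ} (φ : Formula (n + a)) (σ : Fin n ⊎ Fin a → Fin m ⊎ Fin b)
               (xs : Vec D n) (ps : Vec D a) (ys : Vec D m) (qs : Vec D b) →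
               (∀ i → [ lookup ys , lookup qs ]′ (σ i) ≡ [ lookup xs , lookup ps ]′ i) →
               Sat φ (xs ++ ps) ↔ Sat (ren₂ σ φ) (ys ++ qs)
    sat-ren₂ {n} {a = a} φ σ xs ps ys qs h = ↔-sym (sat-ren φ _ λ i →
      trans (lookup-join ys qs (σ (splitAt n i))) (trans (h (splitAt n i))
        (trans (sym (lookup-join xs ps (splitAt n i))) (cong (lookup (xs ++ ps)) (join-splitAt n a i)))))

    def-ren : {P : Vec D n → Set} (σ : Fin n → Fin m) → Def P → Def λ ρ → P (tabulate (lookup ρ ∘ σ))
    def-ren {n} {m} σ (mkDef {a} p c r) = mkDef p (ren₂ τ c) λ ρ →
      sat-ren₂ c τ (tabulate (lookup ρ ∘ σ)) p ρ p
        (λ { (inj₁ i) → sym (lookup∘tabulate (lookup ρ ∘ σ) i) ; (inj₂ j) → refl }) ↔∘ r _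
      where
      τ : Fin n ⊎ Fin a → Fin m ⊎ Fin a
      τ = [ inj₁ ∘ σ , inj₂ ]′

    def-param : {P : Vec D (suc n) → Set} (d : D) → Def P → Def λ ρ → P (d ∷ ρ)
    def-param {n} d (mkDef {a} p c r) = mkDef (d ∷ p) (ren₂ τ c) λ ρ →
      sat-ren₂ c τ (d ∷ ρ) p ρ (d ∷ p)
        (λ { (inj₁ zero) → refl ; (inj₁ (suc i)) → refl ; (inj₂ j) → refl }) ↔∘ r (d ∷ ρ)
      where
      τ : Fin (suc n) ⊎ Fin a → Fin n ⊎ Fin (suc a)
      τ (inj₁ zero)    = inj₂ zero
      τ (inj₁ (suc i)) = inj₁ i
      τ (inj₂ j)       = inj₂ (suc j)

    def-⇒ : {P Q : Vec D n → Set} → Def P → Def Q → Def λ ρ → P ρ → Q ρ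
    def-⇒ {n} {P} {Q} (mkDef {a} p c r) (mkDef {b} q e s) =
      mkDef (p ++ q) (ren₂ σ c ⇒ ren₂ τ e) λ ρ → →-cong
        (sat-ren₂ c σ ρ p ρ (p ++ q) (λ { (inj₁ i) → refl ; (inj₂ j) → lookup-++ˡ p q j }) ↔∘ r ρ)
        (sat-ren₂ e τ ρ q ρ (p ++ q) (λ { (inj₁ i) → refl ; (inj₂ j) → lookup-++ʳ p q j }) ↔∘ s ρ)
      where
      σ : Fin n ⊎ Fin a → Fin n ⊎ Fin (a + b)
      σ = [ inj₁ , inj₂ ∘ (_↑ˡ b) ]′
      τ : Fin n ⊎ Fin b → Fin n ⊎ Fin (a + b)
      τ = [ inj₁ , inj₂ ∘ (a ↑ʳ_) ]′

    def-∀ : {P : Vec D (suc n) → Set} → Def P → Def λ ρ → ∀ d → P (d ∷ ρ)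
    def-∀ (mkDef p c r) = mkDef p (∀ᶠ c) λ ρ →
      (λ f d → proj₁ (r (d ∷ ρ)) (f d)) , (λ f d → proj₂ (r (d ∷ ρ)) (f d))

    def-stable : {P : Vec D n → Set} → Def P → ∀ ρ → Stable (P ρ)
    def-stable (mkDef p c r) ρ = mkStable λ f →
      proj₂ (r ρ) (sat-stable c (ρ ++ p) λ g → f (g ∘ proj₁ (r ρ)))

    def-leibniz : {P : Vec D (suc n) → Set} → Def P → ∀ {x y ρ} → x ≈ y → P (x ∷ ρ) → P (y ∷ ρ)
    def-leibniz (mkDef p c r) {x} {y} {ρ} e t =
      proj₂ (r (y ∷ ρ)) (sat-leibniz c (ρ ++ p) e (proj₁ (r (x ∷ ρ)) t))

  ≈-sym : ∀ {x y} → x ≈ y → y ≈ x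
  ≈-sym {x} {y} e = sat-leibniz (zero ≐ suc zero) (x ∷ []) e ≈-refl

  ≈-trans : ∀ {x y z} → x ≈ y → y ≈ z → x ≈ z
  ≈-trans {x} {y} {z} e f = sat-leibniz (zero ≐ suc zero) (z ∷ []) (≈-sym e) f

  opaque
    -- Variables are the only terms of the language, so substituting `t` means quantifying over all
    -- `z` with `z ≈ t ρ`.
    def-bind : {P : Vec D (suc n) → Set} {t : Vec D n → D} →
               Def (λ ρ → head ρ ≈ t (tail ρ)) → Def P → Def λ ρ → P (t ρ ∷ ρ)
    def-bind d e = def-iff
      (λ ρ → (λ f → f _ ≈-refl) , (λ p z eq → def-leibniz e (≈-sym eq) p)) (def-∀ (def-⇒ d e))

  -- The combinators below compute `⟦_⟧` as a readable Agda type, while the underlying formula stays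
  -- hidden in the certificate. Proofs can therefore ignore de Bruijn codes.
  record Fm (n : ℕ) : Set₁ where
    constructor mkFm
    field
      {⟦_⟧} : Vec D n → Set
      def   : Def ⟦_⟧

  record Tm (n : ℕ) : Set where
    constructor mkTm
    field
      {ev}  : Vec D n → D
      graph : Def λ ρ → head ρ ≈ ev (tail ρ)

  open Fm public
  open Tm public

  evs : Vec (Tm n) k → Vec D n → Vec D k
  evs []       ρ = []
  evs (t ∷ ts) ρ = ev t ρ ∷ evs ts ρ

  opaque
    def-subst : {P : Vec D k → Set} (ts : Vec (Tm n) k) → Def P → Def λ ρ → P (evs ts ρ)
    def-subst {n = n} {P} ts d = def-iff (λ ρ → ↔-≡ (cong P (trans
        (tabulate-cong (lookup-++ˡ (evs ts ρ) ρ)) (tabulate∘lookup (evs ts ρ)))))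
        (go ts (def-ren (_↑ˡ n) d))
      where
      go : ∀ {k} {Q : Vec D (k + n) → Set} (ts : Vec (Tm n) k) → Def Q → Def λ ρ → Q (evs ts ρ ++ ρ)
      go [] d = d
      go {suc k} {Q} (t ∷ ts) d = def-iff
        (λ ρ → ↔-≡ (cong (λ θ → Q (ev t θ ∷ evs ts ρ ++ ρ))
          (trans (tabulate-cong (lookup-++ʳ (evs ts ρ) ρ)) (tabulate∘lookup ρ))))
        (go ts (def-bind (def-iff (λ { (z ∷ ρ) → id , id }) (def-ren (lift 1 (k ↑ʳ_)) (graph t))) d))

  fm-stable : (P : Fm n) (ρ : Vec D n) → Stable (⟦ P ⟧ ρ)
  fm-stable P = def-stable (def P)

  leibniz : (P : Fm (suc n)) → ∀ {x y ρ} → x ≈ y → ⟦ P ⟧ (x ∷ ρ) → ⟦ P ⟧ (y ∷ ρ)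
  leibniz P = def-leibniz (def P)

  infix 20 _⟨_⟩
  _⟨_⟩ : Fm k → Vec (Tm n) k → Fm n
  ⟦ P ⟨ ts ⟩ ⟧ ρ = ⟦ P ⟧ (evs ts ρ)
  def (P ⟨ ts ⟩) = def-subst ts (def P)

  var : Fin n → Tm n
  ev (var i) ρ = lookup ρ i
  graph (var i) = def-iff (λ { (z ∷ ρ) → id , id }) (def-formula (zero ≐ suc i))

  shift : Tm n → Tm (suc n)
  ev (shift t) ρ = ev t (tail ρ)
  graph (shift t) = def-iff
    (λ { (x ∷ y ∷ ρ) → ↔-≡ (cong (λ θ → x ≈ ev t θ) (tabulate∘lookup ρ)) })
    (def-ren (lift 1 suc) (graph t))

  shifts : Vec (Tm n) k → Vec (Tm (suc n)) k
  shifts []       = []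
  shifts (t ∷ ts) = shift t ∷ shifts ts

  evs-shifts : (ts : Vec (Tm n) k) (ρ : Vec D (suc n)) → evs (shifts ts) ρ ≡ evs ts (tail ρ)
  evs-shifts []       ρ = refl
  evs-shifts (t ∷ ts) ρ = cong (_ ∷_) (evs-shifts ts ρ)

  infix 20 _⟪_⟫
  _⟪_⟫ : Tm k → Vec (Tm n) k → Tm n
  ev (t ⟪ ts ⟫) ρ = ev t (evs ts ρ)
  graph (t ⟪ ts ⟫) = def-iff
    (λ { (z ∷ ρ) → ↔-≡ (cong (λ θ → z ≈ ev t θ) (evs-shifts ts (z ∷ ρ))) })
    (def-subst (var zero ∷ shifts ts) (graph t))

  ⌜_⌝ : D → Tm n
  ev ⌜ d ⌝ ρ = d
  graph ⌜ d ⌝ = def-param {P = λ ρ → head (tail ρ) ≈ head ρ} d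
    (def-iff (λ { (x ∷ y ∷ ρ) → id , id }) (def-formula (suc zero ≐ zero)))

  v₀ : Tm (1 + n)
  v₀ = var zero
  v₁ : Tm (2 + n)
  v₁ = var (suc zero)
  v₂ : Tm (3 + n)
  v₂ = var (suc (suc zero))
  v₃ : Tm (4 + n)
  v₃ = var (suc (suc (suc zero)))
  v₄ : Tm (5 + n)
  v₄ = var (suc (suc (suc (suc zero))))

  opaque
    -- The Henkin element of the negated formula: `P` holds there if it holds anywhere. This is what
    -- allows `∃'` to be interpreted by Σ.
    witness : (P : Fm (suc n)) (ρ : Vec D n) → Σ D λ d → ¬ (∀ x → ¬ ⟦ P ⟧ (x ∷ ρ)) → ⟦ P ⟧ (d ∷ ρ)
    witness P ρ with mkDef p c r ← def P with sat-henkin (~ c) (ρ ++ p)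
    ... | d , h = d , λ f → stable {{fm-stable P _}}
      λ g → f λ x t → h (g ∘ proj₂ (r _)) x (proj₁ (r _) t)

  infix  8 _∈'_ _≈'_
  infixr 6 _∧'_
  infixr 5 _∨'_
  infixr 4 _⇒'_

  _∈'_ _≈'_ : Tm n → Tm n → Fm n
  ⟦ t ∈' s ⟧ ρ = ev t ρ ∈ ev s ρ
  def (t ∈' s) = def-subst {P = λ { (x ∷ y ∷ []) → x ∈ y }} (t ∷ s ∷ [])
    (def-iff (λ { (x ∷ y ∷ []) → id , id }) (def-formula (zero ϵ suc zero)))
  ⟦ t ≈' s ⟧ ρ = ev t ρ ≈ ev s ρ
  def (t ≈' s) = def-subst {P = λ { (x ∷ y ∷ []) → x ≈ y }} (t ∷ s ∷ [])
    (def-iff (λ { (x ∷ y ∷ []) → id , id }) (def-formula (zero ≐ suc zero)))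

  ⊥' : Fm n
  ⊥' = mkFm (def-formula ⊥ᶠ)

  _⇒'_ _∧'_ _∨'_ : Fm n → Fm n → Fm n
  P ⇒' Q = mkFm (def-⇒ (def P) (def Q))
  ⟦ P ∧' Q ⟧ ρ = ⟦ P ⟧ ρ × ⟦ Q ⟧ ρ
  def (P ∧' Q) = def-iff
    (λ ρ → (λ f → stable {{fm-stable P ρ}} (λ g → f λ p _ → g p) ,
                  stable {{fm-stable Q ρ}} (λ g → f λ _ q → g q)) ,
           (λ { (p , q) f → f p q }))
    (def-⇒ (def-⇒ (def P) (def-⇒ (def Q) (def ⊥'))) (def ⊥'))

  ¬' : Fm n → Fm n
  ¬' P = P ⇒' ⊥'

  P ∨' Q = ¬' P ⇒' Q

  ∀' ∃' : Fm (suc n) → Fm n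
  ∀' P = mkFm (def-∀ (def P))
  ⟦ ∃' P ⟧ ρ = Σ D λ d → ⟦ P ⟧ (d ∷ ρ)
  def (∃' P) = def-iff
    (λ ρ → (λ f → _ , proj₂ (witness P ρ) f) , (λ { (d , p) f → f d p }))
    (def-⇒ (def-∀ (def (¬' P))) (def ⊥'))

  ∀∈' ∃∈' : Tm n → Fm (suc n) → Fm n
  ∀∈' t P = ∀' (v₀ ∈' shift t ⇒' P)
  ∃∈' t P = ∃' (v₀ ∈' shift t ∧' P)

  -- Satisfaction with conjunctions as products and, thanks to the Henkin witnesses, existential
  -- quantifiers as Σ-types

  ⟪_⟫ˢ : Formula n → Vec D n → Set
  ⟪ (φ ⇒ (ψ ⇒ ⊥ᶠ)) ⇒ ⊥ᶠ ⟫ˢ ρ = ⟪ φ ⟫ˢ ρ × ⟪ ψ ⟫ˢ ρ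
  ⟪ ∀ᶠ (φ ⇒ ⊥ᶠ) ⇒ ⊥ᶠ ⟫ˢ    ρ = Σ D λ d → ⟪ φ ⟫ˢ (d ∷ ρ)
  ⟪ x ≐ y ⟫ˢ ρ = lookup ρ x ≈ lookup ρ y
  ⟪ x ϵ y ⟫ˢ ρ = lookup ρ x ∈ lookup ρ y
  ⟪ ⊥ᶠ ⟫ˢ    ρ = R
  ⟪ φ ⇒ ψ ⟫ˢ ρ = ⟪ φ ⟫ˢ ρ → ⟪ ψ ⟫ˢ ρ
  ⟪ ∀ᶠ φ ⟫ˢ  ρ = ∀ d → ⟪ φ ⟫ˢ (d ∷ ρ)

  opaque
    ⟪⟫ˢ↔sat : (φ : Formula n) (ρ : Vec D n) → ⟪ φ ⟫ˢ ρ ↔ Sat φ ρ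
    ⟪⟫ˢ↔sat ((φ ⇒ (ψ ⇒ ⊥ᶠ)) ⇒ ⊥ᶠ) ρ with ⟪⟫ˢ↔sat φ ρ | ⟪⟫ˢ↔sat ψ ρ
    ... | f , g | f′ , g′ = (λ { (p , q) h → h (f p) (f′ q) }) ,
      λ h → g (sat-stable φ ρ λ k → h λ p _ → k p) , g′ (sat-stable ψ ρ λ k → h λ _ q → k q)
    ⟪⟫ˢ↔sat (∀ᶠ (φ ⇒ ⊥ᶠ) ⇒ ⊥ᶠ)    ρ =
      (λ { (d , p) h → h d (proj₁ (⟪⟫ˢ↔sat φ (d ∷ ρ)) p) }) ,
      λ h → _ , proj₂ (⟪⟫ˢ↔sat φ _) (proj₂ (witness (mkFm (def-formula φ)) ρ) h)
    ⟪⟫ˢ↔sat (x ≐ y) ρ = id , id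
    ⟪⟫ˢ↔sat (x ϵ y) ρ = id , id
    ⟪⟫ˢ↔sat ⊥ᶠ      ρ = id , id
    ⟪⟫ˢ↔sat (∀ᶠ φ)  ρ =
      (λ f d → proj₁ (⟪⟫ˢ↔sat φ (d ∷ ρ)) (f d)) , (λ f d → proj₂ (⟪⟫ˢ↔sat φ (d ∷ ρ)) (f d))
    -- The remaining implications, in the order in which the clauses of ⟪_⟫ˢ split.
    ⟪⟫ˢ↔sat ((x ≐ y) ⇒ ψ) ρ = →-cong (⟪⟫ˢ↔sat (x ≐ y) ρ) (⟪⟫ˢ↔sat ψ ρ)
    ⟪⟫ˢ↔sat ((x ϵ y) ⇒ ψ) ρ = →-cong (⟪⟫ˢ↔sat (x ϵ y) ρ) (⟪⟫ˢ↔sat ψ ρ)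
    ⟪⟫ˢ↔sat (⊥ᶠ ⇒ ψ) ρ = →-cong (⟪⟫ˢ↔sat ⊥ᶠ ρ) (⟪⟫ˢ↔sat ψ ρ)
    ⟪⟫ˢ↔sat ((φ ⇒ (x ≐ y)) ⇒ ψ) ρ = →-cong (⟪⟫ˢ↔sat (φ ⇒ (x ≐ y)) ρ) (⟪⟫ˢ↔sat ψ ρ)
    ⟪⟫ˢ↔sat ((φ ⇒ (x ϵ y)) ⇒ ψ) ρ = →-cong (⟪⟫ˢ↔sat (φ ⇒ (x ϵ y)) ρ) (⟪⟫ˢ↔sat ψ ρ)
    ⟪⟫ˢ↔sat ((φ ⇒ ⊥ᶠ) ⇒ ψ) ρ = →-cong (⟪⟫ˢ↔sat (φ ⇒ ⊥ᶠ) ρ) (⟪⟫ˢ↔sat ψ ρ)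
    ⟪⟫ˢ↔sat ((φ ⇒ (∀ᶠ θ)) ⇒ ψ) ρ = →-cong (⟪⟫ˢ↔sat (φ ⇒ (∀ᶠ θ)) ρ) (⟪⟫ˢ↔sat ψ ρ)
    ⟪⟫ˢ↔sat ((φ ⇒ (χ ⇒ (x ≐ y))) ⇒ ψ) ρ = →-cong (⟪⟫ˢ↔sat (φ ⇒ (χ ⇒ (x ≐ y))) ρ) (⟪⟫ˢ↔sat ψ ρ)
    ⟪⟫ˢ↔sat ((φ ⇒ (χ ⇒ (x ϵ y))) ⇒ ψ) ρ = →-cong (⟪⟫ˢ↔sat (φ ⇒ (χ ⇒ (x ϵ y))) ρ) (⟪⟫ˢ↔sat ψ ρ)
    ⟪⟫ˢ↔sat ((φ ⇒ (χ ⇒ (θ ⇒ η))) ⇒ ψ) ρ = →-cong (⟪⟫ˢ↔sat (φ ⇒ (χ ⇒ (θ ⇒ η))) ρ) (⟪⟫ˢ↔sat ψ ρ)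
    ⟪⟫ˢ↔sat ((φ ⇒ (χ ⇒ (∀ᶠ θ))) ⇒ ψ) ρ = →-cong (⟪⟫ˢ↔sat (φ ⇒ (χ ⇒ (∀ᶠ θ))) ρ) (⟪⟫ˢ↔sat ψ ρ)
    ⟪⟫ˢ↔sat ((φ ⇒ (χ ⇒ ⊥ᶠ)) ⇒ (x ≐ y)) ρ = →-cong (⟪⟫ˢ↔sat (φ ⇒ (χ ⇒ ⊥ᶠ)) ρ) (⟪⟫ˢ↔sat (x ≐ y) ρ)
    ⟪⟫ˢ↔sat ((φ ⇒ (χ ⇒ ⊥ᶠ)) ⇒ (x ϵ y)) ρ = →-cong (⟪⟫ˢ↔sat (φ ⇒ (χ ⇒ ⊥ᶠ)) ρ) (⟪⟫ˢ↔sat (x ϵ y) ρ)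
    ⟪⟫ˢ↔sat ((φ ⇒ (χ ⇒ ⊥ᶠ)) ⇒ (θ ⇒ η)) ρ = →-cong (⟪⟫ˢ↔sat (φ ⇒ (χ ⇒ ⊥ᶠ)) ρ) (⟪⟫ˢ↔sat (θ ⇒ η) ρ)
    ⟪⟫ˢ↔sat ((φ ⇒ (χ ⇒ ⊥ᶠ)) ⇒ (∀ᶠ θ)) ρ = →-cong (⟪⟫ˢ↔sat (φ ⇒ (χ ⇒ ⊥ᶠ)) ρ) (⟪⟫ˢ↔sat (∀ᶠ θ) ρ)
    ⟪⟫ˢ↔sat ((∀ᶠ (x ≐ y)) ⇒ ψ) ρ = →-cong (⟪⟫ˢ↔sat (∀ᶠ (x ≐ y)) ρ) (⟪⟫ˢ↔sat ψ ρ)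
    ⟪⟫ˢ↔sat ((∀ᶠ (x ϵ y)) ⇒ ψ) ρ = →-cong (⟪⟫ˢ↔sat (∀ᶠ (x ϵ y)) ρ) (⟪⟫ˢ↔sat ψ ρ)
    ⟪⟫ˢ↔sat ((∀ᶠ ⊥ᶠ) ⇒ ψ) ρ = →-cong (⟪⟫ˢ↔sat (∀ᶠ ⊥ᶠ) ρ) (⟪⟫ˢ↔sat ψ ρ)
    ⟪⟫ˢ↔sat ((∀ᶠ (∀ᶠ θ)) ⇒ ψ) ρ = →-cong (⟪⟫ˢ↔sat (∀ᶠ (∀ᶠ θ)) ρ) (⟪⟫ˢ↔sat ψ ρ)
    ⟪⟫ˢ↔sat ((∀ᶠ (φ ⇒ (x ≐ y))) ⇒ ψ) ρ = →-cong (⟪⟫ˢ↔sat (∀ᶠ (φ ⇒ (x ≐ y))) ρ) (⟪⟫ˢ↔sat ψ ρ)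
    ⟪⟫ˢ↔sat ((∀ᶠ (φ ⇒ (x ϵ y))) ⇒ ψ) ρ = →-cong (⟪⟫ˢ↔sat (∀ᶠ (φ ⇒ (x ϵ y))) ρ) (⟪⟫ˢ↔sat ψ ρ)
    ⟪⟫ˢ↔sat ((∀ᶠ (φ ⇒ (θ ⇒ η))) ⇒ ψ) ρ = →-cong (⟪⟫ˢ↔sat (∀ᶠ (φ ⇒ (θ ⇒ η))) ρ) (⟪⟫ˢ↔sat ψ ρ)
    ⟪⟫ˢ↔sat ((∀ᶠ (φ ⇒ (∀ᶠ θ))) ⇒ ψ) ρ = →-cong (⟪⟫ˢ↔sat (∀ᶠ (φ ⇒ (∀ᶠ θ))) ρ) (⟪⟫ˢ↔sat ψ ρ)
    ⟪⟫ˢ↔sat ((∀ᶠ (φ ⇒ ⊥ᶠ)) ⇒ (x ≐ y)) ρ = →-cong (⟪⟫ˢ↔sat (∀ᶠ (φ ⇒ ⊥ᶠ)) ρ) (⟪⟫ˢ↔sat (x ≐ y) ρ)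
    ⟪⟫ˢ↔sat ((∀ᶠ (φ ⇒ ⊥ᶠ)) ⇒ (x ϵ y)) ρ = →-cong (⟪⟫ˢ↔sat (∀ᶠ (φ ⇒ ⊥ᶠ)) ρ) (⟪⟫ˢ↔sat (x ϵ y) ρ)
    ⟪⟫ˢ↔sat ((∀ᶠ (φ ⇒ ⊥ᶠ)) ⇒ (θ ⇒ η)) ρ = →-cong (⟪⟫ˢ↔sat (∀ᶠ (φ ⇒ ⊥ᶠ)) ρ) (⟪⟫ˢ↔sat (θ ⇒ η) ρ)
    ⟪⟫ˢ↔sat ((∀ᶠ (φ ⇒ ⊥ᶠ)) ⇒ (∀ᶠ θ)) ρ = →-cong (⟪⟫ˢ↔sat (∀ᶠ (φ ⇒ ⊥ᶠ)) ρ) (⟪⟫ˢ↔sat (∀ᶠ θ) ρ)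

  ⌞_⌟ : Formula n → Fm n
  ⌞ φ ⌟ = mkFm (def-iff (λ ρ → ↔-sym (⟪⟫ˢ↔sat φ ρ)) (def-formula φ))

  opaque
    axiomˢ : {σ : Sentence} → ZF σ → ⟪ σ ⟫ˢ []
    axiomˢ {σ} a = proj₂ (⟪⟫ˢ↔sat σ []) (sat-axiom a)

  -- Operations on sets obtained from the axioms

  extensional : ∀ {x y} → (∀ z → z ∈ x ↔ z ∈ y) → x ≈ y
  extensional = axiomˢ zf-extensionality _ _

  ∈-resp : ∀ {x x′ y y′} → x ≈ x′ → y ≈ y′ → x ∈ y → x′ ∈ y′
  ∈-resp {x} {x′} {y} {y′} e f i =
    leibniz (⌜ x′ ⌝ ∈' v₀) {ρ = []} f (leibniz (v₀ ∈' ⌜ y ⌝) {ρ = []} e i)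

  ∈-respˡ : ∀ {x x′ y} → x ≈ x′ → x ∈ y → x′ ∈ y
  ∈-respˡ e = ∈-resp e ≈-refl

  ∈-respʳ : ∀ {x y y′} → y ≈ y′ → x ∈ y → x ∈ y′
  ∈-respʳ e = ∈-resp ≈-refl e

  tm-cong₁ : (t : Tm 1) → ∀ {x x′} → x ≈ x′ → ev t (x ∷ []) ≈ ev t (x′ ∷ [])
  tm-cong₁ t {x} e = leibniz (⌜ ev t (x ∷ []) ⌝ ≈' t ⟪ v₀ ∷ [] ⟫) {ρ = []} e ≈-refl

  tm-cong₂ : (t : Tm 2) → ∀ {x x′ y y′} → x ≈ x′ → y ≈ y′ → ev t (x ∷ y ∷ []) ≈ ev t (x′ ∷ y′ ∷ [])
  tm-cong₂ t {x} {x′} {y} e f =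
    leibniz (⌜ ev t (x ∷ y ∷ []) ⌝ ≈' t ⟪ ⌜ x′ ⌝ ∷ v₀ ∷ [] ⟫) {ρ = []} f
      (leibniz (⌜ ev t (x ∷ y ∷ []) ⌝ ≈' t ⟪ v₀ ∷ ⌜ y ⌝ ∷ [] ⟫) {ρ = []} e ≈-refl)

  closure-elim : ∀ {n} (φ : Formula n) → Sat (∀-closure φ) [] → ∀ ρ → Sat φ ρ
  closure-elim {zero}  φ s []      = s
  closure-elim {suc n} φ s (d ∷ ρ) = closure-elim (∀ᶠ φ) s ρ d

  separation-body : Formula (1 + n) → Formula n
  separation-body φ = ∀₁ λ x → ∃₁ λ y → ∀₁ λ z → z ϵ y ↑ 1 ⇔ (z ϵ x ↑ 2 ∧ ren (z ▸ (_↑ 3)) φ)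

  replacement-body : Formula (2 + n) → Formula n
  replacement-body φ = ∀₁ λ a →
    (∀₃ λ x y y′ → x ϵ a ↑ 3 ∧ ren (x ▸ y ▸ (_↑ 4)) φ ∧ ren (x ▸ y′ ▸ (_↑ 4)) φ ⇒ y ≐ y′) ⇒
    (∃₁ λ b → ∀₁ λ y → y ϵ b ↑ 1 ⇔ (∃∈ (a ↑ 2) λ x → ren (x ▸ y ↑ 1 ▸ (_↑ 4)) φ))

  opaque
    separate : (a : D) (P : Fm (suc n)) (ρ : Vec D n) →
               Σ D λ y → ∀ z → z ∈ y ↔ (z ∈ a × ⟦ P ⟧ (z ∷ ρ))
    separate {n} a P ρ with mkDef p c r ← def P
      with proj₂ (⟪⟫ˢ↔sat (separation-body c) (ρ ++ p))
        (closure-elim (separation-body c) (sat-axiom (zf-separation c)) (ρ ++ p)) a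
    ... | y , f = y , λ z →
          (λ i → proj₁ (proj₁ (f z) i) , proj₁ (equiv z) (proj₂ (proj₁ (f z) i))) ,
          (λ { (i , q) → proj₂ (f z) (i , proj₂ (equiv z) q) })
      where
      equiv : ∀ z → ⟪ ren (zero ▸ (_↑ 3)) c ⟫ˢ (z ∷ y ∷ a ∷ ρ ++ p) ↔ ⟦ P ⟧ (z ∷ ρ)
      equiv z = ↔-sym (r (z ∷ ρ)) ↔∘
        sat-ren c (zero ▸ (_↑ 3)) {ρ = z ∷ y ∷ a ∷ ρ ++ p} (λ { zero → refl ; (suc i) → refl }) ↔∘
        ⟪⟫ˢ↔sat (ren (zero ▸ (_↑ 3)) c) (z ∷ y ∷ a ∷ ρ ++ p)

    replace : (a : D) (P : Fm 2) → (∀ x y y′ → x ∈ a → ⟦ P ⟧ (x ∷ y ∷ []) → ⟦ P ⟧ (x ∷ y′ ∷ []) → y ≈ y′) →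
              Σ D λ b → ∀ y → y ∈ b ↔ (Σ D λ x → x ∈ a × ⟦ P ⟧ (x ∷ y ∷ []))
    replace a P functional with mkDef p c r ← def P
      with proj₂ (⟪⟫ˢ↔sat (replacement-body c) p)
        (closure-elim (replacement-body c) (sat-axiom (zf-replacement c)) p) a
    ... | f = case f (λ x y y′ (i , q , q′) → functional x y y′ i
            (proj₁ (equiv {ρ = y′ ∷ y ∷ x ∷ a ∷ p} λ { zero → refl ; (suc zero) → refl ; (suc (suc i)) → refl }) q)
            (proj₁ (equiv {ρ = y′ ∷ y ∷ x ∷ a ∷ p} λ { zero → refl ; (suc zero) → refl ; (suc (suc i)) → refl }) q′)) of λ
          { (b , g) → b , λ y →
              (λ i → case proj₁ (g y) i of λ { (x , j , q) → x , j , proj₁ (eq₃ x y b) q }) ,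
              (λ { (x , j , q) → proj₂ (g y) (x , j , proj₂ (eq₃ x y b) q) }) }
      where
      equiv : ∀ {m x y} {σ : Fin (2 + _) → Fin m} {ρ : Vec D m} →
              (∀ i → lookup ρ (σ i) ≡ lookup (x ∷ y ∷ p) i) → ⟪ ren σ c ⟫ˢ ρ ↔ ⟦ P ⟧ (x ∷ y ∷ [])
      equiv {x = x} {y} {σ} {ρ} h = ↔-sym (r (x ∷ y ∷ [])) ↔∘ sat-ren c σ {ρ = ρ} h ↔∘ ⟪⟫ˢ↔sat (ren σ c) ρ
      eq₃ : ∀ x y b → ⟪ ren (zero ▸ suc zero ▸ (_↑ 4)) c ⟫ˢ (x ∷ y ∷ b ∷ a ∷ p) ↔ ⟦ P ⟧ (x ∷ y ∷ [])
      eq₃ x y b = equiv {ρ = x ∷ y ∷ b ∷ a ∷ p} λ { zero → refl ; (suc zero) → refl ; (suc (suc i)) → refl }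

  skip : Fm (suc n) → Fm (suc (suc n))
  ⟦ skip P ⟧ ρ = ⟦ P ⟧ (head ρ ∷ tail (tail ρ))
  def (skip P) = def-iff (λ { (x ∷ y ∷ ρ) → ↔-≡ (cong (λ θ → ⟦ P ⟧ (x ∷ θ)) (tabulate∘lookup ρ)) })
    (def-ren (lift 1 suc) (def P))

  -- By extensionality, definable membership in the values of `F` already makes the graph of `F`
  -- definable.
  set-tm : {F : Vec D n → D} (P : Fm (suc n)) → (∀ ρ z → z ∈ F ρ ↔ ⟦ P ⟧ (z ∷ ρ)) → Tm n
  ev (set-tm {F = F} P h) = F
  graph (set-tm {F = F} P h) = def-iff (λ { (w ∷ ρ) →
      (λ f → extensional λ z → ↔-sym (h ρ z) ↔∘ (proj₁ (f z) , proj₂ (f z))) ,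
      (λ e z → (λ i → proj₁ (h ρ z) (∈-respʳ e i)) , (λ p → ∈-respʳ (≈-sym e) (proj₂ (h ρ z) p))) })
    (def (∀' ((v₀ ∈' v₁ ⇒' skip P) ∧' (skip P ⇒' v₀ ∈' v₁))))

  opaque
    sep : D → Fm (suc n) → Vec D n → D
    sep a P ρ = proj₁ (separate a P ρ)

    ∈-sep : ∀ {a} {P : Fm (suc n)} {ρ z} → z ∈ sep a P ρ ↔ (z ∈ a × ⟦ P ⟧ (z ∷ ρ))
    ∈-sep {a = a} {P} {ρ} {z} = proj₂ (separate a P ρ) z

    pair : D → D → D
    pair x y = proj₁ (axiomˢ zf-pairing x y)

    ∈-pair : ∀ {x y z} → z ∈ pair x y ↔ (z ≈ x or z ≈ y)
    ∈-pair {x} {y} {z} = proj₂ (axiomˢ zf-pairing x y) z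

    ⋃ : D → D
    ⋃ x = proj₁ (axiomˢ zf-union x)

    ∈-⋃ : ∀ {x z} → z ∈ ⋃ x ↔ (Σ D λ y → y ∈ x × z ∈ y)
    ∈-⋃ {x} {z} = proj₂ (axiomˢ zf-union x) z

    𝒫 : D → D
    𝒫 x = proj₁ (axiomˢ zf-powerset x)

    ∈-𝒫 : ∀ {x z} → z ∈ 𝒫 x ↔ (∀ w → w ∈ z → w ∈ x)
    ∈-𝒫 {x} {z} = proj₂ (axiomˢ zf-powerset x) z

    infinite : D
    infinite = proj₁ (axiomˢ zf-infinity)

    infinite-inductive : ⟪ IsInductive zero ⟫ˢ (infinite ∷ [])
    infinite-inductive = proj₂ (axiomˢ zf-infinity)

    ∅ : D
    ∅ = proj₁ (proj₁ infinite-inductive)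

    ∉-∅ : ∀ {z} → ¬ z ∈ ∅
    ∉-∅ {z} = proj₂ (proj₂ (proj₁ infinite-inductive)) z

  pair' : Tm n → Tm n → Tm n
  pair' t s = set-tm {F = λ { (x ∷ y ∷ []) → pair x y }} (v₀ ≈' v₁ ∨' v₀ ≈' v₂)
    (λ { (x ∷ y ∷ []) z → ∈-pair }) ⟪ t ∷ s ∷ [] ⟫

  ⋃' : Tm n → Tm n
  ⋃' t = set-tm {F = λ { (x ∷ []) → ⋃ x }} (∃∈' v₁ (v₁ ∈' v₀)) (λ { (x ∷ []) z → ∈-⋃ }) ⟪ t ∷ [] ⟫

  ∅-unique : ∀ {x} → (∀ z → ¬ z ∈ x) → x ≈ ∅
  ∅-unique h = extensional λ z → (λ i → exfalso (h z i)) , (λ i → exfalso (∉-∅ i))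

  ∈-pairˡ : ∀ {x y} → x ∈ pair x y
  ∈-pairˡ = proj₂ ∈-pair (inl ≈-refl)

  ∈-pairʳ : ∀ {x y} → y ∈ pair x y
  ∈-pairʳ = proj₂ ∈-pair (inr ≈-refl)

  pair-cong : ∀ {x x′ y y′} → x ≈ x′ → y ≈ y′ → pair x y ≈ pair x′ y′
  pair-cong = tm-cong₂ (pair' v₀ v₁)

  ∈-single : ∀ {x z} → z ∈ pair x x ↔ z ≈ x
  ∈-single = (λ i → or-elim (proj₁ ∈-pair i) id id) , (λ e → ∈-respˡ (≈-sym e) ∈-pairˡ)

  -- Lets an opaque operation be used as a term, which keeps normal forms small: definability is
  -- inherited from a transparent term with the same values.
  named₁ : (F : D → D) (t : Tm 1) → (∀ x → F x ≈ ev t (x ∷ [])) → Tm 1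
  ev (named₁ F t h) ρ = F (head ρ)
  graph (named₁ F t h) = def-iff
    (λ { (z ∷ x ∷ []) → (λ e → ≈-trans e (≈-sym (h x))) , (λ e → ≈-trans e (h x)) }) (graph t)

  named₂ : (F : D → D → D) (t : Tm 2) → (∀ x y → F x y ≈ ev t (x ∷ y ∷ [])) → Tm 2
  ev (named₂ F t h) ρ = F (head ρ) (head (tail ρ))
  graph (named₂ F t h) = def-iff
    (λ { (z ∷ x ∷ y ∷ []) → (λ e → ≈-trans e (≈-sym (h x y))) , (λ e → ≈-trans e (h x y)) }) (graph t)

  opaque
    op : D → D → D
    op x y = pair (pair x x) (pair x y)

    op-def : ∀ x y → op x y ≈ pair (pair x x) (pair x y)
    op-def x y = ≈-refl

  op' : Tm n → Tm n → Tm n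
  op' t s = named₂ op (pair' (pair' v₀ v₀) (pair' v₀ v₁)) op-def ⟪ t ∷ s ∷ [] ⟫

  op-cong : ∀ {x x′ y y′} → x ≈ x′ → y ≈ y′ → op x y ≈ op x′ y′
  op-cong = tm-cong₂ (op' v₀ v₁)

  single-pair : ∀ {x y z} → pair x x ≈ pair y z → x ≈ y × x ≈ z
  single-pair e = ≈-sym (proj₁ ∈-single (∈-respʳ (≈-sym e) ∈-pairˡ)) ,
                  ≈-sym (proj₁ ∈-single (∈-respʳ (≈-sym e) ∈-pairʳ))

  pair-injʳ : ∀ {x y z} → pair x y ≈ pair x z → y ≈ z
  pair-injʳ e = or-elim (proj₁ ∈-pair (∈-respʳ e ∈-pairʳ))
    (λ y≈x → or-elim (proj₁ ∈-pair (∈-respʳ (≈-sym e) ∈-pairʳ))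
      (λ z≈x → ≈-trans y≈x (≈-sym z≈x)) ≈-sym) id

  opaque
    unfolding op

    op-injˡ : ∀ {x y x′ y′} → op x y ≈ op x′ y′ → x ≈ x′
    op-injˡ e = or-elim (proj₁ ∈-pair (∈-respʳ e ∈-pairˡ))
      (λ f → proj₁ (single-pair f)) (λ f → proj₁ (single-pair f))

    op-injʳ : ∀ {x y x′ y′} → op x y ≈ op x′ y′ → y ≈ y′
    op-injʳ e = pair-injʳ (pair-injʳ (≈-trans e (op-cong (≈-sym (op-injˡ e)) ≈-refl)))

    op≉∅ : ∀ {x y} → ¬ op x y ≈ ∅
    op≉∅ e = ∉-∅ (∈-respʳ e ∈-pairˡ)

  sucˢ : D → D
  sucˢ x = ⋃ (pair x (pair x x))

  sucˢ' : Tm n → Tm n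
  sucˢ' t = ⋃' (pair' t (pair' t t))

  ∈-suc : ∀ {x z} → z ∈ sucˢ x ↔ (z ∈ x or z ≈ x)
  ∈-suc =
    (λ i → case proj₁ ∈-⋃ i of λ { (y , j , h) → or-elim (proj₁ ∈-pair j)
      (λ e → inl (∈-respʳ e h)) (λ e → inr (proj₁ ∈-single (∈-respʳ e h))) }) ,
    (λ o → or-elim o (λ i → proj₂ ∈-⋃ (_ , ∈-pairˡ , i))
      (λ e → proj₂ ∈-⋃ (_ , ∈-pairʳ , proj₂ ∈-single e)))

  one : D
  one = sucˢ ∅

  infixr 7 _∪_
  _∪_ : D → D → D
  x ∪ y = ⋃ (pair x y)

  ∈-∪ : ∀ {x y z} → z ∈ x ∪ y ↔ (z ∈ x or z ∈ y)
  ∈-∪ =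
    (λ i → case proj₁ ∈-⋃ i of λ { (y , j , h) → or-elim (proj₁ ∈-pair j)
      (λ e → inl (∈-respʳ e h)) (λ e → inr (∈-respʳ e h)) }) ,
    (λ o → or-elim o (λ i → proj₂ ∈-⋃ (_ , ∈-pairˡ , i)) (λ i → proj₂ ∈-⋃ (_ , ∈-pairʳ , i)))

  opaque
    unfolding op

    prod : D → D → D
    prod a b = sep (𝒫 (𝒫 (a ∪ b))) (∃∈' ⌜ a ⌝ (∃∈' ⌜ b ⌝ (v₂ ≈' op' v₁ v₀))) []

    ∈-prod : ∀ {a b p} → p ∈ prod a b ↔ (Σ D λ x → x ∈ a × (Σ D λ y → y ∈ b × p ≈ op x y))
    ∈-prod {a} {b} {p} =
      (λ i → proj₂ (proj₁ ∈-sep i)) ,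
      (λ { (x , i , y , j , e) → proj₂ ∈-sep
        (∈-respˡ (≈-sym e) (proj₂ ∈-𝒫 λ w h → proj₂ ∈-𝒫 λ v k →
          or-elim (proj₁ ∈-pair h)
            (λ e′ → proj₂ ∈-∪ (inl (∈-respˡ (≈-sym (proj₁ ∈-single (∈-respʳ e′ k))) i)))
            (λ e′ → or-elim (proj₁ ∈-pair (∈-respʳ e′ k))
              (λ f → proj₂ ∈-∪ (inl (∈-respˡ (≈-sym f) i)))
              (λ f → proj₂ ∈-∪ (inr (∈-respˡ (≈-sym f) j))))) ,
        x , i , y , j , e) })

  op∈prod : ∀ {a b x y} → x ∈ a → y ∈ b → op x y ∈ prod a b
  op∈prod i j = proj₂ ∈-prod (_ , i , _ , j , ≈-refl)

  op∈prod⁻ : ∀ {a b x y} → op x y ∈ prod a b → x ∈ a × y ∈ b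
  op∈prod⁻ i with proj₁ ∈-prod i
  ... | x , j , y , h , e = ∈-respˡ (≈-sym (op-injˡ e)) j , ∈-respˡ (≈-sym (op-injʳ e)) h

  -- The notions of Defs in terms of these operations

  isPair : ∀ {p x y} → ⟪ IsPair zero (suc zero) (suc (suc zero)) ⟫ˢ (p ∷ x ∷ y ∷ []) ↔ p ≈ pair x y
  isPair = (λ f → extensional λ z → ↔-sym ∈-pair ↔∘ f z) ,
    (λ e z → (λ i → proj₁ ∈-pair (∈-respʳ e i)) , (λ o → ∈-respʳ (≈-sym e) (proj₂ ∈-pair o)))

  isOPair : ∀ {p x y} → ⟪ IsOPair zero (suc zero) (suc (suc zero)) ⟫ˢ (p ∷ x ∷ y ∷ []) ↔ p ≈ op x y
  isOPair = (λ { (a , b , e , f , g) → ≈-trans (≈-trans (proj₁ isPair g)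
        (pair-cong (proj₁ isPair e) (proj₁ isPair f))) (≈-sym (op-def _ _)) }) ,
    (λ e → _ , _ , proj₂ isPair ≈-refl , proj₂ isPair ≈-refl , proj₂ isPair (≈-trans e (op-def _ _)))

  related : ∀ {r x y} → ⟪ Related zero (suc zero) (suc (suc zero)) ⟫ˢ (r ∷ x ∷ y ∷ []) ↔ op x y ∈ r
  related = (λ { (p , i , e) → ∈-respˡ (proj₁ isOPair e) i }) , (λ i → _ , i , proj₂ isOPair ≈-refl)

  isEmpty : ∀ {x} → ⟪ IsEmpty zero ⟫ˢ (x ∷ []) ↔ x ≈ ∅
  isEmpty = ∅-unique , (λ e z i → ∉-∅ (∈-respʳ e i))

  isSuccessor : ∀ {s x} → ⟪ IsSuccessor zero (suc zero) ⟫ˢ (s ∷ x ∷ []) ↔ s ≈ sucˢ x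
  isSuccessor = (λ f → extensional λ z → ↔-sym ∈-suc ↔∘ f z) ,
    (λ e z → (λ i → proj₁ ∈-suc (∈-respʳ e i)) , (λ o → ∈-respʳ (≈-sym e) (proj₂ ∈-suc o)))

  isProduct : ∀ {c a b} → ⟪ IsProduct zero (suc zero) (suc (suc zero)) ⟫ˢ (c ∷ a ∷ b ∷ []) ↔ c ≈ prod a b
  isProduct = (λ f → extensional λ z →
        (λ i → case proj₁ (f z) i of λ { (x , y , j , h , e) → proj₂ ∈-prod (x , j , y , h , proj₁ isOPair e) }) ,
        (λ i → case proj₁ ∈-prod i of λ { (x , j , y , h , e) → proj₂ (f z) (x , y , j , h , proj₂ isOPair e) })) ,
    (λ e z →
        (λ i → case proj₁ ∈-prod (∈-respʳ e i) of λ { (x , j , y , h , e′) → x , y , j , h , proj₂ isOPair e′ }) ,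
        (λ { (x , y , j , h , e′) → ∈-respʳ (≈-sym e) (proj₂ ∈-prod (x , j , y , h , proj₁ isOPair e′)) }))

  prod' : Tm n → Tm n → Tm n
  prod' t s = set-tm {F = λ { (a ∷ b ∷ []) → prod a b }} (∃∈' v₁ (∃∈' v₃ (v₂ ≈' op' v₁ v₀)))
    (λ { (a ∷ b ∷ []) z → ∈-prod }) ⟪ t ∷ s ∷ [] ⟫

  sep' : Tm n → Fm (suc n) → Tm n
  sep' t P = set-tm {F = λ ρ → sep (ev t ρ) P ρ} (v₀ ∈' shift t ∧' P) (λ ρ z → ∈-sep)

  -- Definite description: a junk value unless exactly one element of b satisfies P.
  the : D → Fm (suc n) → Vec D n → D
  the b P ρ = ⋃ (sep b P ρ)

  the' : Tm n → Fm (suc n) → Tm n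
  the' t P = ⋃' (sep' t P)

  the-unique : ∀ {b} (P : Fm (suc n)) {ρ x} → x ∈ b → ⟦ P ⟧ (x ∷ ρ) →
               (∀ y → y ∈ b → ⟦ P ⟧ (y ∷ ρ) → y ≈ x) → the b P ρ ≈ x
  the-unique P i p u = extensional λ z →
    (λ j → case proj₁ ∈-⋃ j of λ { (y , h , k) → case proj₁ ∈-sep h of λ { (h′ , q) → ∈-respʳ (u y h′ q) k } }) ,
    (λ j → proj₂ ∈-⋃ (_ , proj₂ ∈-sep (i , p) , j))

  -- Natural numbers

  Natural Inductive : D → Set
  Natural k = ⟪ IsNatural zero ⟫ˢ (k ∷ [])
  Inductive i = ⟪ IsInductive zero ⟫ˢ (i ∷ [])

  natural-∅ : Natural ∅
  natural-∅ i ((e , e∈i , p) , _) = ∈-respˡ (proj₁ isEmpty p) e∈i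

  natural-suc : ∀ {k} → Natural k → Natural (sucˢ k)
  natural-suc h i ind with proj₂ ind _ (h i ind)
  ... | s , s∈i , p = ∈-respˡ (proj₁ isSuccessor p) s∈i

  natural-induction : (P : Fm 1) → ⟦ P ⟧ (∅ ∷ []) →
    (∀ k → Natural k → ⟦ P ⟧ (k ∷ []) → ⟦ P ⟧ (sucˢ k ∷ [])) → ∀ k → Natural k → ⟦ P ⟧ (k ∷ [])
  natural-induction P base step k h = proj₂ (proj₂ (proj₁ ∈-sep (h _ closed)))
    where
    Q : Fm 1
    Q = ⌞ IsNatural zero ⌟ ∧' P
    closed : Inductive (sep infinite Q [])
    closed = (∅ , proj₂ ∈-sep (natural-∅ infinite infinite-inductive , natural-∅ , base) , proj₂ isEmpty ≈-refl) ,
      λ x i → case proj₁ ∈-sep i of λ { (_ , nat , p) → sucˢ x , proj₂ ∈-sep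
        (natural-suc nat infinite infinite-inductive , natural-suc nat , step x nat p) , proj₂ isSuccessor ≈-refl }

  -- Foundation applied to the pair of `x` and `y`. It makes `sucˢ` injective on all sets, not
  -- merely on natural numbers.
  ∈-asymmetric : ∀ {x y} → x ∈ y → ¬ y ∈ x
  ∈-asymmetric {x} {y} i j with axiomˢ zf-foundation (pair x y) (x , ∈-pairˡ)
  ... | z , h , f = or-elim (proj₁ ∈-pair h)
    (λ e → f (y , ∈-pairʳ , ∈-respʳ (≈-sym e) j)) (λ e → f (x , ∈-pairˡ , ∈-respʳ (≈-sym e) i))

  sucˢ-injective : ∀ {x y} → sucˢ x ≈ sucˢ y → x ≈ y
  sucˢ-injective {x} {y} e = or-elim (proj₁ ∈-suc (∈-respʳ e (proj₂ ∈-suc (inr ≈-refl))))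
    (λ x∈y → or-elim (proj₁ ∈-suc (∈-respʳ (≈-sym e) (proj₂ ∈-suc (inr ≈-refl))))
      (λ y∈x → exfalso (∈-asymmetric x∈y y∈x)) ≈-sym) id

  sucˢ≉∅ : ∀ {x} → ¬ sucˢ x ≈ ∅
  sucˢ≉∅ e = ∉-∅ (∈-respʳ e (proj₂ ∈-suc (inr ≈-refl)))

  sucˢ-cong : ∀ {x y} → x ≈ y → sucˢ x ≈ sucˢ y
  sucˢ-cong = tm-cong₁ (sucˢ' v₀)

  ∅≉one : ¬ ∅ ≈ one
  ∅≉one e = sucˢ≉∅ (≈-sym e)

  opaque
    ω : D
    ω = sep infinite ⌞ IsNatural zero ⌟ []

    ∈-ω : ∀ {k} → k ∈ ω ↔ Natural k
    ∈-ω = (λ i → proj₂ (proj₁ ∈-sep i)) , (λ h → proj₂ ∈-sep (h infinite infinite-inductive , h))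

  -- Iteration of an operation along ω

  module Iterates (F : Tm 1) (s : D) where

    f : D → D
    f S = ev F (S ∷ [])

    Continues : Fm 2
    Continues = ∃' (∃' (op' v₁ v₀ ∈' v₃ ∧' v₂ ≈' op' (sucˢ' v₁) (F ⟪ v₀ ∷ [] ⟫)))

    -- Every pair in t is ⟨0 , s⟩ or ⟨k + 1 , f S⟩ for some ⟨k , S⟩ in t.
    Traced : Fm 1
    Traced = ∀∈' v₀ (v₀ ≈' op' ⌜ ∅ ⌝ ⌜ s ⌝ ∨' Continues ⟨ v₀ ∷ v₁ ∷ [] ⟩)

    -- A trace need be neither a function nor defined on an initial segment; every pair in it merely
    -- has a history. Uniqueness of the value at `k` then follows by induction.
    Reaches : Fm 2
    Reaches = ∃' (Traced ⟨ v₀ ∷ [] ⟩ ∧' op' v₁ v₂ ∈' v₀)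

    reaches-∅ : ∀ {S} → ⟦ Reaches ⟧ (∅ ∷ S ∷ []) → S ≈ s
    reaches-∅ (t , tr , i) = or-elim (tr _ i) op-injʳ
      λ { (k , S′ , _ , e) → exfalso (sucˢ≉∅ (≈-sym (op-injˡ e))) }

    reaches-suc : ∀ {k S} → ⟦ Reaches ⟧ (sucˢ k ∷ S ∷ []) → Σ D λ S′ → ⟦ Reaches ⟧ (k ∷ S′ ∷ []) × S ≈ f S′
    reaches-suc {k} {S} (t , tr , i) = or-elim {{pred-stable}} (tr _ i)
      (λ e → exfalso {{pred-stable}} (sucˢ≉∅ (op-injˡ e)))
      λ { (k′ , S′ , j , e) → S′ ,
        (t , tr , ∈-respˡ (op-cong (≈-sym (sucˢ-injective (op-injˡ e))) ≈-refl) j) , op-injʳ e }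
      where
      pred-stable : Stable (Σ D λ S′ → ⟦ Reaches ⟧ (k ∷ S′ ∷ []) × S ≈ f S′)
      pred-stable = fm-stable (∃' (Reaches ⟨ ⌜ k ⌝ ∷ v₀ ∷ [] ⟩ ∧' ⌜ S ⌝ ≈' F ⟪ v₀ ∷ [] ⟫)) []

    reaches-step : ∀ {k S} → ⟦ Reaches ⟧ (k ∷ S ∷ []) → ⟦ Reaches ⟧ (sucˢ k ∷ f S ∷ [])
    reaches-step {k} {S} (t , tr , i) = t ∪ pair p p , traced , proj₂ ∈-∪ (inr ∈-pairˡ)
      where
      p : D
      p = op (sucˢ k) (f S)
      traced : ⟦ Traced ⟧ (t ∪ pair p p ∷ [])
      traced q j = or-elim
        {{fm-stable (v₀ ≈' op' ⌜ ∅ ⌝ ⌜ s ⌝ ∨' Continues) (q ∷ t ∪ pair p p ∷ [])}} (proj₁ ∈-∪ j)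
        (λ h ¬z → let (k′ , S′ , l , e) = tr q h ¬z in k′ , S′ , proj₂ ∈-∪ (inl l) , e)
        (λ h _ → k , S , proj₂ ∈-∪ (inl i) , proj₁ ∈-single h)

    reaches-start : ⟦ Reaches ⟧ (∅ ∷ s ∷ [])
    reaches-start = pair p p ,
      (λ q j → inl {{fm-stable Continues (q ∷ pair p p ∷ [])}} (proj₁ ∈-single j)) , ∈-pairˡ
      where
      p : D
      p = op ∅ s

    reaches-unique : ∀ k → Natural k → ∀ S S′ → ⟦ Reaches ⟧ (k ∷ S ∷ []) → ⟦ Reaches ⟧ (k ∷ S′ ∷ []) → S ≈ S′
    reaches-unique = natural-induction
      (∀' (∀' (Reaches ⟨ v₂ ∷ v₁ ∷ [] ⟩ ⇒' Reaches ⟨ v₂ ∷ v₀ ∷ [] ⟩ ⇒' v₁ ≈' v₀)))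
      (λ S S′ r r′ → ≈-trans (reaches-∅ r) (≈-sym (reaches-∅ r′)))
      λ k _ ih S S′ r r′ → case reaches-suc r of λ { (T , q , e) → case reaches-suc r′ of λ { (T′ , q′ , e′) →
        ≈-trans e (≈-trans (tm-cong₁ F (ih T T′ q q′)) (≈-sym e′)) } }

    -- Replacement along `ω`. The result is the ambient set from which Separation cuts out the
    -- words, and later the families of balls.
    family : Σ D λ C → s ∈ C × (∀ S → S ∈ C → f S ∈ C)
    family = case replace ω Reaches (λ k S S′ i → reaches-unique k (proj₁ ∈-ω i) S S′) of λ
      { (C , h) → C , proj₂ (h s) (∅ , proj₂ ∈-ω natural-∅ , reaches-start) ,
        λ S i → case proj₁ (h S) i of λ { (k , j , r) →
          proj₂ (h (f S)) (sucˢ k , proj₂ ∈-ω (natural-suc (proj₁ ∈-ω j)) , reaches-step r) } }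

  -- Letters and words

  two : D
  two = pair ∅ one

  Λ : D → D
  Λ A = prod A two

  isPositive : ∀ {a x} → ⟪ IsPositive zero (suc zero) ⟫ˢ (a ∷ x ∷ []) ↔ a ≈ op x ∅
  isPositive = (λ { (e , p , q) → ≈-trans (proj₁ isOPair q) (op-cong ≈-refl (proj₁ isEmpty p)) }) ,
    (λ e → ∅ , proj₂ isEmpty ≈-refl , proj₂ isOPair e)

  isNegative : ∀ {a x} → ⟪ IsNegative zero (suc zero) ⟫ˢ (a ∷ x ∷ []) ↔ a ≈ op x one
  isNegative = (λ { (e , i , p , q , r) → ≈-trans (proj₁ isOPair r)
        (op-cong ≈-refl (≈-trans (proj₁ isSuccessor q) (sucˢ-cong (proj₁ isEmpty p)))) }) ,
    (λ e → ∅ , one , proj₂ isEmpty ≈-refl , proj₂ isSuccessor ≈-refl , proj₂ isOPair e)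

  pos∈Λ : ∀ {A x} → x ∈ A → op x ∅ ∈ Λ A
  pos∈Λ i = op∈prod i ∈-pairˡ

  neg∈Λ : ∀ {A x} → x ∈ A → op x one ∈ Λ A
  neg∈Λ i = op∈prod i ∈-pairʳ

  ∈Λ-elim : ∀ {A a} {C : Set} {{_ : Stable C}} → a ∈ Λ A →
            (∀ x → x ∈ A → a ≈ op x ∅ → C) → (∀ x → x ∈ A → a ≈ op x one → C) → C
  ∈Λ-elim i f g with proj₁ ∈-prod i
  ... | x , j , s , h , e = or-elim (proj₁ ∈-pair h)
    (λ e′ → f x j (≈-trans e (op-cong ≈-refl e′))) (λ e′ → g x j (≈-trans e (op-cong ≈-refl e′)))

  isLetter : ∀ {A a} → ⟪ IsLetter zero (suc zero) ⟫ˢ (A ∷ a ∷ []) ↔ a ∈ Λ A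
  isLetter {A} {a} =
    (λ { (x , i , o) → or-elim o
      (λ p → ∈-respˡ (≈-sym (proj₁ (isPositive {a} {x}) p)) (pos∈Λ i))
      (λ p → ∈-respˡ (≈-sym (proj₁ (isNegative {a} {x}) p)) (neg∈Λ i)) }) ,
    (λ i → ∈Λ-elim {{fm-stable ⌞ IsLetter zero (suc zero) ⌟ (A ∷ a ∷ [])}} i
      (λ x j e → x , j , inl {{fm-stable ⌞ IsNegative zero (suc zero) ⌟ (a ∷ x ∷ [])}} (proj₂ isPositive e))
      (λ x j e → x , j , inr (proj₂ isNegative e)))

  Closed : D → D → Set
  Closed A S = ∅ ∈ S × (∀ a v → a ∈ Λ A → v ∈ S → op a v ∈ S)

  IsClosed : Formula 2
  IsClosed = (∃∈ S λ e → IsEmpty e) ∧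
    (∀₃ λ a v av → IsLetter (A ↑ 3) a ∧ v ϵ S ↑ 3 ∧ IsOPair av a v ⇒ av ϵ S ↑ 3)
    where
    S A : Fin 2
    S = zero
    A = suc zero

  module _ (A : D) where

    private
      next : Tm 1
      next = prod' ⌜ Λ A ⌝ v₀

    opaque
      closed-set : Σ D (Closed A)
      -- The iterates of `next` on the set of the empty word are the sets of words of a fixed
      -- length, so their union is closed under prefixing.
      closed-set = case Iterates.family next (pair ∅ ∅) of λ
        { (C , i , h) → ⋃ C , proj₂ ∈-⋃ (_ , i , ∈-pairˡ) ,
          λ a v j k → case proj₁ ∈-⋃ k of λ { (S , l , v∈S) → proj₂ ∈-⋃ (_ , h S l , op∈prod j v∈S) } }

      W : D
      W = sep (proj₁ closed-set) (⌞ IsWord zero (suc zero) ⌟ ⟨ ⌜ A ⌝ ∷ v₀ ∷ [] ⟩) []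

      closed-sem : ∀ {S} → Closed A S → ⟪ IsClosed ⟫ˢ (S ∷ A ∷ [])
      closed-sem (i , h) = (∅ , i , proj₂ isEmpty ≈-refl) , λ a v av (l , k , e) →
        ∈-respˡ (≈-sym (proj₁ (isOPair {av} {a} {v}) e)) (h a v (proj₁ (isLetter {A} {a}) l) k)

      sem-closed : ∀ {S} → ⟪ IsClosed ⟫ˢ (S ∷ A ∷ []) → Closed A S
      sem-closed ((e , i , p) , h) = ∈-respˡ (proj₁ (isEmpty {e}) p) i , λ a v l k →
        h a v (op a v) (proj₂ (isLetter {A} {a}) l , k , proj₂ (isOPair {op a v} {a} {v}) ≈-refl)

      isWord : ∀ {w} → ⟪ IsWord zero (suc zero) ⟫ˢ (A ∷ w ∷ []) ↔ w ∈ W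
      isWord {w} = (λ h → proj₂ ∈-sep (h (proj₁ closed-set) (closed-sem (proj₂ closed-set)) , h)) ,
        (λ i → proj₂ (proj₁ ∈-sep i))

      W-closed : Closed A W
      W-closed = proj₁ (isWord {∅}) (λ S c → proj₁ (sem-closed {S} c)) ,
        λ a v i j → proj₁ (isWord {op a v}) λ S c → proj₂ (sem-closed {S} c) a v i (proj₂ (isWord {v}) j S c)

      W-least : ∀ {S} → Closed A S → ∀ {w} → w ∈ W → w ∈ S
      W-least {S} c {w} j = proj₂ (isWord {w}) j S (closed-sem c)

    ∅∈W : ∅ ∈ W
    ∅∈W = proj₁ W-closed

    cons∈W : ∀ {a v} → a ∈ Λ A → v ∈ W → op a v ∈ W
    cons∈W = proj₂ W-closed _ _

    word-induction : (P : Fm 1) → ⟦ P ⟧ (∅ ∷ []) →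
      (∀ a v → a ∈ Λ A → v ∈ W → ⟦ P ⟧ (v ∷ []) → ⟦ P ⟧ (op a v ∷ [])) → ∀ w → w ∈ W → ⟦ P ⟧ (w ∷ [])
    word-induction P base step w i = proj₂ (proj₁ ∈-sep (W-least {sep W P []}
      (proj₂ ∈-sep (∅∈W , base) ,
       λ a v j k → case proj₁ ∈-sep k of λ { (k′ , p) → proj₂ ∈-sep (cons∈W j k′ , step a v j k′ p) }) i))

    IsCons : Fm 1
    IsCons = ∃∈' ⌜ Λ A ⌝ (∃∈' ⌜ W ⌝ (v₂ ≈' op' v₁ v₀))

    word-cases : ∀ {w} → w ∈ W → w ≈ ∅ or ⟦ IsCons ⟧ (w ∷ [])
    word-cases {w} = word-induction (v₀ ≈' ⌜ ∅ ⌝ ∨' IsCons)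
      (inl {{fm-stable IsCons (∅ ∷ [])}} ≈-refl) (λ a v i j _ → inr (a , i , v , j , ≈-refl)) w

    cons∈W⁻ : ∀ {a v} → op a v ∈ W → a ∈ Λ A × v ∈ W
    cons∈W⁻ i = or-elim (word-cases i) (λ e → exfalso (op≉∅ e))
      λ { (a , j , v , k , e) → ∈-respˡ (≈-sym (op-injˡ e)) j , ∈-respˡ (≈-sym (op-injʳ e)) k }

    -- Folds of words: the value of ⟨a₁ , … ⟨aₙ , ∅⟩ …⟩ at b is G a₁ (… (G aₙ b)).
    module Fold (V : D) (G : Tm 2)
                (G∈V : ∀ {a r} → a ∈ Λ A → r ∈ V → ev G (a ∷ r ∷ []) ∈ V) where

      g : D → D → D
      g a r = ev G (a ∷ r ∷ [])

      FoldClosed : Fm 2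
      FoldClosed = op' ⌜ ∅ ⌝ v₁ ∈' v₀ ∧' ∀∈' ⌜ Λ A ⌝ (∀' (∀' (op' v₁ v₀ ∈' v₃ ⇒'
        op' (op' v₂ v₁) (G ⟪ v₂ ∷ v₀ ∷ [] ⟫) ∈' v₃)))

      InGraph : Fm 2
      InGraph = ∀' (FoldClosed ⟨ v₀ ∷ v₂ ∷ [] ⟩ ⇒' v₁ ∈' v₀)

      graph-tm : Tm 1
      graph-tm = sep' ⌜ prod W V ⌝ InGraph

      opaque
        Γ : D → D
        Γ b = sep (prod W V) InGraph (b ∷ [])

        ∈-Γ : ∀ {p b} → p ∈ Γ b ↔ (p ∈ prod W V × ⟦ InGraph ⟧ (p ∷ b ∷ []))
        ∈-Γ = ∈-sep

        Γ-ev : ∀ b → Γ b ≈ ev graph-tm (b ∷ [])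
        Γ-ev b = ≈-refl

      Γₜ : Tm 1
      Γₜ = named₁ Γ graph-tm Γ-ev

      module _ {b : D} (b∈V : b ∈ V) where

        Γ-base : op ∅ b ∈ Γ b
        Γ-base = proj₂ ∈-Γ (op∈prod ∅∈W b∈V , λ R c → proj₁ c)

        Γ-step : ∀ {a v r} → a ∈ Λ A → op v r ∈ Γ b → op (op a v) (g a r) ∈ Γ b
        Γ-step i j = case proj₁ ∈-Γ j of λ { (j′ , h) → case op∈prod⁻ j′ of λ { (k , l) → proj₂ ∈-Γ
          (op∈prod (cons∈W i k) (G∈V i l) , λ R c → proj₂ c _ i _ _ (h R c)) } }

        Inverted : Fm 1
        Inverted = v₀ ≈' op' ⌜ ∅ ⌝ ⌜ b ⌝ ∨' ∃' (∃' (∃' (op' v₁ v₀ ∈' ⌜ Γ b ⌝ ∧'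
          v₃ ≈' op' (op' v₂ v₁) (G ⟪ v₂ ∷ v₀ ∷ [] ⟫))))

        -- The pairs of the inverted form already make up a closed relation, and `Γ b` is contained
        -- in every closed relation.
        Γ-inversion : ∀ {p} → p ∈ Γ b → ⟦ Inverted ⟧ (p ∷ [])
        Γ-inversion {p} i = proj₂ (proj₁ ∈-sep (proj₂ (proj₁ ∈-Γ i) (sep (Γ b) Inverted [])
          (proj₂ ∈-sep (Γ-base , inl {{fm-stable (∃' (∃' (∃' (op' v₁ v₀ ∈' ⌜ Γ b ⌝ ∧' ⌜ op ∅ b ⌝ ≈'
               op' (op' v₂ v₁) (G ⟪ v₂ ∷ v₀ ∷ [] ⟫))))) []}} ≈-refl) ,
           λ a j v r k → case proj₁ ∈-sep k of λ { (k′ , _) →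
             proj₂ ∈-sep (Γ-step j k′ , inr (a , v , r , k′ , ≈-refl)) })))

        Γ-unique : ∀ w → w ∈ W → ∀ r r′ → op w r ∈ Γ b → op w r′ ∈ Γ b → r ≈ r′
        Γ-unique = word-induction (∀' (∀' (op' v₂ v₁ ∈' ⌜ Γ b ⌝ ⇒' op' v₂ v₀ ∈' ⌜ Γ b ⌝ ⇒' v₁ ≈' v₀)))
          (λ r r′ i j → ≈-trans (at-∅ i) (≈-sym (at-∅ j)))
          λ a v _ _ ih r r′ i j → at-cons i λ s h e → at-cons j λ s′ h′ e′ →
            ≈-trans e (≈-trans (tm-cong₂ G ≈-refl (ih s s′ h h′)) (≈-sym e′))
          where
          at-∅ : ∀ {r} → op ∅ r ∈ Γ b → r ≈ b
          at-∅ i = or-elim (Γ-inversion i) op-injʳ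
            λ { (_ , _ , _ , _ , e) → exfalso (op≉∅ (≈-sym (op-injˡ e))) }
          at-cons : ∀ {a v r} {C : Set} {{_ : Stable C}} → op (op a v) r ∈ Γ b →
                    (∀ s → op v s ∈ Γ b → r ≈ g a s → C) → C
          at-cons i k = or-elim (Γ-inversion i) (λ e → exfalso (op≉∅ (op-injˡ e)))
            λ { (a′ , v′ , s , j , e) → k s
              (∈-respˡ (op-cong (≈-sym (op-injʳ (op-injˡ e))) ≈-refl) j)
              (≈-trans (op-injʳ e) (tm-cong₂ G (≈-sym (op-injˡ (op-injˡ e))) ≈-refl)) }

        Γ-total : ∀ w → w ∈ W → Σ D λ r → r ∈ V × op w r ∈ Γ b
        Γ-total = word-induction (∃∈' ⌜ V ⌝ (op' v₁ v₀ ∈' ⌜ Γ b ⌝))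
          (b , b∈V , Γ-base) λ { a v i _ (r , j , h) → g a r , G∈V i j , Γ-step i h }

      IsValue : Fm 3
      IsValue = op' v₁ v₀ ∈' Γₜ ⟪ v₂ ∷ [] ⟫

      fold-tm : Tm 2
      fold-tm = the' ⌜ V ⌝ IsValue

      opaque
        fold : D → D → D
        fold w b = the V IsValue (w ∷ b ∷ [])

        fold-the : ∀ w b → fold w b ≈ the V IsValue (w ∷ b ∷ [])
        fold-the w b = ≈-refl

        fold-ev : ∀ w b → fold w b ≈ ev fold-tm (w ∷ b ∷ [])
        fold-ev w b = ≈-refl

      foldₜ : Tm 2
      foldₜ = named₂ fold fold-tm fold-ev

      fold-graph : ∀ {w b r} → w ∈ W → b ∈ V → op w r ∈ Γ b → fold w b ≈ r
      fold-graph i j h = ≈-trans (fold-the _ _) (the-unique IsValue {_ ∷ _ ∷ []}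
        (proj₂ (op∈prod⁻ (proj₁ (proj₁ ∈-Γ h)))) h λ y _ k → Γ-unique j _ i _ _ k h)

      graph-fold : ∀ {w b} → w ∈ W → b ∈ V → op w (fold w b) ∈ Γ b
      graph-fold i j = case Γ-total j _ i of λ
        { (r , _ , h) → ∈-respˡ (op-cong ≈-refl (≈-sym (fold-graph i j h))) h }

      fold-∈ : ∀ {w b} → w ∈ W → b ∈ V → fold w b ∈ V
      fold-∈ i j = proj₂ (op∈prod⁻ (proj₁ (proj₁ ∈-Γ (graph-fold i j))))

      fold-∅ : ∀ {b} → b ∈ V → fold ∅ b ≈ b
      fold-∅ j = fold-graph ∅∈W j (Γ-base j)

      fold-cons : ∀ {a w b} → a ∈ Λ A → w ∈ W → b ∈ V → fold (op a w) b ≈ g a (fold w b)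
      fold-cons i j k = fold-graph (cons∈W i j) k (Γ-step k i (graph-fold j k))

      fold-cong : ∀ {w w′ b b′} → w ≈ w′ → b ≈ b′ → fold w b ≈ fold w′ b′
      fold-cong = tm-cong₂ foldₜ

  Starts : Fm 2
  Starts = ∃' (v₂ ≈' op' v₁ v₀)

  module Free (A : D) where

    IsInverse : Fm 2
    IsInverse = ∃∈' ⌜ A ⌝ ((v₂ ≈' op' v₀ ⌜ ∅ ⌝ ∧' v₁ ≈' op' v₀ ⌜ one ⌝) ∨'
                           (v₂ ≈' op' v₀ ⌜ one ⌝ ∧' v₁ ≈' op' v₀ ⌜ ∅ ⌝))

    opaque
      inv : D → D
      inv a = the (Λ A) IsInverse (a ∷ [])

      inv-the : ∀ a → inv a ≈ the (Λ A) IsInverse (a ∷ [])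
      inv-the a = ≈-refl

    invₜ : Tm 1
    invₜ = named₁ inv (the' ⌜ Λ A ⌝ IsInverse) inv-the

    inv-cong : ∀ {a b} → a ≈ b → inv a ≈ inv b
    inv-cong = tm-cong₁ invₜ

    inv-pos : ∀ {x} → x ∈ A → inv (op x ∅) ≈ op x one
    inv-pos {x} i = ≈-trans (inv-the _) (the-unique IsInverse {op x ∅ ∷ []} (neg∈Λ i)
      (x , i , inl (≈-refl , ≈-refl))
      λ { y _ (x′ , _ , o) → or-elim o
        (λ { (e , e′) → ≈-trans e′ (op-cong (≈-sym (op-injˡ e)) ≈-refl) })
        (λ { (e , _) → exfalso (∅≉one (op-injʳ e)) }) })

    inv-neg : ∀ {x} → x ∈ A → inv (op x one) ≈ op x ∅
    inv-neg {x} i = ≈-trans (inv-the _) (the-unique IsInverse {op x one ∷ []} (pos∈Λ i)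
      (x , i , inr (≈-refl , ≈-refl))
      λ { y _ (x′ , _ , o) → or-elim o
        (λ { (e , _) → exfalso (∅≉one (≈-sym (op-injʳ e))) })
        (λ { (e , e′) → ≈-trans e′ (op-cong (≈-sym (op-injˡ e)) ≈-refl) }) })

    inv∈Λ : ∀ {a} → a ∈ Λ A → inv a ∈ Λ A
    inv∈Λ i = ∈Λ-elim i
      (λ x j e → ∈-respˡ (≈-sym (≈-trans (inv-cong e) (inv-pos j))) (neg∈Λ j))
      (λ x j e → ∈-respˡ (≈-sym (≈-trans (inv-cong e) (inv-neg j))) (pos∈Λ j))

    inv-inv : ∀ {a} → a ∈ Λ A → inv (inv a) ≈ a
    inv-inv i = ∈Λ-elim i
      (λ x j e → ≈-trans (inv-cong (≈-trans (inv-cong e) (inv-pos j))) (≈-trans (inv-neg j) (≈-sym e)))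
      (λ x j e → ≈-trans (inv-cong (≈-trans (inv-cong e) (inv-neg j))) (≈-trans (inv-pos j) (≈-sym e)))

    areInverse⁻ : ∀ {a b} → ⟪ AreInverseLetters zero (suc zero) (suc (suc zero)) ⟫ˢ (A ∷ a ∷ b ∷ []) →
                  a ∈ Λ A × b ≈ inv a
    areInverse⁻ {a} {b} (x , i , o) = or-elim
        {⟪ IsPositive zero (suc zero) ⟫ˢ (a ∷ x ∷ []) × ⟪ IsNegative zero (suc zero) ⟫ˢ (b ∷ x ∷ [])}
        {⟪ IsNegative zero (suc zero) ⟫ˢ (a ∷ x ∷ []) × ⟪ IsPositive zero (suc zero) ⟫ˢ (b ∷ x ∷ [])} o
        (λ pq → pos (proj₁ (isPositive {a} {x}) (proj₁ pq)) (proj₁ (isNegative {b} {x}) (proj₂ pq)))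
        (λ pq → neg (proj₁ (isNegative {a} {x}) (proj₁ pq)) (proj₁ (isPositive {b} {x}) (proj₂ pq)))
      where
      pos : a ≈ op x ∅ → b ≈ op x one → a ∈ Λ A × b ≈ inv a
      pos e f = ∈-respˡ (≈-sym e) (pos∈Λ i) , ≈-trans f (≈-sym (≈-trans (inv-cong e) (inv-pos i)))
      neg : a ≈ op x one → b ≈ op x ∅ → a ∈ Λ A × b ≈ inv a
      neg e f = ∈-respˡ (≈-sym e) (neg∈Λ i) , ≈-trans f (≈-sym (≈-trans (inv-cong e) (inv-neg i)))

    areInverse⁺ : ∀ {a b} → a ∈ Λ A → b ≈ inv a →
                  ⟪ AreInverseLetters zero (suc zero) (suc (suc zero)) ⟫ˢ (A ∷ a ∷ b ∷ [])
    areInverse⁺ {a} {b} i e = ∈Λ-elim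
        {{fm-stable ⌞ AreInverseLetters zero (suc zero) (suc (suc zero)) ⌟ (A ∷ a ∷ b ∷ [])}} i
        (λ x j f → x , j , pos x j f) (λ x j f → x , j , neg x j f)
      where
      Neg : ∀ x → Set
      Neg x = ⟪ IsNegative zero (suc zero) ⟫ˢ (a ∷ x ∷ []) × ⟪ IsPositive zero (suc zero) ⟫ˢ (b ∷ x ∷ [])
      Pos : ∀ x → Set
      Pos x = ⟪ IsPositive zero (suc zero) ⟫ˢ (a ∷ x ∷ []) × ⟪ IsNegative zero (suc zero) ⟫ˢ (b ∷ x ∷ [])
      pos : ∀ x → x ∈ A → a ≈ op x ∅ → Pos x or Neg x
      pos x j f = inl {Pos x} {Neg x} {{stable-× {{fm-stable ⌞ IsNegative zero (suc zero) ⌟ (a ∷ x ∷ [])}}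
                                 {{fm-stable ⌞ IsPositive zero (suc zero) ⌟ (b ∷ x ∷ [])}}}}
        (proj₂ (isPositive {a} {x}) f , proj₂ (isNegative {b} {x}) (≈-trans e (≈-trans (inv-cong f) (inv-pos j))))
      neg : ∀ x → x ∈ A → a ≈ op x one → Pos x or Neg x
      neg x j f = inr {Pos x} {Neg x} (proj₂ (isNegative {a} {x}) f ,
        proj₂ (isPositive {b} {x}) (≈-trans e (≈-trans (inv-cong f) (inv-neg j))))

    -- Left multiplication of a reduced word by a letter.

    IsProductL : Fm 3
    IsProductL = v₂ ≈' op' (invₜ ⟪ v₁ ∷ [] ⟫) v₀ ∨'
      (¬' (Starts ⟨ invₜ ⟪ v₁ ∷ [] ⟫ ∷ v₂ ∷ [] ⟩) ∧' v₀ ≈' op' v₁ v₂)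

    opaque
      L : D → D → D
      L a r = the (W A) IsProductL (a ∷ r ∷ [])

      L-the : ∀ a r → L a r ≈ the (W A) IsProductL (a ∷ r ∷ [])
      L-the a r = ≈-refl

    Lₜ : Tm 2
    Lₜ = named₂ L (the' ⌜ W A ⌝ IsProductL) L-the

    L-cong : ∀ {a a′ r r′} → a ≈ a′ → r ≈ r′ → L a r ≈ L a′ r′
    L-cong = tm-cong₂ Lₜ

    StartsInv : D → D → Set
    StartsInv a r = ⟦ Starts ⟧ (inv a ∷ r ∷ [])

    L-cancel : ∀ {a q} → q ∈ W A → L a (op (inv a) q) ≈ q
    L-cancel {a} {q} j = ≈-trans (L-the _ _) (the-unique IsProductL {a ∷ op (inv a) q ∷ []} j
      (inl ≈-refl) λ y _ o → or-elim o (λ e → ≈-sym (op-injʳ e))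
        (λ { (f , _) → exfalso (f (q , ≈-refl)) }))

    L-cons : ∀ {a r} → a ∈ Λ A → r ∈ W A → ¬ StartsInv a r → L a r ≈ op a r
    L-cons {a} {r} i j h = ≈-trans (L-the _ _) (the-unique IsProductL {a ∷ r ∷ []} (cons∈W A i j)
      (inr (h , ≈-refl)) λ y _ o → or-elim o (λ e → exfalso (h (y , e))) proj₂)

    -- Concatenation and cancellation

    module Cat = Fold A (W A) (op' v₀ v₁) (cons∈W A)
    open Cat public using () renaming (fold to cat; foldₜ to catₜ; fold-cong to cat-cong; fold-∈ to cat∈W;
      fold-∅ to cat-∅; fold-cons to cat-cons)

    IsConcatClosed : Formula 3
    IsConcatClosed = (∃₁ λ e → IsEmpty e ∧ Related (S ↑ 1) e (v ↑ 1)) ∧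
      (∀₃ λ a p q → IsLetter (X ↑ 3) a ∧ Related (S ↑ 3) p q ⇒
        (∀₂ λ ap aq → IsOPair ap (a ↑ 2) (p ↑ 2) ∧ IsOPair aq (a ↑ 2) (q ↑ 2) ⇒ Related (S ↑ 5) ap aq))
      where
      S v X : Fin 3
      S = zero
      v = suc zero
      X = suc (suc zero)

    isConcatClosed : ∀ {R v} → ⟪ IsConcatClosed ⟫ˢ (R ∷ v ∷ A ∷ []) ↔
      (op ∅ v ∈ R × (∀ a p q → a ∈ Λ A → op p q ∈ R → op (op a p) (op a q) ∈ R))
    isConcatClosed {R} {v} =
      (λ { ((e , z , r) , h) →
        ∈-respˡ (op-cong (proj₁ (isEmpty {e}) z) ≈-refl) (proj₁ (related {R} {e} {v}) r) ,
        λ a p q i j → proj₁ (related {R} {op a p} {op a q}) (h a p q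
          (proj₂ (isLetter {A} {a}) i , proj₂ (related {R} {p} {q}) j) (op a p) (op a q)
          (proj₂ (isOPair {op a p} {a} {p}) ≈-refl , proj₂ (isOPair {op a q} {a} {q}) ≈-refl)) }) ,
      (λ { (i , h) → (∅ , proj₂ (isEmpty {∅}) ≈-refl , proj₂ (related {R} {∅} {v}) i) ,
        λ a p q (l , r) ap aq (e , f) → proj₂ (related {R} {ap} {aq}) (∈-respˡ
          (op-cong (≈-sym (proj₁ (isOPair {ap} {a} {p}) e)) (≈-sym (proj₁ (isOPair {aq} {a} {q}) f)))
          (h a p q (proj₁ (isLetter {A} {a}) l) (proj₁ (related {R} {p} {q}) r))) })

    isConcat : ∀ {u v w} →
               ⟪ IsConcat zero (suc zero) (suc (suc zero)) (suc (suc (suc zero))) ⟫ˢ (A ∷ u ∷ v ∷ w ∷ []) ↔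
               (u ∈ W A × v ∈ W A × w ≈ cat u v)
    isConcat {u} {v} {w} =
      (λ { (hu , hv , h) → let i = proj₁ (isWord A {u}) hu ; j = proj₁ (isWord A {v}) hv in i , j ,
        ≈-sym (Cat.fold-graph i j (proj₁ (related {Cat.Γ v} {u} {w}) (h (Cat.Γ v)
          (proj₂ (isConcatClosed {Cat.Γ v} {v}) (Cat.Γ-base j , λ a p q → Cat.Γ-step j))))) }) ,
      (λ { (i , j , e) → proj₂ (isWord A {u}) i , proj₂ (isWord A {v}) j , λ R c →
        proj₂ (related {R} {u} {w}) (∈-respˡ (op-cong ≈-refl (≈-sym e))
          (contains R j (proj₁ (isConcatClosed {R} {v}) c) u i)) })
      where
      contains : ∀ R → v ∈ W A → (op ∅ v ∈ R × (∀ a p q → a ∈ Λ A → op p q ∈ R → op (op a p) (op a q) ∈ R)) →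
                 ∀ u → u ∈ W A → op u (cat u v) ∈ R
      contains R j (b , h) = word-induction A (op' v₀ (catₜ ⟪ v₀ ∷ ⌜ v ⌝ ∷ [] ⟫) ∈' ⌜ R ⌝)
        (∈-respˡ (op-cong ≈-refl (≈-sym (cat-∅ j))) b)
        λ a p i k ih → ∈-respˡ (op-cong ≈-refl (≈-sym (cat-cons i k j))) (h a p (cat p v) i ih)

    Canc : Fm 2
    Canc = ∃∈' ⌜ W A ⌝ (∃∈' ⌜ W A ⌝ (∃∈' ⌜ Λ A ⌝ (
      v₃ ≈' catₜ ⟪ v₂ ∷ op' v₀ (op' (invₜ ⟪ v₀ ∷ [] ⟫) v₁) ∷ [] ⟫ ∧' v₄ ≈' catₜ ⟪ v₂ ∷ v₁ ∷ [] ⟫)))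

    cancels : ∀ {w v} → ⟪ Cancels zero (suc zero) (suc (suc zero)) ⟫ˢ (A ∷ w ∷ v ∷ []) ↔ ⟦ Canc ⟧ (w ∷ v ∷ [])
    cancels {w} {v} =
      (λ { (p , q , c , a , b , bq , abq , o , e , f , c′) →
        forth p q a b bq abq (proj₁ (isConcat {p} {q} {v}) c) (areInverse⁻ {a} {b} o)
          (proj₁ (isOPair {bq} {b} {q}) e) (proj₁ (isOPair {abq} {a} {bq}) f) (proj₁ (isConcat {p} {abq} {w}) c′) }) ,
      (λ { (p , i , q , j , a , k , e , f) → p , q , proj₂ (isConcat {p} {q} {v}) (i , j , f) ,
        a , inv a , op (inv a) q , op a (op (inv a) q) , areInverse⁺ {a} {inv a} k ≈-refl ,
        proj₂ (isOPair {op (inv a) q} {inv a} {q}) ≈-refl ,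
        proj₂ (isOPair {op a (op (inv a) q)} {a} {op (inv a) q}) ≈-refl ,
        proj₂ (isConcat {p} {op a (op (inv a) q)} {w}) (i , cons∈W A k (cons∈W A (inv∈Λ k) j) , e) })
      where
      forth : ∀ p q a b bq abq → (p ∈ W A × q ∈ W A × v ≈ cat p q) → (a ∈ Λ A × b ≈ inv a) →
              bq ≈ op b q → abq ≈ op a bq → (p ∈ W A × abq ∈ W A × w ≈ cat p abq) → ⟦ Canc ⟧ (w ∷ v ∷ [])
      forth p q a b bq abq (i , j , ev) (k , eb) e f (_ , _ , ew) = p , i , q , j , a , k ,
        ≈-trans ew (cat-cong ≈-refl (≈-trans f (op-cong ≈-refl (≈-trans e (op-cong eb ≈-refl))))) , ev

    -- Reduced words

    Irreducible : Fm 1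
    Irreducible = ¬' (∃' (Canc ⟨ v₁ ∷ v₀ ∷ [] ⟩))

    opaque
      RW : D
      RW = sep (W A) Irreducible []

      ∈-RW : ∀ {w} → w ∈ RW ↔ (w ∈ W A × ⟦ Irreducible ⟧ (w ∷ []))
      ∈-RW = ∈-sep

    isReduced : ∀ {w} → ⟪ IsReducedWord zero (suc zero) ⟫ˢ (A ∷ w ∷ []) ↔ w ∈ RW
    isReduced {w} =
      (λ { (h , f) → proj₂ ∈-RW (proj₁ (isWord A {w}) h , λ { (v , c) → f (v , proj₂ (cancels {w} {v}) c) }) }) ,
      (λ i → case proj₁ ∈-RW i of λ { (j , f) →
        proj₂ (isWord A {w}) j , λ { (v , c) → f (v , proj₁ (cancels {w} {v}) c) } })

    RW⊆W : ∀ {w} → w ∈ RW → w ∈ W A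
    RW⊆W i = proj₁ (proj₁ ∈-RW i)

    ∅∈RW : ∅ ∈ RW
    ∅∈RW = proj₂ ∈-RW (∅∈W A , λ { (v , p , i , q , j , a , k , e , _) → or-elim (word-cases A i)
      (λ e′ → op≉∅ (≈-sym (≈-trans e (≈-trans (cat-cong e′ ≈-refl) (cat-∅ (cons∈W A k (cons∈W A (inv∈Λ k) j)))))))
      (λ { (b , i′ , p′ , j′ , e′) → op≉∅ (≈-sym (≈-trans e (≈-trans (cat-cong e′ ≈-refl)
        (cat-cons i′ j′ (cons∈W A k (cons∈W A (inv∈Λ k) j)))))) }) })

    Canc-cons : ∀ {a u v} → a ∈ Λ A → ⟦ Canc ⟧ (u ∷ v ∷ []) → ⟦ Canc ⟧ (op a u ∷ op a v ∷ [])
    Canc-cons {a} i (p , i′ , q , j , b , k , e , f) = op a p , cons∈W A i i′ , q , j , b , k ,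
      ≈-trans (op-cong ≈-refl e) (≈-sym (cat-cons i i′ (cons∈W A k (cons∈W A (inv∈Λ k) j)))) ,
      ≈-trans (op-cong ≈-refl f) (≈-sym (cat-cons i i′ j))

    Canc-here : ∀ {a q} → a ∈ Λ A → q ∈ W A → ⟦ Canc ⟧ (op a (op (inv a) q) ∷ q ∷ [])
    Canc-here {a} {q} i j = ∅ , ∅∈W A , q , j , a , i ,
      ≈-sym (cat-∅ (cons∈W A i (cons∈W A (inv∈Λ i) j))) , ≈-sym (cat-∅ j)

    RW-tail : ∀ {a u} → op a u ∈ RW → u ∈ RW
    RW-tail {a} {u} i = case proj₁ ∈-RW i of λ { (j , f) → case cons∈W⁻ A j of λ { (k , l) →
      proj₂ ∈-RW (l , λ { (v , c) → f (op a v , Canc-cons k c) }) } }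

    RW-head : ∀ {a u} → op a u ∈ RW → ¬ StartsInv a u
    RW-head {a} {u} i (q , e) = case proj₁ ∈-RW i of λ { (j , f) → case cons∈W⁻ A j of λ { (k , l) →
      f (q , leibniz (Canc ⟨ op' ⌜ a ⌝ v₀ ∷ ⌜ q ⌝ ∷ [] ⟩) {ρ = []} (≈-sym e)
        (Canc-here k (proj₂ (cons∈W⁻ A (∈-respˡ e l))))) } }

    -- A cancellation in the longer word either happens at its front or already inside `u`,
    -- according to whether the prefix `p` before the cancelling pair is empty.
    RW-cons : ∀ {a u} → a ∈ Λ A → u ∈ RW → ¬ StartsInv a u → op a u ∈ RW
    RW-cons {a} {u} i j h = proj₂ ∈-RW (cons∈W A i (RW⊆W j) ,
      λ { (v , p , i′ , q , j′ , b , k , e , _) →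
        let s = cons∈W A k (cons∈W A (inv∈Λ k) j′) in or-elim (word-cases A i′)
        (λ e′ → let e″ = ≈-trans e (≈-trans (cat-cong e′ ≈-refl) (cat-∅ s)) in
          h (q , ≈-trans (op-injʳ e″) (op-cong (inv-cong (≈-sym (op-injˡ e″))) ≈-refl)))
        (λ { (c , k′ , p′ , l , e′) → let e″ = ≈-trans e (≈-trans (cat-cong e′ ≈-refl) (cat-cons k′ l s)) in
          proj₂ (proj₁ ∈-RW j) (cat p′ q , p′ , l , q , j′ , b , k , op-injʳ e″ , ≈-refl) }) })

    L-cases : ∀ {a r} {C : Set} {{_ : Stable C}} → a ∈ Λ A → r ∈ RW →
              (∀ q → q ∈ RW → r ≈ op (inv a) q → L a r ≈ q → C) →
              (¬ StartsInv a r → op a r ∈ RW → L a r ≈ op a r → C) → C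
    L-cases {a} {r} i j f g = by-cases (StartsInv a r)
      (λ { (q , e) → let k = RW-tail (∈-respˡ e j) in f q k e (≈-trans (L-cong ≈-refl e) (L-cancel (RW⊆W k))) })
      (λ h → g h (RW-cons i j h) (L-cons i (RW⊆W j) h))

    L∈RW : ∀ {a r} → a ∈ Λ A → r ∈ RW → L a r ∈ RW
    L∈RW i j = L-cases i j (λ q k _ e → ∈-respˡ (≈-sym e) k) (λ _ k e → ∈-respˡ (≈-sym e) k)

    -- Each letter thus permutes the reduced words. This is van der Waerden's trick: multiplication
    -- is composition of permutations, which is associative for free.
    L-inv : ∀ {a r} → a ∈ Λ A → r ∈ RW → L a (L (inv a) r) ≈ r
    L-inv {a} {r} i j = L-cases (inv∈Λ i) j
      (λ q k e e′ → let e″ = ≈-trans e (op-cong (inv-inv i) ≈-refl) in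
        ≈-trans (L-cong ≈-refl e′) (≈-trans (L-cons i (RW⊆W k) (RW-head (∈-respˡ e″ j))) (≈-sym e″)))
      (λ _ k e → ≈-trans (L-cong ≈-refl e) (L-cancel (RW⊆W j)))

  -- Multiplication, functions and bijections in the model

  isMult : ∀ {m a b c} →
           ⟪ Mult zero (suc zero) (suc (suc zero)) (suc (suc (suc zero))) ⟫ˢ (m ∷ a ∷ b ∷ c ∷ []) ↔ op (op a b) c ∈ m
  isMult {m} {a} {b} {c} =
    (λ { (p , e , r) → ∈-respˡ (op-cong (proj₁ (isOPair {p} {a} {b}) e) ≈-refl) (proj₁ (related {m} {p} {c}) r) }) ,
    (λ i → op a b , proj₂ (isOPair {op a b} {a} {b}) ≈-refl , proj₂ (related {m} {op a b} {c}) i)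

  Function : D → D → D → Set
  Function f a b = (∀ p → p ∈ f → p ∈ prod a b) ×
                   (∀ x → x ∈ a → Σ D λ y → op x y ∈ f × (∀ y′ → op x y′ ∈ f → y′ ≈ y))

  Bijection : D → D → D → Set
  Bijection f a b = Function f a b × (∀ y → y ∈ b → Σ D λ x → op x y ∈ f × (∀ x′ → op x′ y ∈ f → x′ ≈ x))

  isFunction⁻ : ∀ {f a b} → ⟪ IsFunction zero (suc zero) (suc (suc zero)) ⟫ˢ (f ∷ a ∷ b ∷ []) → Function f a b
  isFunction⁻ {f} {a} {b} (h , k) = into , total
    where
    into : ∀ p → p ∈ f → p ∈ prod a b
    into p i = let (x , y , j , l , e) = h p i in proj₂ ∈-prod (x , j , y , l , proj₁ (isOPair {p} {x} {y}) e)
    total : ∀ x → x ∈ a → Σ D λ y → op x y ∈ f × (∀ y′ → op x y′ ∈ f → y′ ≈ y)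
    total x i = let (y , r , u) = k x i in
      y , proj₁ (related {f} {x} {y}) r , λ y′ r′ → u y′ (proj₂ (related {f} {x} {y′}) r′)

  isFunction⁺ : ∀ {f a b} → Function f a b → ⟪ IsFunction zero (suc zero) (suc (suc zero)) ⟫ˢ (f ∷ a ∷ b ∷ [])
  isFunction⁺ {f} {a} {b} (h , k) = into , total
    where
    into : ∀ p → p ∈ f → Σ D λ x → Σ D λ y → x ∈ a × y ∈ b ×
           ⟪ IsOPair zero (suc zero) (suc (suc zero)) ⟫ˢ (p ∷ x ∷ y ∷ [])
    into p i = let (x , j , y , l , e) = proj₁ ∈-prod (h p i) in x , y , j , l , proj₂ (isOPair {p} {x} {y}) e
    total : ∀ x → x ∈ a → Σ D λ y → ⟪ Related zero (suc zero) (suc (suc zero)) ⟫ˢ (f ∷ x ∷ y ∷ []) ×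
            (∀ y′ → ⟪ Related zero (suc zero) (suc (suc zero)) ⟫ˢ (f ∷ x ∷ y′ ∷ []) → y′ ≈ y)
    total x i = let (y , r , u) = k x i in
      y , proj₂ (related {f} {x} {y}) r , λ y′ r′ → u y′ (proj₁ (related {f} {x} {y′}) r′)

  isBijection⁻ : ∀ {f a b} → ⟪ IsBijection zero (suc zero) (suc (suc zero)) ⟫ˢ (f ∷ a ∷ b ∷ []) → Bijection f a b
  isBijection⁻ {f} {a} {b} (h , k) = isFunction⁻ {f} {a} {b} h , onto
    where
    onto : ∀ y → y ∈ b → Σ D λ x → op x y ∈ f × (∀ x′ → op x′ y ∈ f → x′ ≈ x)
    onto y i = let (x , r , u) = k y i in
      x , proj₁ (related {f} {x} {y}) r , λ x′ r′ → u x′ (proj₂ (related {f} {x′} {y}) r′)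

  isBijection⁺ : ∀ {f a b} → Bijection f a b → ⟪ IsBijection zero (suc zero) (suc (suc zero)) ⟫ˢ (f ∷ a ∷ b ∷ [])
  isBijection⁺ {f} {a} {b} (h , k) = isFunction⁺ {f} {a} {b} h , onto
    where
    onto : ∀ y → y ∈ b → Σ D λ x → ⟪ Related zero (suc zero) (suc (suc zero)) ⟫ˢ (f ∷ x ∷ y ∷ []) ×
           (∀ x′ → ⟪ Related zero (suc zero) (suc (suc zero)) ⟫ˢ (f ∷ x′ ∷ y ∷ []) → x′ ≈ x)
    onto y i = let (x , r , u) = k y i in
      x , proj₂ (related {f} {x} {y}) r , λ x′ r′ → u x′ (proj₁ (related {f} {x′} {y}) r′)

  -- The group of reduced words and its actions

  module FreeGroup (A : D) where

    open Free A public

    -- `act u v` will be the product: the letters of `u` are multiplied onto `v` one after another,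
    -- reducing at every step.
    module Mul = Fold A RW Lₜ L∈RW
    open Mul public using () renaming (fold to act; foldₜ to actₜ; fold-cong to act-cong; fold-∈ to act∈RW;
      fold-∅ to act-∅; fold-cons to act-cons)

    -- If inverse letters act inversely, the fold is insensitive to cancellation and becomes an
    -- action of the free group. On `RW` itself this gives associativity; on pairs of a set and a
    -- bit it gives the parity action.
    module Action (V : D) (G : Tm 2) (G∈V : ∀ {a r} → a ∈ Λ A → r ∈ V → ev G (a ∷ r ∷ []) ∈ V)
      (G-inv : ∀ {a r} → a ∈ Λ A → r ∈ V → ev G (a ∷ ev G (inv a ∷ r ∷ []) ∷ []) ≈ r) where

      open Fold A V G G∈V public

      fold-L : ∀ {a r s} → a ∈ Λ A → r ∈ RW → s ∈ V → fold (L a r) s ≈ g a (fold r s)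
      fold-L i j k = L-cases i j
        (λ q l e e′ → ≈-trans (fold-cong e′ ≈-refl) (≈-sym (≈-trans
          (tm-cong₂ G ≈-refl (≈-trans (fold-cong e ≈-refl) (fold-cons (inv∈Λ i) (RW⊆W l) k)))
          (G-inv i (fold-∈ (RW⊆W l) k)))))
        (λ _ _ e → ≈-trans (fold-cong e ≈-refl) (fold-cons i (RW⊆W j) k))

      fold-act : ∀ {u p s} → u ∈ W A → p ∈ RW → s ∈ V → fold (act u p) s ≈ fold u (fold p s)
      fold-act {u} {p} {s} i j k = word-induction A
        (foldₜ ⟪ actₜ ⟪ v₀ ∷ ⌜ p ⌝ ∷ [] ⟫ ∷ ⌜ s ⌝ ∷ [] ⟫ ≈' foldₜ ⟪ v₀ ∷ ⌜ fold p s ⌝ ∷ [] ⟫)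
        (≈-trans (fold-cong (act-∅ j) ≈-refl) (≈-sym (fold-∅ (fold-∈ (RW⊆W j) k))))
        (λ a u i l ih → ≈-trans (fold-cong (act-cons i l j) ≈-refl) (≈-trans (fold-L i (act∈RW l j) k)
          (≈-trans (tm-cong₂ G ≈-refl ih) (≈-sym (fold-cons i l (fold-∈ (RW⊆W j) k)))))) u i

      fold-cat : ∀ {u v s} → u ∈ W A → v ∈ W A → s ∈ V → fold (cat u v) s ≈ fold u (fold v s)
      fold-cat {u} {v} {s} i j k = word-induction A
        (foldₜ ⟪ catₜ ⟪ v₀ ∷ ⌜ v ⌝ ∷ [] ⟫ ∷ ⌜ s ⌝ ∷ [] ⟫ ≈' foldₜ ⟪ v₀ ∷ ⌜ fold v s ⌝ ∷ [] ⟫)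
        (≈-trans (fold-cong (cat-∅ j) ≈-refl) (≈-sym (fold-∅ (fold-∈ j k))))
        (λ a u i l ih → ≈-trans (fold-cong (cat-cons i l j) ≈-refl) (≈-trans (fold-cons i (cat∈W l j) k)
          (≈-trans (tm-cong₂ G ≈-refl ih) (≈-sym (fold-cons i l (fold-∈ j k)))))) u i

      fold-canc : ∀ {w v s} → ⟦ Canc ⟧ (w ∷ v ∷ []) → s ∈ V → fold w s ≈ fold v s
      fold-canc (p , i , q , j , a , k , e , f) l =
        ≈-trans (fold-cong e ≈-refl) (≈-trans (fold-cat i (cons∈W A k (cons∈W A (inv∈Λ k) j)) l)
        (≈-trans (fold-cong ≈-refl (≈-trans (fold-cons k (cons∈W A (inv∈Λ k) j) l)
          (≈-trans (tm-cong₂ G ≈-refl (fold-cons (inv∈Λ k) j l)) (G-inv k (fold-∈ j l)))))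
        (≈-trans (≈-sym (fold-cat i j l)) (fold-cong (≈-sym f) ≈-refl))))

      fold-letter : ∀ {a s} → a ∈ Λ A → s ∈ V → fold (op a ∅) s ≈ g a s
      fold-letter i k = ≈-trans (fold-cons i (∅∈W A) k) (tm-cong₂ G ≈-refl (fold-∅ k))

    module Left = Action RW Lₜ L∈RW L-inv
    open Left public using () renaming (fold-act to act-act; fold-cat to act-cat; fold-canc to act-canc;
      fold-letter to act-letter)

    letter∈RW : ∀ {a} → a ∈ Λ A → op a ∅ ∈ RW
    letter∈RW i = RW-cons i ∅∈RW λ { (q , e) → op≉∅ (≈-sym e) }

    act-identityʳ : ∀ {w} → w ∈ RW → act w ∅ ≈ w
    act-identityʳ {w} i = word-induction A (v₀ ∈' ⌜ RW ⌝ ⇒' actₜ ⟪ v₀ ∷ ⌜ ∅ ⌝ ∷ [] ⟫ ≈' v₀)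
      (λ _ → act-∅ ∅∈RW)
      (λ a u j k ih l → ≈-trans (act-cons j k ∅∈RW) (≈-trans (L-cong ≈-refl (ih (RW-tail l)))
        (L-cons j k (RW-head l)))) w (RW⊆W i) i

    Canc∈W : ∀ {w v} → ⟦ Canc ⟧ (w ∷ v ∷ []) → v ∈ W A
    Canc∈W (p , i , q , j , a , k , e , f) = ∈-respˡ (≈-sym f) (cat∈W i j)

    CancClosed : Fm 1
    CancClosed = ∀' (∀' (v₁ ∈' v₂ ⇒' Canc ⟨ v₁ ∷ v₀ ∷ [] ⟩ ⇒' v₀ ∈' v₂))

    opaque
      -- The pullback of `S` along prefixing `a`. It inherits closure under cancellation, so the
      -- induction hypothesis of `reduces` can be applied below the letter `a`.
      quotient : D → D → D
      quotient a S = sep (W A) (op' ⌜ a ⌝ v₀ ∈' ⌜ S ⌝) []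

      ∈-quotient : ∀ {a S t} → t ∈ quotient a S ↔ (t ∈ W A × op a t ∈ S)
      ∈-quotient = ∈-sep

    quotient-closed : ∀ {a S} → a ∈ Λ A → ⟦ CancClosed ⟧ (S ∷ []) → ⟦ CancClosed ⟧ (quotient a S ∷ [])
    quotient-closed {a} i c s t j d =
      proj₂ ∈-quotient (Canc∈W d , c (op a s) (op a t) (proj₂ (proj₁ ∈-quotient j)) (Canc-cons i d))

    reduces-L : ∀ {a r S} → a ∈ Λ A → r ∈ RW → op a r ∈ S → ⟦ CancClosed ⟧ (S ∷ []) → L a r ∈ S
    reduces-L {a} {r} {S} i j h c = L-cases i j
      (λ q l e e′ → ∈-respˡ (≈-sym e′) (c (op a (op (inv a) q)) q
        (∈-respˡ (op-cong ≈-refl e) h) (Canc-here i (RW⊆W l))))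
      (λ _ _ e → ∈-respˡ (≈-sym e) h)

    reduces : ∀ w → w ∈ W A → ∀ S → w ∈ S → ⟦ CancClosed ⟧ (S ∷ []) → act w ∅ ∈ S
    reduces = word-induction A
      (∀' (v₁ ∈' v₀ ⇒' CancClosed ⟨ v₀ ∷ [] ⟩ ⇒' actₜ ⟪ v₁ ∷ ⌜ ∅ ⌝ ∷ [] ⟫ ∈' v₀))
      (λ S i _ → ∈-respˡ (≈-sym (act-∅ ∅∈RW)) i)
      λ a u i j ih S k c → ∈-respˡ (≈-sym (act-cons i j ∅∈RW)) (reduces-L i (act∈RW j ∅∈RW)
        (proj₂ (proj₁ ∈-quotient (ih (quotient a S) (proj₂ ∈-quotient (j , k)) (quotient-closed i c)))) c)

    opaque
      sameClass : D → D
      sameClass w = sep (W A) (actₜ ⟪ v₀ ∷ ⌜ ∅ ⌝ ∷ [] ⟫ ≈' ⌜ act w ∅ ⌝) []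

      ∈-sameClass : ∀ {w t} → t ∈ sameClass w ↔ (t ∈ W A × act t ∅ ≈ act w ∅)
      ∈-sameClass = ∈-sep

    -- Uniqueness of the reduced form needs no confluence argument: cancellation does not change the
    -- effect of a word on `∅`, and a reduced word is recovered from that effect.
    isReductionOf : ∀ {v w} → w ∈ W A →
      ⟪ IsReductionOf zero (suc zero) (suc (suc zero)) ⟫ˢ (A ∷ v ∷ w ∷ []) ↔ v ≈ act w ∅
    isReductionOf {v} {w} i = to , from
      where
      to : ⟪ IsReductionOf zero (suc zero) (suc (suc zero)) ⟫ˢ (A ∷ v ∷ w ∷ []) → v ≈ act w ∅
      to (r , h) = ≈-trans (≈-sym (act-identityʳ (proj₁ (isReduced {v}) r))) (proj₂ (proj₁ ∈-sameClass (h (sameClass w)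
        (proj₂ ∈-sameClass (i , ≈-refl) , λ s t (j , c) → let c′ = proj₁ (cancels {s} {t}) c in
          proj₂ ∈-sameClass (Canc∈W {s} {t} c′ ,
            ≈-trans (≈-sym (act-canc {s} {t} c′ ∅∈RW)) (proj₂ (proj₁ ∈-sameClass j)))))))
      from : v ≈ act w ∅ → ⟪ IsReductionOf zero (suc zero) (suc (suc zero)) ⟫ˢ (A ∷ v ∷ w ∷ [])
      from e = proj₂ (isReduced {v}) (∈-respˡ (≈-sym e) (act∈RW i ∅∈RW)) ,
        λ S (j , c) → ∈-respˡ (≈-sym e) (reduces w i S j λ s t k d → c s t (k , proj₂ (cancels {s} {t}) d))

    act-reduces : ∀ {u v} → u ∈ RW → v ∈ RW → act (cat u v) ∅ ≈ act u v
    act-reduces i j = ≈-trans (act-cat (RW⊆W i) (RW⊆W j) ∅∈RW) (act-cong ≈-refl (act-identityʳ j))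

    HasInverse : Fm 1
    HasInverse = ∃∈' ⌜ RW ⌝ (∀∈' ⌜ RW ⌝ (actₜ ⟪ v₂ ∷ actₜ ⟪ v₁ ∷ v₀ ∷ [] ⟫ ∷ [] ⟫ ≈' v₀ ∧'
                                          actₜ ⟪ v₁ ∷ actₜ ⟪ v₂ ∷ v₀ ∷ [] ⟫ ∷ [] ⟫ ≈' v₀))

    -- Inverses as maps on reduced words, a form that passes through the induction on `u`;
    -- evaluation at `∅` gives inverses in the group.
    Inverse : D → D → Set
    Inverse u u′ = ∀ r → r ∈ RW → act u (act u′ r) ≈ r × act u′ (act u r) ≈ r

    inverse-cons : ∀ {a u u′} → a ∈ Λ A → u ∈ W A → u′ ∈ RW → Inverse u u′ →
                   Inverse (op a u) (act u′ (op (inv a) ∅))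
    inverse-cons {a} {u} {u′} i j k h r l =
        ≈-trans (act-cong ≈-refl (e l)) (≈-trans (act-cons i j (act∈RW (RW⊆W k) s∈))
          (≈-trans (L-cong ≈-refl (proj₁ (h _ s∈))) (L-inv i l))) ,
        ≈-trans (act-cong ≈-refl (act-cons i j l)) (≈-trans (e (L∈RW i (act∈RW j l)))
          (≈-trans (act-cong ≈-refl (≈-trans (L-cong ≈-refl (L-cong (≈-sym (inv-inv i)) ≈-refl))
            (L-inv (inv∈Λ i) (act∈RW j l)))) (proj₂ (h r l))))
      where
      s∈ : L (inv a) r ∈ RW
      s∈ = L∈RW (inv∈Λ i) l
      e : ∀ {r} → r ∈ RW → act (act u′ (op (inv a) ∅)) r ≈ act u′ (L (inv a) r)
      e l = ≈-trans (act-act (RW⊆W k) (letter∈RW (inv∈Λ i)) l) (act-cong ≈-refl (act-letter (inv∈Λ i) l))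

    has-inverse : ∀ u → u ∈ W A → Σ D λ u′ → u′ ∈ RW × Inverse u u′
    has-inverse = word-induction A HasInverse
      (∅ , ∅∈RW , λ r i → ≈-trans (act-cong ≈-refl (act-∅ i)) (act-∅ i) , ≈-trans (act-cong ≈-refl (act-∅ i)) (act-∅ i))
      λ a u i j (u′ , k , h) → act u′ (op (inv a) ∅) ,
        act∈RW (RW⊆W k) (letter∈RW (inv∈Λ i)) , inverse-cons i j k h

    inverse : ∀ {u} → u ∈ RW → Σ D λ u′ → u′ ∈ RW × act u u′ ≈ ∅ × act u′ u ≈ ∅
    inverse {u} i = let (u′ , j , h) = has-inverse u (RW⊆W i) in u′ , j ,
      ≈-trans (act-cong ≈-refl (≈-sym (act-identityʳ j))) (proj₁ (h ∅ ∅∈RW)) ,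
      ≈-trans (act-cong ≈-refl (≈-sym (act-identityʳ i))) (proj₂ (h ∅ ∅∈RW))

    act-act-inverse : ∀ {u x x′} → u ∈ RW → x ∈ RW → x′ ∈ RW → act x x′ ≈ ∅ → act (act u x) x′ ≈ u
    act-act-inverse i k l e = ≈-trans (act-act (RW⊆W i) k l) (≈-trans (act-cong ≈-refl e) (act-identityʳ i))

    act-cancelʳ : ∀ {u v x} → u ∈ RW → v ∈ RW → x ∈ RW → act u x ≈ act v x → u ≈ v
    act-cancelʳ {u} {v} i j k e = let (x′ , l , e₁ , _) = inverse k in
      ≈-trans (≈-sym (act-act-inverse i k l e₁)) (≈-trans (act-cong e ≈-refl) (act-act-inverse j k l e₁))

    module Subgroup (K : D) (K⊆RW : ∀ {u} → u ∈ K → u ∈ RW) (∅∈K : ∅ ∈ K)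
      (act∈K : ∀ {u v} → u ∈ K → v ∈ K → act u v ∈ K)
      (inverse∈K : ∀ {u} → u ∈ K → Σ D λ u′ → u′ ∈ K × act u u′ ≈ ∅ × act u′ u ≈ ∅) where

      IsTriple : Fm 1
      IsTriple = ∃∈' ⌜ K ⌝ (∃∈' ⌜ K ⌝ (v₂ ≈' op' (op' v₁ v₀) (actₜ ⟪ v₁ ∷ v₀ ∷ [] ⟫)))

      opaque
        mul : D
        mul = sep (prod (prod K K) K) IsTriple []

        ∈-mul : ∀ {t} → t ∈ mul ↔ (Σ D λ u → u ∈ K × (Σ D λ v → v ∈ K × t ≈ op (op u v) (act u v)))
        ∈-mul = (λ i → proj₂ (proj₁ ∈-sep i)) , λ { (u , i , v , j , e) → proj₂ ∈-sep
          (∈-respˡ (≈-sym e) (op∈prod (op∈prod i j) (act∈K i j)) , u , i , v , j , e) }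

      ∈-mul₃ : ∀ {u v w} → op (op u v) w ∈ mul ↔ (u ∈ K × v ∈ K × w ≈ act u v)
      ∈-mul₃ {u₀} {u₁} {w} = to , λ (i , j , e) → proj₂ ∈-mul (_ , i , _ , j , op-cong ≈-refl e)
        where
        to : op (op u₀ u₁) w ∈ mul → u₀ ∈ K × u₁ ∈ K × w ≈ act u₀ u₁
        to i = let (u , i , v , j , e) = proj₁ ∈-mul i ; e₁ = op-injˡ (op-injˡ e) ; e₂ = op-injʳ (op-injˡ e) in
          ∈-respˡ (≈-sym e₁) i , ∈-respˡ (≈-sym e₂) j , ≈-trans (op-injʳ e) (act-cong (≈-sym e₁) (≈-sym e₂))

      mul-function : Function mul (prod K K) K
      mul-function =
        (λ p i → let (u , j , v , k , e) = proj₁ ∈-mul i in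
          ∈-respˡ (≈-sym e) (op∈prod (op∈prod j k) (act∈K j k))) ,
        (λ x i → let (u , j , v , k , e) = proj₁ ∈-prod i in act u v ,
          ∈-respˡ (op-cong (≈-sym e) ≈-refl) (proj₂ ∈-mul₃ (j , k , ≈-refl)) ,
          λ y l → proj₂ (proj₂ (proj₁ ∈-mul₃ (∈-respˡ (op-cong e ≈-refl) l))))

      isGroup : ⟪ IsGroup zero (suc zero) ⟫ˢ (K ∷ mul ∷ [])
      isGroup =
        (prod K K , proj₂ (isProduct {prod K K} {K} {K}) ≈-refl , isFunction⁺ {mul} {prod K K} {K} mul-function) ,
        (λ a b c (i , j , k) ab bc d (p , q , r) → proj₂ (isMult {mul} {a} {bc} {d})
          (assoc i j k (proj₁ (isMult {mul} {a} {b} {ab}) p) (proj₁ (isMult {mul} {b} {c} {bc}) q)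
            (proj₁ (isMult {mul} {ab} {c} {d}) r))) ,
        (∅ , ∅∈K ,
          (λ a i → proj₂ (isMult {mul} {∅} {a} {a}) (proj₂ ∈-mul₃ (∅∈K , i , ≈-sym (act-∅ (K⊆RW i)))) ,
                   proj₂ (isMult {mul} {a} {∅} {a}) (proj₂ ∈-mul₃ (i , ∅∈K , ≈-sym (act-identityʳ (K⊆RW i))))) ,
          (λ a i → let (b , j , e , f) = inverse∈K i in b , j ,
            proj₂ (isMult {mul} {a} {b} {∅}) (proj₂ ∈-mul₃ (i , j , ≈-sym e)) ,
            proj₂ (isMult {mul} {b} {a} {∅}) (proj₂ ∈-mul₃ (j , i , ≈-sym f))))
        where
        assoc : ∀ {a b c ab bc d} → a ∈ K → b ∈ K → c ∈ K → op (op a b) ab ∈ mul → op (op b c) bc ∈ mul →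
                op (op ab c) d ∈ mul → op (op a bc) d ∈ mul
        assoc i j k p q r = let (_ , _ , e) = proj₁ ∈-mul₃ p ; (_ , _ , f) = proj₁ ∈-mul₃ q
                                (_ , _ , h) = proj₁ ∈-mul₃ r in proj₂ ∈-mul₃ (i , ∈-respˡ (≈-sym f) (act∈K j k) ,
          ≈-trans h (≈-trans (act-cong e ≈-refl) (≈-trans
            (act-act (RW⊆W (K⊆RW i)) (K⊆RW j) (K⊆RW k)) (act-cong ≈-refl (≈-sym f)))))

    module Whole = Subgroup RW id ∅∈RW (λ i → act∈RW (RW⊆W i)) inverse
    open Whole public using () renaming (mul to MulRW; ∈-mul to ∈-MulRW; ∈-mul₃ to ∈-MulRW₃; isGroup to RW-isGroup)

    IsProductWord : Formula 4
    IsProductWord = ∃₁ λ uv → IsConcat (X ↑ 1) (u ↑ 1) (v ↑ 1) uv ∧ IsReductionOf (X ↑ 1) (w ↑ 1) uv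
      where
      X u v w : Fin 4
      X = zero
      u = suc zero
      v = suc (suc zero)
      w = suc (suc (suc zero))

    isProductWord : ∀ {u v w} → u ∈ RW → v ∈ RW → ⟪ IsProductWord ⟫ˢ (A ∷ u ∷ v ∷ w ∷ []) ↔ w ≈ act u v
    isProductWord {u} {v} {w} i j = to , from
      where
      to : ⟪ IsProductWord ⟫ˢ (A ∷ u ∷ v ∷ w ∷ []) → w ≈ act u v
      to (uv , c , r) = let (_ , _ , e) = proj₁ (isConcat {u} {v} {uv}) c in
        ≈-trans (proj₁ (isReductionOf {w} {uv} (∈-respˡ (≈-sym e) (cat∈W (RW⊆W i) (RW⊆W j)))) r)
          (≈-trans (act-cong e ≈-refl) (act-reduces i j))
      from : w ≈ act u v → ⟪ IsProductWord ⟫ˢ (A ∷ u ∷ v ∷ w ∷ [])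
      from e = cat u v , proj₂ (isConcat {u} {v} {cat u v}) (RW⊆W i , RW⊆W j , ≈-refl) ,
        proj₂ (isReductionOf {w} {cat u v} (cat∈W (RW⊆W i) (RW⊆W j))) (≈-trans e (≈-sym (act-reduces i j)))

    IsMulTriple : Formula 4
    IsMulTriple = ∃₃ λ u v w → u ϵ W′ ↑ 3 ∧ v ϵ W′ ↑ 3 ∧
        (∃₁ λ uv → IsConcat (X ↑ 4) (u ↑ 1) (v ↑ 1) uv ∧ IsReductionOf (X ↑ 4) (w ↑ 1) uv) ∧
        (∃₁ λ p → IsOPair p (u ↑ 1) (v ↑ 1) ∧ IsOPair (t ↑ 4) p (w ↑ 1))
      where
      t X W′ : Fin 4
      t = zero
      X = suc zero
      W′ = suc (suc zero)

    mulTriple⁻ : ∀ {t W′ M′} → (∀ {w} → w ∈ W′ → w ∈ RW) → ⟪ IsMulTriple ⟫ˢ (t ∷ A ∷ W′ ∷ M′ ∷ []) →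
      Σ D λ u → u ∈ RW × (Σ D λ v → v ∈ RW × t ≈ op (op u v) (act u v))
    mulTriple⁻ {t} s (u , v , w , i , j , c , p , e , f) = u , s i , v , s j ,
      ≈-trans (proj₁ (isOPair {t} {p} {w}) f) (op-cong (proj₁ (isOPair {p} {u} {v}) e)
        (proj₁ (isProductWord {u} {v} {w} (s i) (s j)) c))

    mulTriple⁺ : ∀ {t u v M′} → u ∈ RW → v ∈ RW → t ≈ op (op u v) (act u v) → ⟪ IsMulTriple ⟫ˢ (t ∷ A ∷ RW ∷ M′ ∷ [])
    mulTriple⁺ {t} {u} {v} i j e = u , v , act u v , i , j ,
      proj₂ (isProductWord {u} {v} {act u v} i j) ≈-refl ,
      (op u v , proj₂ (isOPair {op u v} {u} {v}) ≈-refl , proj₂ (isOPair {t} {op u v} {act u v}) e)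

    isFreeGroupOn : ⟪ IsFreeGroupOn zero (suc zero) (suc (suc zero)) ⟫ˢ (A ∷ RW ∷ MulRW ∷ [])
    isFreeGroupOn = (λ w → proj₂ (isReduced {w}) , proj₁ (isReduced {w})) , λ t → to t , from t
      where
      to : ∀ t → t ∈ MulRW → ⟪ IsMulTriple ⟫ˢ (t ∷ A ∷ RW ∷ MulRW ∷ [])
      to t i = let (u , i , v , j , e) = proj₁ ∈-MulRW i in mulTriple⁺ {t} {u} {v} {MulRW} i j e
      from : ∀ t → ⟪ IsMulTriple ⟫ˢ (t ∷ A ∷ RW ∷ MulRW ∷ []) → t ∈ MulRW
      from t h = proj₂ ∈-MulRW (mulTriple⁻ {t} {RW} {MulRW} id h)

    module _ {W′ M′ : D} (free : ⟪ IsFreeGroupOn zero (suc zero) (suc (suc zero)) ⟫ˢ (A ∷ W′ ∷ M′ ∷ [])) where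

      free-RW : ∀ {w} → w ∈ W′ ↔ w ∈ RW
      free-RW {w} = (λ i → proj₁ (isReduced {w}) (proj₁ (proj₁ free w) i)) ,
                    (λ i → proj₂ (proj₁ free w) (proj₂ (isReduced {w}) i))

      free-act : ∀ {u v w} → op (op u v) w ∈ M′ → w ≈ act u v
      free-act {u₀} {u₁} {w} i =
        let (u , _ , v , _ , e) = mulTriple⁻ {op (op u₀ u₁) w} {W′} {M′} (proj₁ free-RW)
              (proj₁ (proj₂ free (op (op u₀ u₁) w)) i)
            h = op-injˡ e
        in ≈-trans (op-injʳ e) (act-cong (≈-sym (op-injˡ h)) (≈-sym (op-injʳ h)))

  -- Bit flips and the subgroup `K`

  v₅ : Tm (6 + n)
  v₅ = var (suc (suc (suc (suc (suc zero)))))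

  IsOther : Fm 2
  IsOther = ¬' (v₀ ≈' v₁)

  opaque
    flip : D → D
    flip b = the two IsOther (b ∷ [])

    flip-the : ∀ b → flip b ≈ the two IsOther (b ∷ [])
    flip-the b = ≈-refl

  flipₜ : Tm 1
  flipₜ = named₁ flip (the' ⌜ two ⌝ IsOther) flip-the

  flip-∅ : flip ∅ ≈ one
  flip-∅ = ≈-trans (flip-the _) (the-unique IsOther {∅ ∷ []} ∈-pairʳ (λ e → ∅≉one (≈-sym e))
    λ y i h → or-elim (proj₁ ∈-pair i) (λ e → exfalso (h e)) id)

  flip-one : flip one ≈ ∅
  flip-one = ≈-trans (flip-the _) (the-unique IsOther {one ∷ []} ∈-pairˡ ∅≉one
    λ y i h → or-elim (proj₁ ∈-pair i) id (λ e → exfalso (h e)))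

  flip-cong : ∀ {b c} → b ≈ c → flip b ≈ flip c
  flip-cong = tm-cong₁ flipₜ

  flip∈two : ∀ {b} → b ∈ two → flip b ∈ two
  flip∈two i = or-elim (proj₁ ∈-pair i)
    (λ e → ∈-respˡ (≈-sym (≈-trans (flip-cong e) flip-∅)) ∈-pairʳ)
    (λ e → ∈-respˡ (≈-sym (≈-trans (flip-cong e) flip-one)) ∈-pairˡ)

  flip-flip : ∀ {b} → b ∈ two → flip (flip b) ≈ b
  flip-flip i = or-elim (proj₁ ∈-pair i)
    (λ e → ≈-trans (flip-cong (≈-trans (flip-cong e) flip-∅)) (≈-trans flip-one (≈-sym e)))
    (λ e → ≈-trans (flip-cong (≈-trans (flip-cong e) flip-one)) (≈-trans flip-∅ (≈-sym e)))

  module Fibres (Y : D) where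

    IsPoint : Fm 1
    IsPoint = ∃∈' ⌜ Y ⌝ (∃∈' v₀ (v₂ ≈' op' v₁ v₀))

    opaque
      X : D
      X = sep (prod Y (⋃ Y)) IsPoint []

      ∈-X : ∀ {x} → x ∈ X ↔ (Σ D λ y → y ∈ Y × (Σ D λ z → z ∈ y × x ≈ op y z))
      ∈-X = (λ i → proj₂ (proj₁ ∈-sep i)) , λ (y , i , z , j , e) → proj₂ ∈-sep
        (∈-respˡ (≈-sym e) (op∈prod i (proj₂ ∈-⋃ (y , i , j))) , y , i , z , j , e)

    open FreeGroup X public

    ltr : D → D → D → D
    ltr y z e = op (op y z) e

    ltr∈Λ : ∀ {y z e} → y ∈ Y → z ∈ y → e ∈ two → ltr y z e ∈ Λ X
    ltr∈Λ i j k = op∈prod (proj₂ ∈-X (_ , i , _ , j , ≈-refl)) k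

    letter-form : ∀ {a} → a ∈ Λ X → Σ D λ y → y ∈ Y × (Σ D λ z → z ∈ y × (Σ D λ e → e ∈ two × a ≈ ltr y z e))
    letter-form i = let (x , j , e , k , p) = proj₁ ∈-prod i ; (y , l , z , m , q) = proj₁ ∈-X j in
      y , l , z , m , e , k , ≈-trans p (op-cong q ≈-refl)

    inv-form : ∀ {y z e} → y ∈ Y → z ∈ y → e ∈ two → inv (ltr y z e) ≈ ltr y z (flip e)
    inv-form {y} {z} {e} i j k = or-elim (proj₁ ∈-pair k)
      (λ p → ≈-trans (inv-cong (op-cong ≈-refl p)) (≈-trans (inv-pos x∈)
        (op-cong ≈-refl (≈-sym (≈-trans (flip-cong p) flip-∅)))))
      (λ p → ≈-trans (inv-cong (op-cong ≈-refl p)) (≈-trans (inv-neg x∈)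
        (op-cong ≈-refl (≈-sym (≈-trans (flip-cong p) flip-one)))))
      where
      x∈ : op y z ∈ X
      x∈ = proj₂ ∈-X (y , i , z , j , ≈-refl)

    -- A letter over y updates the second component of ⟨y , b⟩ and fixes ⟨y′ , b⟩ for y′ ≠ y.
    module FibreAction (T : D) (Φ : Tm 2) (Φ∈T : ∀ {y z b} → y ∈ Y → z ∈ y → b ∈ T → ev Φ (z ∷ b ∷ []) ∈ T) where

      V : D
      V = prod Y T

      φ : D → D → D
      φ z b = ev Φ (z ∷ b ∷ [])

      IsTurned : Fm 3
      IsTurned = ∃' (∃' (∃' (∃' (v₅ ≈' op' (op' v₃ v₁) v₀ ∧' v₆ ≈' op' v₃ v₂ ∧' v₄ ≈' op' v₃ (Φ ⟪ v₁ ∷ v₂ ∷ [] ⟫)))))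
        ∨' (¬' (∃' (∃' (∃' (∃' (v₅ ≈' op' (op' v₃ v₁) v₀ ∧' v₆ ≈' op' v₃ v₂))))) ∧' v₀ ≈' v₂)
        where
        v₆ : ∀ {n} → Tm (7 + n)
        v₆ = var (suc (suc (suc (suc (suc (suc zero))))))

      opaque
        turn : D → D → D
        turn a s = the V IsTurned (a ∷ s ∷ [])

        turn-the : ∀ a s → turn a s ≈ the V IsTurned (a ∷ s ∷ [])
        turn-the a s = ≈-refl

      turnₜ : Tm 2
      turnₜ = named₂ turn (the' ⌜ V ⌝ IsTurned) turn-the

      turn-cong : ∀ {a a′ s s′} → a ≈ a′ → s ≈ s′ → turn a s ≈ turn a′ s′
      turn-cong = tm-cong₂ turnₜ

      turn-hit : ∀ {y z e b} → y ∈ Y → z ∈ y → b ∈ T → turn (ltr y z e) (op y b) ≈ op y (φ z b)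
      turn-hit {y} {z} {e} {b} i j k = ≈-trans (turn-the _ _) (the-unique IsTurned {ltr y z e ∷ op y b ∷ []}
        (op∈prod i (Φ∈T i j k)) (λ f → exfalso (f (y , b , z , e , ≈-refl , ≈-refl , ≈-refl))) unique)
        where
        unique : ∀ t → t ∈ V → ⟦ IsTurned ⟧ (t ∷ ltr y z e ∷ op y b ∷ []) → t ≈ op y (φ z b)
        unique t _ o = stable λ ¬e → proj₁ (o λ (y′ , b′ , z′ , e′ , p , q , r) → ¬e (≈-trans r
            (op-cong (≈-sym (op-injˡ q)) (tm-cong₂ Φ (≈-sym (op-injʳ (op-injˡ p))) (≈-sym (op-injʳ q))))))
          (y , b , z , e , ≈-refl , ≈-refl)

      turn-miss : ∀ {y z e y′ b} → y′ ∈ Y → b ∈ T → ¬ y ≈ y′ → turn (ltr y z e) (op y′ b) ≈ op y′ b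
      turn-miss {y} {z} {e} {y′} {b} i j ne = ≈-trans (turn-the _ _) (the-unique IsTurned {ltr y z e ∷ op y′ b ∷ []}
        (op∈prod i j) (λ _ → missed , ≈-refl) unique)
        where
        missed : ¬ (Σ D λ u → Σ D λ c → Σ D λ w → Σ D λ d → ltr y z e ≈ op (op u w) d × op y′ b ≈ op u c)
        missed (u , c , w , d , p , q) = ne (≈-trans (op-injˡ (op-injˡ p)) (≈-sym (op-injˡ q)))
        unique : ∀ t → t ∈ V → ⟦ IsTurned ⟧ (t ∷ ltr y z e ∷ op y′ b ∷ []) → t ≈ op y′ b
        unique t _ o = stable λ ¬e → ¬e (proj₂ (o λ (u , c , w , d , p , q , _) → missed (u , c , w , d , p , q)))

      turn∈V : ∀ {a s} → a ∈ Λ X → s ∈ V → turn a s ∈ V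
      turn∈V {a} {s} i j =
        let (y , k , z , l , e , m , p) = letter-form i ; (y′ , k′ , b , l′ , q) = proj₁ ∈-prod j in
        by-cases (y ≈ y′)
          (λ f → ∈-respˡ (≈-sym (≈-trans (turn-cong p (≈-trans q (op-cong (≈-sym f) ≈-refl))) (turn-hit k l l′)))
            (op∈prod k (Φ∈T k l l′)))
          (λ f → ∈-respˡ (≈-sym (≈-trans (turn-cong p q) (turn-miss k′ l′ f))) (op∈prod k′ l′))

    module Parity = FibreAction two (flipₜ ⟪ v₁ ∷ [] ⟫) (λ _ _ → flip∈two)
    open Parity using (turn; turn-cong; turn-hit; turn-miss)

    -- Letters over the same `y` flip the same bit, whatever their points and exponents. With `z`
    -- and `z′` distinct, this is what places all of `y` in one coset of `K`.
    turn-twice : ∀ {y z z′ e e′ s} → y ∈ Y → z ∈ y → z′ ∈ y → s ∈ Parity.V →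
                 turn (ltr y z e) (turn (ltr y z′ e′) s) ≈ s
    turn-twice {y} {z} {z′} {e} {e′} {s} i j j′ k = at (proj₁ ∈-prod k)
      where
      hit : ∀ {b} → b ∈ two → s ≈ op y b → turn (ltr y z e) (turn (ltr y z′ e′) s) ≈ s
      hit m q = ≈-trans (turn-cong ≈-refl (≈-trans (turn-cong ≈-refl q) (turn-hit i j′ m)))
          (≈-trans (turn-hit i j (flip∈two m)) (≈-trans (op-cong ≈-refl (flip-flip m)) (≈-sym q)))
      miss : ∀ {y′ b} → y′ ∈ Y → b ∈ two → s ≈ op y′ b → ¬ y ≈ y′ → turn (ltr y z e) (turn (ltr y z′ e′) s) ≈ s
      miss l m q f = ≈-trans (turn-cong ≈-refl (≈-trans (turn-cong ≈-refl q) (turn-miss l m f)))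
        (≈-trans (turn-miss l m f) (≈-sym q))
      at : (Σ D λ y′ → y′ ∈ Y × (Σ D λ b → b ∈ two × s ≈ op y′ b)) → turn (ltr y z e) (turn (ltr y z′ e′) s) ≈ s
      at (y′ , l , b , m , q) = by-cases (y ≈ y′)
        (λ f → hit m (≈-trans q (op-cong (≈-sym f) ≈-refl))) (miss l m q)

    turn-inv : ∀ {a s} → a ∈ Λ X → s ∈ Parity.V → turn a (turn (inv a) s) ≈ s
    turn-inv {a} {s} i j = let (y , k , z , l , e , m , p) = letter-form i in
      ≈-trans (turn-cong p (turn-cong (≈-trans (inv-cong p) (inv-form k l m)) ≈-refl)) (turn-twice k l l j)

    module Par = Action Parity.V Parity.turnₜ Parity.turn∈V turn-inv
    open Par public using () renaming (fold to par; foldₜ to parₜ; fold-cong to par-cong; fold-∅ to par-∅;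
      fold-cons to par-cons; fold-act to par-act; fold-letter to par-letter; fold-∈ to par∈V)

    Fixes : Fm 1
    Fixes = ∀∈' ⌜ Parity.V ⌝ (parₜ ⟪ v₁ ∷ v₀ ∷ [] ⟫ ≈' v₀)

    opaque
      K : D
      K = sep RW Fixes []

      ∈-K : ∀ {w} → w ∈ K ↔ (w ∈ RW × (∀ s → s ∈ Parity.V → par w s ≈ s))
      ∈-K = ∈-sep

    K⊆RW : ∀ {w} → w ∈ K → w ∈ RW
    K⊆RW i = proj₁ (proj₁ ∈-K i)

    K⊆W : ∀ {w} → w ∈ K → w ∈ W X
    K⊆W i = RW⊆W (K⊆RW i)

    K-fixes : ∀ {w s} → w ∈ K → s ∈ Parity.V → par w s ≈ s
    K-fixes i = proj₂ (proj₁ ∈-K i) _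

    ∅∈K : ∅ ∈ K
    ∅∈K = proj₂ ∈-K (∅∈RW , λ s → par-∅)

    act∈K : ∀ {u v} → u ∈ K → v ∈ K → act u v ∈ K
    act∈K i j = proj₂ ∈-K (act∈RW (K⊆W i) (K⊆RW j) , λ s k → ≈-trans (par-act (K⊆W i) (K⊆RW j) k)
      (≈-trans (par-cong ≈-refl (K-fixes j k)) (K-fixes i k)))

    inverse∈K : ∀ {u} → u ∈ K → Σ D λ u′ → u′ ∈ K × act u u′ ≈ ∅ × act u′ u ≈ ∅
    inverse∈K {u} i = let (u′ , j , e , f) = inverse (K⊆RW i) in u′ , proj₂ ∈-K (j , λ s k →
        ≈-trans (par-cong ≈-refl (≈-sym (K-fixes i k))) (≈-trans (≈-sym (par-act (RW⊆W j) (K⊆RW i) k))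
          (≈-trans (par-cong f ≈-refl) (par-∅ k)))) , e , f

    module KGroup = Subgroup K K⊆RW ∅∈K act∈K inverse∈K
    open KGroup public using () renaming (mul to MulK; ∈-mul to ∈-MulK; ∈-mul₃ to ∈-MulK₃; isGroup to K-isGroup)

    ι : D → D → D
    ι y z = op (ltr y z ∅) ∅

    ι∈RW : ∀ {y z} → y ∈ Y → z ∈ y → ι y z ∈ RW
    ι∈RW i j = letter∈RW (ltr∈Λ i j ∈-pairˡ)

    -- ι y z (ι y z′)⁻¹ ∈ K.
    connect : ∀ {y z z′} → y ∈ Y → z ∈ y → z′ ∈ y → Σ D λ k → k ∈ K × act k (ι y z′) ≈ ι y z
    connect {y} {z} {z′} i j j′ = act (ι y z) c , proj₂ ∈-K (act∈RW (RW⊆W x∈) c∈ , fixes) ,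
        ≈-trans (act-act (RW⊆W x∈) c∈ (ι∈RW i j′)) (≈-trans (act-cong ≈-refl cancel) (act-identityʳ x∈))
      where
      c : D
      c = op (ltr y z′ one) ∅
      x∈ : ι y z ∈ RW
      x∈ = ι∈RW i j
      l∈ : ltr y z′ one ∈ Λ X
      l∈ = ltr∈Λ i j′ ∈-pairʳ
      c∈ : c ∈ RW
      c∈ = letter∈RW l∈
      cancel : act c (ι y z′) ≈ ∅
      cancel = ≈-trans (act-letter l∈ (ι∈RW i j′)) (≈-trans (L-cong ≈-refl (op-cong
        (≈-sym (≈-trans (inv-form i j′ ∈-pairʳ) (op-cong ≈-refl flip-one))) ≈-refl)) (L-cancel (∅∈W X)))
      fixes : ∀ s → s ∈ Parity.V → par (act (ι y z) c) s ≈ s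
      fixes s k = ≈-trans (par-act (RW⊆W x∈) c∈ k) (≈-trans (par-letter (ltr∈Λ i j ∈-pairˡ) (par∈V (RW⊆W c∈) k))
        (≈-trans (turn-cong ≈-refl (par-letter l∈ k)) (turn-twice i j j′ k)))

    -- The first letter over a given set

    T₁ : D
    T₁ = ⋃ Y ∪ pair ∅ ∅

    -- A fold applies the leftmost letter last, so overwriting the second component leaves the first
    -- letter over `y`. Unlike parity this is not invariant under cancellation, hence a plain
    -- `Fold`, read off reduced words as they stand.
    module First = FibreAction T₁ v₀ (λ i j _ → proj₂ ∈-∪ (inl (proj₂ ∈-⋃ (_ , i , j))))
    module Fst = Fold X First.V First.turnₜ First.turn∈V
    open Fst public using () renaming (fold to first; foldₜ to firstₜ)

    -- The starting value `∅` may itself be an element of `y`. For this reason success is expressed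
    -- as membership of the outcome in `y`, not as a difference from `∅`.
    Found : Fm 2
    Found = ∃∈' ⌜ T₁ ⌝ (firstₜ ⟪ v₁ ∷ op' v₂ ⌜ ∅ ⌝ ∷ [] ⟫ ≈' op' v₂ v₀) ∧'
      (¬' (∃∈' v₁ (firstₜ ⟪ v₁ ∷ op' v₂ ⌜ ∅ ⌝ ∷ [] ⟫ ≈' op' v₂ v₀)) ⇒'
        ∀∈' ⌜ two ⌝ (parₜ ⟪ v₁ ∷ op' v₂ v₀ ∷ [] ⟫ ≈' op' v₂ v₀))

    found : ∀ {y} → y ∈ Y → ∀ w → w ∈ W X → ⟦ Found ⟧ (w ∷ y ∷ [])
    found {y} i = word-induction X (Found ⟨ v₀ ∷ ⌜ y ⌝ ∷ [] ⟩)
      ((∅ , ∅∈T₁ , Fst.fold-∅ s∈) , λ _ b j → par-∅ (op∈prod i j)) extend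
      where
      ∅∈T₁ : ∅ ∈ T₁
      ∅∈T₁ = proj₂ ∈-∪ (inr ∈-pairˡ)
      s∈ : op y ∅ ∈ First.V
      s∈ = op∈prod i ∅∈T₁
      extend : ∀ a u → a ∈ Λ X → u ∈ W X → ⟦ Found ⟧ (u ∷ y ∷ []) → ⟦ Found ⟧ (op a u ∷ y ∷ [])
      extend a u j k ((d , l , p) , h) =
          let (y′ , i′ , z , m , e , _ , q) = letter-form j in
          by-cases (y′ ≈ y) {⟦ Found ⟧ (op a u ∷ y ∷ [])} {{fm-stable Found (op a u ∷ y ∷ [])}}
            (λ f → hit f m q) (λ f → miss f q)
        where
        unfold : first (op a u) (op y ∅) ≈ First.turn a (op y d)
        unfold = ≈-trans (Fst.fold-cons j k s∈) (First.turn-cong ≈-refl p)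
        hit : ∀ {y′ z e} → y′ ≈ y → z ∈ y′ → a ≈ ltr y′ z e → ⟦ Found ⟧ (op a u ∷ y ∷ [])
        hit {y′} {z} {e} f m q = (z , proj₂ ∈-∪ (inl (proj₂ ∈-⋃ (y , i , m′))) , r) ,
            λ none → exfalso {{fm-stable (∀∈' ⌜ two ⌝ (parₜ ⟪ ⌜ op a u ⌝ ∷ op' ⌜ y ⌝ v₀ ∷ [] ⟫ ≈' op' ⌜ y ⌝ v₀)) []}}
              (none (z , m′ , r))
          where
          m′ : z ∈ y
          m′ = ∈-respʳ f m
          r : first (op a u) (op y ∅) ≈ op y z
          r = ≈-trans unfold (≈-trans (First.turn-cong (≈-trans q (op-cong (op-cong f ≈-refl) ≈-refl)) ≈-refl)
            (First.turn-hit i m′ l))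
        miss : ∀ {y′ z e} → ¬ y′ ≈ y → a ≈ ltr y′ z e → ⟦ Found ⟧ (op a u ∷ y ∷ [])
        miss f q = (d , l , r) , λ none b n → ≈-trans (par-cons j k (op∈prod i n)) (≈-trans (turn-cong q
            (h (λ (z , m , r′) → none (z , m , ≈-trans r (≈-trans (≈-sym p) r′))) b n)) (turn-miss i n f))
          where
          r : first (op a u) (op y ∅) ≈ op y d
          r = ≈-trans unfold (≈-trans (First.turn-cong q ≈-refl) (First.turn-miss i l f))

    -- `k` fixes the bit of `y` and `ι y z` flips it, so their product flips it; a word without
    -- letters over `y` could not.
    first-in-fibre : ∀ {y z k} → y ∈ Y → z ∈ y → k ∈ K →
      Σ D λ z′ → z′ ∈ y × first (act k (ι y z)) (op y ∅) ≈ op y z′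
    first-in-fibre {y} {z} {k} i j l = stable {{fm-stable
        (∃∈' ⌜ y ⌝ (firstₜ ⟪ ⌜ act k (ι y z) ⌝ ∷ op' ⌜ y ⌝ ⌜ ∅ ⌝ ∷ [] ⟫ ≈' op' ⌜ y ⌝ v₀)) []}} λ none →
      ∅≉one (op-injʳ (≈-trans (≈-sym (proj₂ (found i _ (RW⊆W (act∈RW (K⊆W l) (ι∈RW i j)))) none ∅ ∈-pairˡ)) flips))
      where
      flips : par (act k (ι y z)) (op y ∅) ≈ op y one
      flips = let s = op∈prod i ∈-pairˡ in ≈-trans (par-act (K⊆W l) (ι∈RW i j) s)
        (≈-trans (K-fixes l (par∈V (RW⊆W (ι∈RW i j)) s)) (≈-trans (par-letter (ltr∈Λ i j ∈-pairˡ) s)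
          (≈-trans (turn-hit i j ∈-pairˡ) (op-cong ≈-refl flip-∅))))

  -- Balls and the comparison of their radii

  infix 4 _⊑_
  _⊑_ : D → D → Set
  S ⊑ T = ∀ w → w ∈ S → w ∈ T

  -- The balls around the empty word in the Cayley graph of F(B).
  module Balls (B : D) where

    open FreeGroup B

    origin : D
    origin = pair ∅ ∅

    opaque
      -- Iterating from `origin` gives all words up to a given length, reduced or not. Only reduced
      -- words are ever tested for membership, and for them length is the distance from the empty
      -- word.
      next : D → D
      next S = origin ∪ prod (Λ B) S

      next-def : ∀ S → next S ≈ ⋃ (pair origin (prod (Λ B) S))
      next-def S = ≈-refl

      ∅∈next : ∀ {S} → ∅ ∈ next S
      ∅∈next = proj₂ ∈-∪ (inl ∈-pairˡ)

      cons∈next : ∀ {S c v} → c ∈ Λ B → v ∈ S → op c v ∈ next S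
      cons∈next i j = proj₂ ∈-∪ (inr (op∈prod i j))

      cons∈next⁻ : ∀ {S c v} → op c v ∈ next S → v ∈ S
      cons∈next⁻ i = or-elim (proj₁ ∈-∪ i) (λ j → exfalso (op≉∅ (proj₁ ∈-single j))) (λ j → proj₂ (op∈prod⁻ j))

      ∈next-elim : ∀ {S w} {C : Set} {{_ : Stable C}} → w ∈ next S → (w ≈ ∅ → C) →
                   (∀ c v → c ∈ Λ B → v ∈ S → w ≈ op c v → C) → C
      ∈next-elim {S} {w} {C} i f g = or-elim (proj₁ ∈-∪ i) (λ j → f (proj₁ ∈-single j)) (λ j → at (proj₁ ∈-prod j))
        where
        at : (Σ D λ c → c ∈ Λ B × (Σ D λ v → v ∈ S × w ≈ op c v)) → C
        at (c , k , v , l , e) = g c v k l e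

    nextₜ : Tm 1
    nextₜ = named₁ next (⋃' (pair' ⌜ origin ⌝ (prod' ⌜ Λ B ⌝ v₀))) next-def

    Ball : Fm 1
    Ball = ∀' (⌜ origin ⌝ ∈' v₀ ⇒' ∀∈' v₀ (nextₜ ⟪ v₀ ∷ [] ⟫ ∈' v₁) ⇒' v₁ ∈' v₀)

    IsBall : D → Set
    IsBall S = ∀ N → origin ∈ N → (∀ S → S ∈ N → next S ∈ N) → S ∈ N

    ball-origin : IsBall origin
    ball-origin N i _ = i

    ball-next : ∀ {S} → IsBall S → IsBall (next S)
    ball-next b N i c = c _ (b N i c)

    opaque
      balls : D
      balls = proj₁ (Iterates.family nextₜ origin)

      origin∈balls : origin ∈ balls
      origin∈balls = proj₁ (proj₂ (Iterates.family nextₜ origin))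

      next∈balls : ∀ S → S ∈ balls → next S ∈ balls
      next∈balls = proj₂ (proj₂ (Iterates.family nextₜ origin))

    -- `IsBall` quantifies over sets, so the balls with property `P` must form one; `balls` merely
    -- provides the set from which they are separated.
    ball-induction : (P : Fm 1) → ⟦ P ⟧ (origin ∷ []) →
      (∀ S → IsBall S → ⟦ P ⟧ (S ∷ []) → ⟦ P ⟧ (next S ∷ [])) → ∀ S → IsBall S → ⟦ P ⟧ (S ∷ [])
    ball-induction P base extend S b = proj₂ (proj₂ (proj₁ ∈-sep
        (b N (proj₂ ∈-sep (origin∈balls , ball-origin , base)) closed)))
      where
      N : D
      N = sep balls (Ball ∧' P) []
      closed : ∀ S → S ∈ N → next S ∈ N
      closed S i = at (proj₁ ∈-sep i)
        where
        at : S ∈ balls × IsBall S × ⟦ P ⟧ (S ∷ []) → next S ∈ N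
        at (j , b , p) = proj₂ ∈-sep (next∈balls S j , ball-next b , extend S b p)

    ball-∅ : ∀ S → IsBall S → ∅ ∈ S
    ball-∅ = ball-induction (⌜ ∅ ⌝ ∈' v₀) ∈-pairˡ (λ _ _ _ → ∅∈next)

    next-mono : ∀ {S T} → S ⊑ T → next S ⊑ next T
    next-mono h w i = ∈next-elim i (λ e → ∈-respˡ (≈-sym e) ∅∈next)
      (λ c v j k e → ∈-respˡ (≈-sym e) (cons∈next j (h v k)))

    origin⊑ : ∀ {S} → IsBall S → origin ⊑ S
    origin⊑ b w i = ∈-respˡ (≈-sym (proj₁ ∈-single i)) (ball-∅ _ b)

    ⊑next : ∀ S → IsBall S → S ⊑ next S
    ⊑next = ball-induction (∀' (v₀ ∈' v₁ ⇒' v₀ ∈' nextₜ ⟪ v₁ ∷ [] ⟫))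
      (origin⊑ (ball-next ball-origin)) (λ S b h → next-mono h)

    ball-tail : ∀ S → IsBall S → ∀ c v → op c v ∈ S → v ∈ S
    ball-tail = ball-induction (∀' (∀' (op' v₁ v₀ ∈' v₂ ⇒' v₀ ∈' v₂)))
      (λ c v i → exfalso (op≉∅ (proj₁ ∈-single i)))
      (λ S b _ c v i → ⊑next S b v (cons∈next⁻ i))

    -- Each letter of `w` costs one further step of `next`, starting from `S`.
    enlarge : ∀ w → w ∈ W B → ∀ S → IsBall S → Σ D λ T → IsBall T × S ⊑ T × w ∈ T
    enlarge = word-induction B
      (∀' (Ball ⟨ v₀ ∷ [] ⟩ ⇒' ∃' (Ball ⟨ v₀ ∷ [] ⟩ ∧' ∀' (v₀ ∈' v₂ ⇒' v₀ ∈' v₁) ∧' v₂ ∈' v₀)))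
      (λ S b → S , b , (λ _ i → i) , ball-∅ S b)
      λ a v i j ih S b → grow i (ih S b)
      where
      grow : ∀ {a v S} → a ∈ Λ B → (Σ D λ T → IsBall T × S ⊑ T × v ∈ T) → Σ D λ T → IsBall T × S ⊑ T × op a v ∈ T
      grow i (T , b , s , k) = next T , ball-next b , (λ w l → ⊑next T b w (s w l)) , cons∈next i k

    -- For radii this is the discrete dichotomy `m ≤ n` or `n + 1 ≤ m`, proved by a double
    -- induction.
    compare : ∀ S → IsBall S → ∀ T → IsBall T → S ⊑ T or next T ⊑ S
    compare = ball-induction
      (∀' (Ball ⟨ v₀ ∷ [] ⟩ ⇒' (∀' (v₀ ∈' v₂ ⇒' v₀ ∈' v₁) ∨' ∀' (v₀ ∈' nextₜ ⟪ v₁ ∷ [] ⟫ ⇒' v₀ ∈' v₂))))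
      (λ T b ¬s → exfalso (¬s (origin⊑ b)))
      λ S b ih → ball-induction
        (∀' (v₀ ∈' ⌜ next S ⌝ ⇒' v₀ ∈' v₁) ∨' ∀' (v₀ ∈' nextₜ ⟪ v₁ ∷ [] ⟫ ⇒' v₀ ∈' ⌜ next S ⌝))
        (λ _ → next-mono (origin⊑ b))
        (λ T c _ ¬s → next-mono (ih T c λ s → ¬s (next-mono s)))

    -- If c q p does not start with c, then all of c q cancels against p.
    shrink : ∀ q → q ∈ W B → ∀ c → op c q ∈ RW → ∀ p → p ∈ RW → ¬ ⟦ Starts ⟧ (c ∷ act (op c q) p ∷ []) →
             ∀ S → IsBall S → p ∈ next S → act (op c q) p ∈ S
    shrink = word-induction B
      (∀' (op' v₀ v₁ ∈' ⌜ RW ⌝ ⇒' ∀' (v₀ ∈' ⌜ RW ⌝ ⇒'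
        ¬' (Starts ⟨ v₁ ∷ actₜ ⟪ op' v₁ v₂ ∷ v₀ ∷ [] ⟫ ∷ [] ⟩) ⇒'
        ∀' (Ball ⟨ v₀ ∷ [] ⟩ ⇒' v₁ ∈' nextₜ ⟪ v₀ ∷ [] ⟫ ⇒' actₜ ⟪ op' v₂ v₃ ∷ v₁ ∷ [] ⟫ ∈' v₀))))
      (λ c r p i ns S b j → let k = proj₁ (cons∈W⁻ B (RW⊆W r)) ; e = act-letter k i in L-cases k i
        (λ t l e₁ e₂ → ∈-respˡ (≈-sym (≈-trans e e₂)) (cons∈next⁻ (∈-respˡ e₁ j)))
        (λ _ _ e₁ → exfalso (ns (p , ≈-trans e e₁))))
      λ d q i j ih c r p k ns S b l →
        let m = proj₁ (cons∈W⁻ B (RW⊆W r)) ; r′ = RW-tail r ; e = act-cons m (RW⊆W r′) k in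
        L-cases m (act∈RW (RW⊆W r′) k)
          (λ t n e₁ e₂ → ∈-respˡ (≈-sym (≈-trans e e₂)) (ball-tail S b (inv c) t (∈-respˡ e₁
            (ih d r′ p k (λ (u , e₃) → RW-head r (q , op-cong (op-injˡ (≈-trans (≈-sym e₃) e₁)) ≈-refl)) S b l))))
          (λ _ _ e₁ → exfalso (ns (_ , ≈-trans e e₁)))

  -- Distances and least covering balls in the coset trees

  module Tree (Y B f : D)
    (bij : Bijection f (Fibres.K Y) (FreeGroup.RW B))
    (hom : ∀ {k k′ p p′} → op k p ∈ f → op k′ p′ ∈ f →
           op (Fibres.act Y k k′) (FreeGroup.act B p p′) ∈ f) where

    open Fibres Y
    module FB = FreeGroup B
    open Balls B

    f-∈ : ∀ {k p} → op k p ∈ f → k ∈ K × p ∈ FB.RW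
    f-∈ i = op∈prod⁻ (proj₁ (proj₁ bij) _ i)

    f-total : ∀ {k} → k ∈ K → Σ D λ p → op k p ∈ f
    f-total i = let (p , j , _) = proj₂ (proj₁ bij) _ i in p , j

    f-unique : ∀ {k p p′} → op k p ∈ f → op k p′ ∈ f → p ≈ p′
    f-unique i j = let (_ , _ , u) = proj₂ (proj₁ bij) _ (proj₁ (f-∈ i)) in ≈-trans (u _ i) (≈-sym (u _ j))

    f-onto : ∀ {p} → p ∈ FB.RW → Σ D λ k → op k p ∈ f
    f-onto i = let (k , j , _) = proj₂ bij _ i in k , j

    f-injective : ∀ {k k′ p} → op k p ∈ f → op k′ p ∈ f → k ≈ k′
    f-injective i j = let (_ , _ , u) = proj₂ bij _ (proj₂ (f-∈ i)) in ≈-trans (u _ i) (≈-sym (u _ j))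

    -- The image of the identity is idempotent, and the only idempotent of a group is its identity.
    f-∅ : op ∅ ∅ ∈ f
    f-∅ = at (f-total ∅∈K)
      where
      at : (Σ D λ e → op ∅ e ∈ f) → op ∅ ∅ ∈ f
      at (e , i) = ∈-respˡ (op-cong ≈-refl (FB.act-cancelʳ e∈ FB.∅∈RW e∈ (≈-trans
          (f-unique (∈-respˡ (op-cong (act-∅ ∅∈RW) ≈-refl) (hom i i)) i) (≈-sym (FB.act-∅ e∈))))) i
        where
        e∈ : e ∈ FB.RW
        e∈ = proj₂ (f-∈ i)

    -- `p` labels the path from `ι y z` to `v` in the tree, so membership of `p` in the ball `S`
    -- bounds the distance by the radius of `S`.
    Within : D → D → D → D → Set
    Within y z v S = Σ D λ k → k ∈ K × (Σ D λ p → op k p ∈ f × act k (ι y z) ≈ v × p ∈ S)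

    WithinF : Fm 4
    WithinF = ∃∈' ⌜ K ⌝ (∃' (op' v₁ v₀ ∈' ⌜ f ⌝ ∧'
      actₜ ⟪ v₁ ∷ op' (op' (op' v₂ v₃) ⌜ ∅ ⌝) ⌜ ∅ ⌝ ∷ [] ⟫ ≈' v₄ ∧' v₀ ∈' v₅))

    Near : D → D → D → Set
    Near y v S = v ∈ RW × (∀ z → z ∈ y → Within y z v S)

    NearF : Fm 3
    NearF = v₁ ∈' ⌜ RW ⌝ ∧' ∀∈' v₀ (WithinF ⟨ v₁ ∷ v₀ ∷ v₂ ∷ v₃ ∷ [] ⟩)

    Covered : D → D → Set
    Covered y S = Σ D λ v → Near y v S

    CoveredF : Fm 2
    CoveredF = ∃' (NearF ⟨ v₁ ∷ v₀ ∷ v₂ ∷ [] ⟩)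

    -- Covering is monotone in the ball, so it is enough to exclude the ball one step smaller; at
    -- radius zero there is nothing to exclude.
    Minimal : D → D → Set
    Minimal y S = S ≈ origin or (Σ D λ T → IsBall T × S ≈ next T × (¬ Covered y T))

    MinimalF : Fm 2
    MinimalF = v₁ ≈' ⌜ origin ⌝ ∨' ∃' (Ball ⟨ v₀ ∷ [] ⟩ ∧' v₂ ≈' nextₜ ⟪ v₀ ∷ [] ⟫ ∧' ¬' (CoveredF ⟨ v₁ ∷ v₀ ∷ [] ⟩))

    Least : D → D → Set
    Least y S = IsBall S × Covered y S × Minimal y S

    LeastF : Fm 2
    LeastF = Ball ⟨ v₁ ∷ [] ⟩ ∧' CoveredF ∧' MinimalF

    within-mono : ∀ {y z v S T} → S ⊑ T → Within y z v S → Within y z v T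
    within-mono s (k , i , p , j , e , l) = k , i , p , j , e , s p l

    near-mono : ∀ {y v S T} → S ⊑ T → Near y v S → Near y v T
    near-mono s (i , h) = i , λ z j → within-mono s (h z j)

    least-⊑ : ∀ {y S T} → Least y S → IsBall T → Covered y T → S ⊑ T
    least-⊑ {y} {S} {T} (_ , _ , m) b (v , n) = or-elim m (λ e w i → origin⊑ b w (∈-respʳ e i)) at
      where
      at : (Σ D λ S′ → IsBall S′ × S ≈ next S′ × (¬ Covered y S′)) → S ⊑ T
      at (S′ , b′ , e , nc) = or-elim (compare T b S′ b′) (λ s → exfalso (nc (v , near-mono s n)))
        (λ s w i → s w (∈-respʳ e i))

    least-unique : ∀ {y S T} → Least y S → Least y T → S ≈ T
    least-unique l m = extensional λ w →
      least-⊑ l (proj₁ m) (proj₁ (proj₂ m)) w , least-⊑ m (proj₁ l) (proj₁ (proj₂ l)) w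

    least-exists : ∀ {y} S → IsBall S → Covered y S → Σ D λ T → Least y T
    least-exists {y} = ball-induction (CoveredF ⟨ ⌜ y ⌝ ∷ v₀ ∷ [] ⟩ ⇒' ∃' (LeastF ⟨ ⌜ y ⌝ ∷ v₀ ∷ [] ⟩))
      (λ c → origin , ball-origin , c , inl {{fm-stable
        (∃' (Ball ⟨ v₀ ∷ [] ⟩ ∧' ⌜ origin ⌝ ≈' nextₜ ⟪ v₀ ∷ [] ⟫ ∧' ¬' (CoveredF ⟨ ⌜ y ⌝ ∷ v₀ ∷ [] ⟩))) []}} ≈-refl)
      λ S b ih c → by-cases (Covered y S) {Σ D (Least y)} {{fm-stable (∃' (LeastF ⟨ ⌜ y ⌝ ∷ v₀ ∷ [] ⟩)) []}} ih
        (λ nc → next S , ball-next b , c , λ _ → S , b , ≈-refl , nc)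

    -- Each point of a finite fibre is joined to ι y z₀, and finitely many words lie in one ball.
    module _ {y z₀ n g : D} (y∈Y : y ∈ Y) (z₀∈y : z₀ ∈ y) (natural : Natural n) (enum : Bijection g y n) where

      joined : ∀ {z} → z ∈ y → Σ D λ k → k ∈ K × (Σ D λ p → op k p ∈ f × act k (ι y z) ≈ ι y z₀)
      joined {z} i = at (connect y∈Y z₀∈y i)
        where
        at : (Σ D λ k → k ∈ K × act k (ι y z) ≈ ι y z₀) →
             Σ D λ k → k ∈ K × (Σ D λ p → op k p ∈ f × act k (ι y z) ≈ ι y z₀)
        at (k , j , e) = let (p , l) = f-total j in k , j , p , l , e

      BoundedF : Fm 1
      BoundedF = ∃' (Ball ⟨ v₀ ∷ [] ⟩ ∧' ∀∈' ⌜ y ⌝ (∀∈' v₂ (op' v₁ v₀ ∈' ⌜ g ⌝ ⇒'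
        WithinF ⟨ ⌜ y ⌝ ∷ v₁ ∷ ⌜ ι y z₀ ⌝ ∷ v₂ ∷ [] ⟩)))

      Bounded : D → Set
      Bounded m = Σ D λ S → IsBall S × (∀ z → z ∈ y → ∀ i → i ∈ m → op z i ∈ g → Within y z (ι y z₀) S)

      bounded-suc : ∀ m → Bounded m → Bounded (sucˢ m)
      -- The induction runs over all natural numbers, so `m` may lie outside the range of the
      -- enumeration; in that case the old ball still serves.
      bounded-suc m (S , b , h) = by-cases (Σ D λ z → z ∈ y × op z m ∈ g) {Bounded (sucˢ m)}
          {{fm-stable BoundedF (sucˢ m ∷ [])}}
          (λ (z , i , j) → extend i j (joined i))
          (λ none → S , b , λ z i m′ j l → or-elim {{within-stable}} (proj₁ ∈-suc j) (λ j′ → h z i m′ j′ l)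
            (λ e → exfalso {{within-stable}} (none (z , i , ∈-respˡ (op-cong ≈-refl e) l))))
        where
        within-stable : ∀ {z S} → Stable (Within y z (ι y z₀) S)
        within-stable {z} {S} = fm-stable WithinF (y ∷ z ∷ ι y z₀ ∷ S ∷ [])
        extend : ∀ {z} → z ∈ y → op z m ∈ g →
                 (Σ D λ k → k ∈ K × (Σ D λ p → op k p ∈ f × act k (ι y z) ≈ ι y z₀)) → Bounded (sucˢ m)
        extend {z} i j (k , k∈ , p , kp , e) = at (enlarge p (FB.RW⊆W (proj₂ (f-∈ kp))) S b)
          where
          at : (Σ D λ T → IsBall T × S ⊑ T × p ∈ T) → Bounded (sucˢ m)
          at (T , c , s , p∈) = T , c , λ z′ i′ m′ j′ l → or-elim {{within-stable}} (proj₁ ∈-suc j′)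
              (λ j″ → within-mono s (h z′ i′ m′ j″ l))
              (λ eq → k , k∈ , p , kp , ≈-trans (act-cong ≈-refl (op-cong (op-cong (op-cong ≈-refl
                (same (∈-respˡ (op-cong ≈-refl eq) l))) ≈-refl) ≈-refl)) e , p∈)
            where
            same : ∀ {z′} → op z′ m ∈ g → z′ ≈ z
            same l = let (_ , _ , u) = proj₂ enum m (proj₂ (op∈prod⁻ (proj₁ (proj₁ enum) _ j))) in
              ≈-trans (u _ l) (≈-sym (u _ j))

      bounded : ∀ m → Natural m → Bounded m
      bounded = natural-induction BoundedF
        (origin , ball-origin , λ z _ i j → exfalso
          {{stable-Π {{fm-stable WithinF (y ∷ z ∷ ι y z₀ ∷ origin ∷ [])}}}} (∉-∅ j))
        λ m _ → bounded-suc m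

      least : Σ D λ S → Least y S
      least = at (bounded n natural)
        where
        at : Bounded n → Σ D λ S → Least y S
        at (S , b , h) = least-exists S b (ι y z₀ , ι∈RW y∈Y z₀∈y ,
          λ z i → let (j , l , _) = proj₂ (proj₁ enum) z i in h z i j (proj₂ (op∈prod⁻ (proj₁ (proj₁ enum) _ l))) l)

    Long : D → Set
    Long q = Σ D λ c → Σ D λ d → Σ D λ r → q ≈ op c (op d r)

    -- `q` labels the path from `v` to `v′`. As `K` acts from the left, the leftmost letter of `q`
    -- is the edge arriving at `v′`.
    Joins : D → D → D → D → Set
    Joins v v′ κ q = op κ q ∈ f × v′ ≈ act κ v

    module _ {y v v′ κ q S : D} (y∈Y : y ∈ Y) (J : Joins v v′ κ q) where

      κ∈ : κ ∈ K
      κ∈ = proj₁ (f-∈ (proj₁ J))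

      q∈ : q ∈ FB.RW
      q∈ = proj₂ (f-∈ (proj₁ J))

      -- The element of `K` that carries `ι y z` to a given vertex is unique by right cancellation.
      -- Hence `k′` is the product of `κ` and `k`, and labels multiply accordingly.
      joins-word : ∀ {z k p k′ p′} → z ∈ y → op k p ∈ f → act k (ι y z) ≈ v → op k′ p′ ∈ f → act k′ (ι y z) ≈ v′ →
                   p′ ≈ FB.act q p
      joins-word {z} {k} {p} {k′} {p′} i kp e kp′ e′ =
          f-unique kp′ (∈-respˡ (op-cong (≈-sym same) ≈-refl) (hom (proj₁ J) kp))
        where
        k∈ : k ∈ K
        k∈ = proj₁ (f-∈ kp)
        same : k′ ≈ act κ k
        same = act-cancelʳ (K⊆RW (proj₁ (f-∈ kp′))) (act∈RW (K⊆W κ∈) (K⊆RW k∈)) (ι∈RW y∈Y i)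
          (≈-trans e′ (≈-trans (proj₂ J) (≈-trans (act-cong ≈-refl (≈-sym e))
            (≈-sym (act-act (K⊆W κ∈) (K⊆RW k∈) (ι∈RW y∈Y i))))))

      short-origin : ∀ {z} → z ∈ y → S ≈ origin → Within y z v S → Within y z v′ S → q ≈ ∅
      short-origin i e (k , _ , p , kp , ek , p∈) (k′ , _ , p′ , kp′ , ek′ , p′∈) =
          ≈-trans (≈-sym (FB.act-identityʳ q∈)) (≈-trans (FB.act-cong ≈-refl (≈-sym (empty p∈)))
            (≈-trans (≈-sym (joins-word i kp ek kp′ ek′)) (empty p′∈)))
        where
        empty : ∀ {p} → p ∈ S → p ≈ ∅
        empty p∈ = proj₁ ∈-single (∈-respʳ e p∈)

      -- The vertex one step before v′ on the path from v to v′ is nearer to every point of the fibre.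
      midpoint : ∀ {c d r T} → IsBall T → S ≈ next T → q ≈ op c (op d r) → Near y v S → Near y v′ S → Covered y T
      midpoint {c} {d} {r} {T} b e eq (v∈ , n) (_ , n′) = at (f-onto tail∈)
        where
        q∈′ : op c (op d r) ∈ FB.RW
        q∈′ = ∈-respˡ eq q∈
        tail∈ : op d r ∈ FB.RW
        tail∈ = FB.RW-tail q∈′
        c∈ : c ∈ Λ B
        c∈ = proj₁ (cons∈W⁻ B (FB.RW⊆W q∈′))
        closer : ∀ {p p′} → p ∈ FB.RW → p ∈ S → p′ ∈ S → p′ ≈ FB.act q p → FB.act (op d r) p ∈ T
        -- If `c` cancels against the product of `op d r` and `p`, this product starts with `inv c`
        -- and hence not with `d`, as `q` is reduced; `shrink` makes it shorter than `p`. Otherwise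
        -- it is `p′` without its first letter. Either way one step of `next` is saved.
        closer {p} {p′} p∈ p∈S p′∈S e′ = FB.L-cases c∈ (FB.act∈RW (FB.RW⊆W tail∈) p∈)
            (λ t _ e₁ _ → shrink r (FB.RW⊆W (FB.RW-tail tail∈)) d tail∈ p p∈
              (λ (u , e₂) → FB.RW-head q∈′ (r , op-cong (op-injˡ (≈-trans (≈-sym e₂) e₁)) ≈-refl)) T b (∈-respʳ e p∈S))
            (λ _ _ e₁ → cons∈next⁻ (∈-resp (≈-trans unfold e₁) e p′∈S))
          where
          unfold : p′ ≈ FB.L c (FB.act (op d r) p)
          unfold = ≈-trans e′ (≈-trans (FB.act-cong eq ≈-refl) (FB.act-cons c∈ (FB.RW⊆W tail∈) p∈))
        at : (Σ D λ k → op k (op d r) ∈ f) → Covered y T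
        at (k , kd) = act k v , act∈RW (K⊆W k∈) v∈ , λ z i → step-at i (n z i) (n′ z i)
          where
          k∈ : k ∈ K
          k∈ = proj₁ (f-∈ kd)
          step-at : ∀ {z} → z ∈ y → Within y z v S → Within y z v′ S → Within y z (act k v) T
          step-at i (k₁ , k₁∈ , p , kp , e₁ , p∈S) (k₂ , _ , p′ , kp′ , e₂ , p′∈S) =
            act k k₁ , act∈K k∈ k₁∈ , FB.act (op d r) p , hom kd kp ,
            ≈-trans (act-act (K⊆W k∈) (K⊆RW k₁∈) (ι∈RW y∈Y i)) (act-cong ≈-refl e₁) ,
            closer (proj₂ (f-∈ kp)) p∈S p′∈S (joins-word i kp e₁ kp′ e₂)

      short : ∀ {z} → z ∈ y → Minimal y S → Near y v S → Near y v′ S → ¬ Long q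
      short {z} i m n n′ (c , d , r , e) = or-elim m
        (λ eS → op≉∅ (≈-trans (≈-sym e) (short-origin i eS (proj₂ n z i) (proj₂ n′ z i))))
        (λ (T , b , eS , nc) → nc (midpoint b eS e n n′))

    -- Both vertices are reached from the same point `ι y z`, by `k` and `k′`; the joining element
    -- is `k′` times the inverse of `k`.
    joins : ∀ {y z v v′ S} → y ∈ Y → z ∈ y → Near y v S → Near y v′ S → Σ D λ κ → Σ D λ q → Joins v v′ κ q
    joins {y} {z} {v} {v′} {S} y∈Y i (v∈ , n) (_ , n′) = at (n z i) (n′ z i)
      where
      x∈ : ι y z ∈ RW
      x∈ = ι∈RW y∈Y i
      at : Within y z v S → Within y z v′ S → Σ D λ κ → Σ D λ q → Joins v v′ κ q
      at (k , k∈ , _ , _ , e , _) (k′ , k′∈ , _ , _ , e′ , _) = at₂ (inverse∈K k∈)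
        where
        at₂ : (Σ D λ u → u ∈ K × act k u ≈ ∅ × act u k ≈ ∅) → Σ D λ κ → Σ D λ q → Joins v v′ κ q
        at₂ (u , u∈ , _ , e₂) = let κ∈ = act∈K k′∈ u∈ ; (q , κq) = f-total κ∈ in act k′ u , q , κq ,
          ≈-trans (≈-sym e′) (≈-sym (≈-trans (act-cong ≈-refl (≈-sym e)) (≈-trans (act-act (K⊆W k′∈) (K⊆RW u∈) v∈′)
            (act-cong ≈-refl (≈-trans (≈-sym (act-act (K⊆W u∈) (K⊆RW k∈) x∈)) (≈-trans (act-cong e₂ ≈-refl) (act-∅ x∈)))))))
          where
          v∈′ : act k (ι y z) ∈ RW
          v∈′ = act∈RW (K⊆W k∈) x∈

    -- Orientation and the canonical central vertex

    Precedes : D → D → Set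
    Precedes v′ v = Σ D λ b → b ∈ B × (Σ D λ κ → Joins v′ v κ (op (op b ∅) ∅))

    PrecedesF : Fm 2
    PrecedesF = ∃∈' ⌜ B ⌝ (∃' (op' v₀ (op' (op' v₁ ⌜ ∅ ⌝) ⌜ ∅ ⌝) ∈' ⌜ f ⌝ ∧' v₃ ≈' actₜ ⟪ v₀ ∷ v₂ ∷ [] ⟫))

    -- The centre of a finite set in a tree can be an edge, whose two ends are indistinguishable
    -- without an orientation. The sign of the letter of `B` breaks this symmetry.
    Source : D → D → D → Set
    Source y v S = ¬ (Σ D λ v′ → Near y v′ S × Precedes v′ v)

    Central : D → D → Set
    Central y v = Σ D λ S → Least y S × Near y v S × Source y v S

    CentralF : Fm 2
    CentralF = ∃' (LeastF ⟨ v₁ ∷ v₀ ∷ [] ⟩ ∧' NearF ⟨ v₁ ∷ v₂ ∷ v₀ ∷ [] ⟩ ∧'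
      ¬' (∃' (NearF ⟨ v₂ ∷ v₀ ∷ v₁ ∷ [] ⟩ ∧' PrecedesF ⟨ v₀ ∷ v₃ ∷ [] ⟩)))

    central-exists : ∀ {y z S} → y ∈ Y → z ∈ y → Least y S → Σ D λ v → Central y v
    central-exists {y} {z} {S} y∈Y i l@(_ , (v , n) , m) =
        -- If `v` has a predecessor `v′` among the near vertices, then `v′` is a source: a
        -- predecessor of `v′` would be joined to `v` by two positive letters, which cannot cancel,
        -- against `short`.
        by-cases (Σ D λ v′ → Near y v′ S × Precedes v′ v) {Σ D (Central y)}
          {{fm-stable (∃' (CentralF ⟨ ⌜ y ⌝ ∷ v₀ ∷ [] ⟩)) []}}
          (λ (v′ , n′ , pr) → v′ , S , l , n′ , λ (v″ , n″ , pr′) → twice n″ pr′ pr) (λ s → v , S , l , n , s)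
      where
      twice : ∀ {v′ v″} → Near y v″ S → Precedes v″ v′ → Precedes v′ v → R
      twice {v′} {v″} n″ (b′ , b′∈ , κ′ , κb′ , e′) (b , b∈ , κ , κb , e) =
          short y∈Y (hom κb κb′ , e″) i m n″ n (_ , _ , _ , word)
        where
        e″ : v ≈ act (act κ κ′) v″
        e″ = ≈-trans e (≈-trans (act-cong ≈-refl e′)
          (≈-sym (act-act (K⊆W (proj₁ (f-∈ κb))) (K⊆RW (proj₁ (f-∈ κb′))) (proj₁ n″))))
        word : FB.act (op (op b ∅) ∅) (op (op b′ ∅) ∅) ≈ op (op b ∅) (op (op b′ ∅) ∅)
        word = ≈-trans (FB.act-letter (pos∈Λ b∈) (FB.letter∈RW (pos∈Λ b′∈)))
          (FB.L-cons (pos∈Λ b∈) (FB.RW⊆W (FB.letter∈RW (pos∈Λ b′∈)))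
            λ (_ , e₁) → ∅≉one (op-injʳ (≈-trans (op-injˡ e₁) (FB.inv-pos b∈))))

    joins-reverse : ∀ {v v′ κ b} → v ∈ RW → b ∈ B → Joins v v′ κ (op (op b one) ∅) → Precedes v′ v
    joins-reverse {v} {v′} {κ} {b} v∈ b∈ (κq , e) = b , b∈ , at (f-onto (FB.letter∈RW (pos∈Λ b∈)))
      where
      at : (Σ D λ k → op k (op (op b ∅) ∅) ∈ f) → Σ D λ k → Joins v′ v k (op (op b ∅) ∅)
      at (k , kb) = k , kb , ≈-sym (≈-trans (act-cong ≈-refl e) (≈-trans
          (≈-sym (act-act (K⊆W (proj₁ (f-∈ kb))) (K⊆RW (proj₁ (f-∈ κq))) v∈))
          (≈-trans (act-cong (f-injective (∈-respˡ (op-cong ≈-refl cancel) (hom kb κq)) f-∅) ≈-refl) (act-∅ v∈))))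
        where
        cancel : FB.act (op (op b ∅) ∅) (op (op b one) ∅) ≈ ∅
        cancel = ≈-trans (FB.act-letter (pos∈Λ b∈) (FB.letter∈RW (neg∈Λ b∈)))
          (≈-trans (FB.L-cong ≈-refl (op-cong (≈-sym (FB.inv-pos b∈)) ≈-refl)) (FB.L-cancel (∅∈W B)))

    -- Both vertices refer to the same least ball, so at most one letter lies between them; a letter
    -- of either sign would make one vertex a predecessor of the other.
    central-unique : ∀ {y z v v′} → y ∈ Y → z ∈ y → Central y v → Central y v′ → v ≈ v′
    central-unique {y} {z} {v} {v′} y∈Y i (S , l , n , s) (S′ , l′ , n′₀ , s′₀) = at (joins y∈Y i n n′)
      where
      S′≈S : S′ ≈ S
      S′≈S = least-unique l′ l
      n′ : Near y v′ S
      n′ = near-mono (λ w → ∈-respʳ S′≈S) n′₀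
      s′ : Source y v′ S
      s′ (u , nu , pr) = s′₀ (u , near-mono (λ w → ∈-respʳ (≈-sym S′≈S)) nu , pr)
      at : (Σ D λ κ → Σ D λ q → Joins v v′ κ q) → v ≈ v′
      at (κ , q , κq , e) = or-elim (word-cases B (FB.RW⊆W (proj₂ (f-∈ κq)))) trivial
          (λ (c , c∈ , r , r∈ , eq) → or-elim (word-cases B r∈) (λ er → letter c∈ (≈-trans eq (op-cong ≈-refl er)))
            (λ (d , _ , t , _ , er) → exfalso (short y∈Y (κq , e) i (proj₂ (proj₂ l)) n n′
              (c , d , t , ≈-trans eq (op-cong ≈-refl er)))))
        where
        trivial : q ≈ ∅ → v ≈ v′
        trivial eq = ≈-sym (≈-trans e (≈-trans (act-cong (f-injective (∈-respˡ (op-cong ≈-refl eq) κq) f-∅) ≈-refl)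
          (act-∅ (proj₁ n))))
        letter : ∀ {c} → c ∈ Λ B → q ≈ op c ∅ → v ≈ v′
        letter c∈ eq = ∈Λ-elim c∈
          (λ b b∈ ec → exfalso (s′ (v , n , b , b∈ , κ ,
            ∈-respˡ (op-cong ≈-refl (≈-trans eq (op-cong ec ≈-refl))) κq , e)))
          (λ b b∈ ec → exfalso (s (v′ , n′ , joins-reverse (proj₁ n) b∈
            (∈-respˡ (op-cong ≈-refl (≈-trans eq (op-cong ec ≈-refl))) κq , e))))

  -- Isomorphisms in the model

  Homomorphism : D → D → D → Set
  Homomorphism f m l = ∀ {a b c a′ b′ c′} → op (op a b) c ∈ m → op a a′ ∈ f → op b b′ ∈ f → op c c′ ∈ f →
                       op (op a′ b′) c′ ∈ l

  isIsomorphism⁻ : ∀ {f g m h l} →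
    ⟪ IsIsomorphism zero (suc zero) (suc (suc zero)) (suc (suc (suc zero))) (suc (suc (suc (suc zero)))) ⟫ˢ
      (f ∷ g ∷ m ∷ h ∷ l ∷ []) →
    Bijection f g h × Homomorphism f m l
  isIsomorphism⁻ {f} {g} {m} {h} {l} (b , k) = isBijection⁻ {f} {g} {h} b ,
    λ {x} {y} {z} {x′} {y′} {z′} i j₁ j₂ j₃ → proj₁ (isMult {l} {x′} {y′} {z′})
      (k x y z (proj₂ (isMult {m} {x} {y} {z}) i) x′ y′ z′
        (proj₂ (related {f} {x} {x′}) j₁ , proj₂ (related {f} {y} {y′}) j₂ , proj₂ (related {f} {z} {z′}) j₃))

  isIsomorphism⁺ : ∀ {f g m h l} → Bijection f g h → Homomorphism f m l →
    ⟪ IsIsomorphism zero (suc zero) (suc (suc zero)) (suc (suc (suc zero))) (suc (suc (suc (suc zero)))) ⟫ˢ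
      (f ∷ g ∷ m ∷ h ∷ l ∷ [])
  isIsomorphism⁺ {f} {g} {m} {h} {l} b k = isBijection⁺ {f} {g} {h} b ,
    λ x y z i x′ y′ z′ (j₁ , j₂ , j₃) → proj₂ (isMult {l} {x′} {y′} {z′}) (k (proj₁ (isMult {m} {x} {y} {z}) i)
      (proj₁ (related {f} {x} {x′}) j₁) (proj₁ (related {f} {y} {y′}) j₂) (proj₁ (related {f} {z} {z′}) j₃))

  opaque
    diagonal : D → D
    diagonal g = sep (prod g g) (∃' (v₁ ≈' op' v₀ v₀)) []

    ∈-diagonal : ∀ {g x y} → op x y ∈ diagonal g ↔ (x ∈ g × x ≈ y)
    ∈-diagonal {g} {x} {y} = to , λ (i , e) → proj₂ ∈-sep (op∈prod i (∈-respˡ e i) , x , op-cong ≈-refl (≈-sym e))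
      where
      to : op x y ∈ sep (prod g g) (∃' (v₁ ≈' op' v₀ v₀)) [] → x ∈ g × x ≈ y
      to i = proj₁ (op∈prod⁻ (proj₁ (proj₁ ∈-sep i))) ,
        ≈-trans (op-injˡ (proj₂ (proj₂ (proj₁ ∈-sep i)))) (≈-sym (op-injʳ (proj₂ (proj₂ (proj₁ ∈-sep i)))))

    diagonal⊑ : ∀ {g} p → p ∈ diagonal g → p ∈ prod g g
    diagonal⊑ p i = proj₁ (proj₁ ∈-sep i)

  diagonal-bijection : ∀ {g} → Bijection (diagonal g) g g
  diagonal-bijection = (diagonal⊑ ,
    (λ x i → x , proj₂ ∈-diagonal (i , ≈-refl) , λ y j → ≈-sym (proj₂ (proj₁ ∈-diagonal j)))) ,
    (λ x i → x , proj₂ ∈-diagonal (i , ≈-refl) , λ y j → proj₂ (proj₁ ∈-diagonal j))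

  diagonal-homomorphism : ∀ {g m} → Homomorphism (diagonal g) m m
  diagonal-homomorphism i j₁ j₂ j₃ = ∈-respˡ (op-cong (op-cong (proj₂ (proj₁ ∈-diagonal j₁))
    (proj₂ (proj₁ ∈-diagonal j₂))) (proj₂ (proj₁ ∈-diagonal j₃))) i

  free-isFree : ∀ A → ⟪ IsFree zero (suc zero) ⟫ˢ (FreeGroup.RW A ∷ FreeGroup.MulRW A ∷ [])
  free-isFree A = RW-isGroup , A , RW , MulRW , diagonal RW , isFreeGroupOn ,
    isIsomorphism⁺ {diagonal RW} {RW} {MulRW} {RW} {MulRW} diagonal-bijection diagonal-homomorphism
    where open FreeGroup A

  Finite : D → Set
  Finite y = Σ D λ n → Σ D λ g → Natural n × Bijection g y n

  ChoiceFunction : D → D → Set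
  ChoiceFunction c Y = (Σ D λ b → Function c Y b) × (∀ y → y ∈ Y → Σ D λ z → z ∈ y × op y z ∈ c)

  -- The choice function and the conclusion

  module Choice (Y B f : D)
    (bij : Bijection f (Fibres.K Y) (FreeGroup.RW B))
    (hom : ∀ {k k′ p p′} → op k p ∈ f → op k′ p′ ∈ f →
           op (Fibres.act Y k k′) (FreeGroup.act B p p′) ∈ f)
    (finite : ∀ y → y ∈ Y → (Σ D λ z → z ∈ y) × Finite y) where

    open Fibres Y
    open Tree Y B f bij hom

    ChosenF : Fm 1
    ChosenF = ∃' (∃' (∃' (v₃ ≈' op' v₂ v₁ ∧' CentralF ⟨ v₂ ∷ v₀ ∷ [] ⟩ ∧'
      firstₜ ⟪ v₀ ∷ op' v₂ ⌜ ∅ ⌝ ∷ [] ⟫ ≈' op' v₂ v₁)))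

    Chosen : D → D → Set
    Chosen y z = Σ D λ v → Central y v × first v (op y ∅) ≈ op y z

    opaque
      -- `B` and `f` are fixed before any `y` is considered, so a single application of Separation
      -- defines the values for all `y` simultaneously.
      choice : D
      choice = sep (prod Y (⋃ Y)) ChosenF []

      choice⊑ : ∀ p → p ∈ choice → p ∈ prod Y (⋃ Y)
      choice⊑ p i = proj₁ (proj₁ ∈-sep i)

      choice-∈ : ∀ {y z} → y ∈ Y → z ∈ y → Chosen y z → op y z ∈ choice
      choice-∈ {y} {z} i j (v , c , e) = proj₂ ∈-sep
        (op∈prod i (proj₂ ∈-⋃ (y , i , j)) , y , z , v , ≈-refl , c , e)

      choice-∈⁻ : ∀ {y z} → op y z ∈ choice → Chosen y z
      choice-∈⁻ {y} {z} i = at (proj₂ (proj₁ ∈-sep i))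
        where
        at : ⟦ ChosenF ⟧ (op y z ∷ []) → Chosen y z
        at (y′ , z′ , v , e , c , e′) = v ,
          leibniz (CentralF ⟨ v₀ ∷ ⌜ v ⌝ ∷ [] ⟩) {ρ = []} (≈-sym (op-injˡ e)) c ,
          ≈-trans (Fst.fold-cong ≈-refl (op-cong (op-injˡ e) ≈-refl)) (≈-trans e′ (≈-sym e))

    chosen-unique : ∀ {y z z₁ z₂} → y ∈ Y → z ∈ y → Chosen y z₁ → Chosen y z₂ → z₁ ≈ z₂
    chosen-unique i j (v , c , e) (v′ , c′ , e′) = op-injʳ (≈-trans (≈-sym e)
      (≈-trans (Fst.fold-cong (central-unique i j c c′) ≈-refl) e′))

    -- The point and the enumeration taken from `finite` serve only to establish existence; by
    -- `chosen-unique` the value does not depend on them.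
    chosen-exists : ∀ y → y ∈ Y → Σ D λ z → z ∈ y × Chosen y z
    chosen-exists y i = at (finite y i)
      where
      find : ∀ {v} → (z : D) → z ∈ y → Central y v → Σ D λ z′ → z′ ∈ y × Chosen y z′
      find {v} z j c@(S , _ , n , _) = within (proj₂ n z j)
        where
        within : Within y z v S → Σ D λ z′ → z′ ∈ y × Chosen y z′
        within (k , k∈ , _ , _ , e , _) = at₂ (first-in-fibre i j k∈)
          where
          at₂ : (Σ D λ z′ → z′ ∈ y × first (act k (ι y z)) (op y ∅) ≈ op y z′) → Σ D λ z′ → z′ ∈ y × Chosen y z′
          at₂ (z′ , j′ , e′) = z′ , j′ , v , c , ≈-trans (Fst.fold-cong (≈-sym e) ≈-refl) e′
      at : (Σ D λ z → z ∈ y) × Finite y → Σ D λ z → z ∈ y × Chosen y z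
      at ((z , j) , (n , g , natural , enum)) =
        let (S , l) = least i j natural enum ; (v , c) = central-exists i j l in find z j c

    choice-function : ChoiceFunction choice Y
    choice-function = (⋃ Y , choice⊑ , λ y i → total y i (chosen-exists y i)) , λ y i → value y i (chosen-exists y i)
      where
      total : ∀ y → y ∈ Y → (Σ D λ z → z ∈ y × Chosen y z) →
              Σ D λ z → op y z ∈ choice × (∀ z′ → op y z′ ∈ choice → z′ ≈ z)
      total y i (z , j , c) = z , choice-∈ i j c , λ z′ k → chosen-unique i j (choice-∈⁻ k) c
      value : ∀ y → y ∈ Y → (Σ D λ z → z ∈ y × Chosen y z) → Σ D λ z → z ∈ y × op y z ∈ choice
      value y i (z , j , c) = z , j , choice-∈ i j c

  module _ (Y : D) (finite : ∀ y → y ∈ Y → (Σ D λ z → z ∈ y) × Finite y) where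

    open Fibres Y

    MulK⊑MulRW : ∀ t → t ∈ MulK → t ∈ MulRW
    MulK⊑MulRW t i = at (proj₁ ∈-MulK i)
      where
      at : (Σ D λ u → u ∈ K × (Σ D λ v → v ∈ K × t ≈ op (op u v) (act u v))) → t ∈ MulRW
      at (u , i , v , j , e) = proj₂ ∈-MulRW (u , K⊆RW i , v , K⊆RW j , e)

    -- The free group supplied by the principle is known only through its defining formula. Its
    -- carrier and products are first identified with `FB.RW` and `FB.act`, which turns the
    -- isomorphism into the form required by `Tree`.
    choose-from-basis : ∀ {B W′ M′ f} → ⟪ IsFreeGroupOn zero (suc zero) (suc (suc zero)) ⟫ˢ (B ∷ W′ ∷ M′ ∷ []) →
      Bijection f K W′ → Homomorphism f MulK M′ → Σ D λ c → ChoiceFunction c Y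
    choose-from-basis {B} {W′} {M′} {f} free ((into , total) , onto) h = choice , choice-function
      where
      module FB = FreeGroup B
      W′↔RW : ∀ {w} → w ∈ W′ ↔ w ∈ FB.RW
      W′↔RW {w} = FB.free-RW {W′} {M′} free {w}
      bij : Bijection f K FB.RW
      bij = ((λ p i → ∈-respʳ (tm-cong₂ (prod' v₀ v₁) ≈-refl (extensional λ w → W′↔RW)) (into p i)) , total) ,
        λ p i → onto p (proj₂ W′↔RW i)
      hom : ∀ {k k′ p p′} → op k p ∈ f → op k′ p′ ∈ f → op (act k k′) (FB.act p p′) ∈ f
      hom {k} {k′} {p} {p′} i j = at (total (act k k′) (act∈K k∈ k′∈))
        where
        k∈ : k ∈ K
        k∈ = proj₁ (op∈prod⁻ (into _ i))
        k′∈ : k′ ∈ K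
        k′∈ = proj₁ (op∈prod⁻ (into _ j))
        at : (Σ D λ q → op (act k k′) q ∈ f × (∀ q′ → op (act k k′) q′ ∈ f → q′ ≈ q)) →
             op (act k k′) (FB.act p p′) ∈ f
        at (q , l , _) = ∈-respˡ (op-cong ≈-refl (FB.free-act {W′} {M′} free
          (h (proj₂ ∈-MulK₃ (k∈ , k′∈ , ≈-refl)) i j l))) l
      open Choice Y B f bij hom finite

    nielsen-schreier-choice : ⟪ NS ⟫ˢ [] → Σ D λ c → ChoiceFunction c Y
    nielsen-schreier-choice ns = at (ns RW MulRW K MulK (free-isFree X , K-isGroup , (λ w → K⊆RW) , MulK⊑MulRW))
      where
      at : ⟪ IsFree zero (suc zero) ⟫ˢ (K ∷ MulK ∷ []) → Σ D λ c → ChoiceFunction c Y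
      at (_ , B , W′ , M′ , f , free , iso) = choose-from-basis {B} {W′} {M′} {f} free (proj₁ iso′) (proj₂ iso′)
        where
        iso′ : Bijection f K W′ × Homomorphism f MulK M′
        iso′ = isIsomorphism⁻ {f} {K} {MulK} {W′} {M′} iso

  finite⁻ : ∀ {y} → ⟪ IsFinite zero ⟫ˢ (y ∷ []) → Finite y
  finite⁻ {y} (n , g , natural , b) = n , g , natural , isBijection⁻ {g} {y} {n} b

  choiceFunction⁺ : ∀ {c Y} → ChoiceFunction c Y → ⟪ IsChoiceFunction zero (suc zero) ⟫ˢ (c ∷ Y ∷ [])
  choiceFunction⁺ {c} {Y} ((b , g) , h) = (b , isFunction⁺ {c} {Y} {b} g) , value
    where
    value : ∀ y → y ∈ Y → Σ D λ z → z ∈ y × ⟪ Related zero (suc zero) (suc (suc zero)) ⟫ˢ (c ∷ y ∷ z ∷ [])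
    value y i = let (z , j , k) = h y i in z , j , proj₂ (related {c} {y} {z}) k

  NS⇒ACfin : ⟪ NS ⟫ˢ [] → ⟪ ACfin ⟫ˢ []
  NS⇒ACfin ns Y finite = at
      (nielsen-schreier-choice Y (λ y i → proj₁ (finite y i) , finite⁻ {y} (proj₂ (finite y i))) ns)
    where
    at : (Σ D λ c → ChoiceFunction c Y) → Σ D λ c → ⟪ IsChoiceFunction zero (suc zero) ⟫ˢ (c ∷ Y ∷ [])
    at (c , h) = c , choiceFunction⁺ {c} {Y} h

  satisfied : Sat (NS ⇒ ACfin) []
  satisfied ns = proj₁ (⟪⟫ˢ↔sat ACfin []) (NS⇒ACfin (proj₂ (⟪⟫ˢ↔sat NS []) ns))

mainTheorem2 : ZF ⊢ NS ⇒ ACfin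
mainTheorem2 = provable (NS ⇒ ACfin) InModel.satisfied
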